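{- For $n,k\ge 0$ let $w_{n,k}$ be the number of weakly graded $(\mathbf{3+1})$-avoiding posets on the vertex set $[n]$ of height $k$, and let $w_n=\sum_k w_{n,k}$. Let $\Psi(x)=\sum_{m,n\ge 0}\frac{2^{mn}x^{m+n}}{m!\,n!}$. Then $$\sum_{n,k} w_{n,k}\frac{x^n}{n!}t^k = 1+(e^x-1)t+(e^{ -x}\Psi(x)-e^x)t^2 + t^3\,\frac{e^{3x}+e^{3x}t-e^x\big(2e^x+(1+2e^x-e^{2x})t\big)\Psi(x)-\big((1-3e^x+e^{2x})+(e^x-2)t\big)\Psi(x)^2}{e^x(e^x+te^x+t^2)+\big((1-3e^x+e^{2x})t+(e^x-2)t^2\big)\Psi(x)},$$ and $$\sum_{n\ge 0} w_n\frac{x^n}{n!} = (e^{ -x}-1)\Psi(x)+\frac{2e^{3x}+e^{2x}(e^x-2)\Psi(x)}{e^x(2e^x+1)+(e^{2x}-2e^x-1)\Psi(x)}.$$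
   Context: All posets are finite; a poset on $[n]=\{1,\dots,n\}$ is a partial order on this labeled set, and distinct order relations give distinct posets. A poset $P$ is weakly graded if there is a function $\operatorname{rk}:P\to\mathbb{N}$ such that $\operatorname{rk}(b)=\operatorname{rk}(a)+1$ whenever $b$ covers $a$, and such that the minimum value of $\operatorname{rk}$ on each connected component of $P$ is $0$. The height of a poset is the number of elements in a longest chain (the empty poset has height $0$). A poset is $(\mathbf{3+1})$-avoiding if there are no four elements $x,y,z,w$ with $x<y<z$ and $w$ incomparable to each of $x,y,z$. -}

module Defs where

open import Data.Nat as ℕ using (ℕ; zero; suc; _≤_; _!; _^_)
import Data.Nat.Properties as ℕP
open import Data.Integer using (+_)
open import Data.Rational as ℚ using (ℚ; 0ℚ; 1ℚ; -_; 1/_)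
open import Data.Rational.Properties using (_≟_)
open import Data.Fin using (Fin)
open import Data.Vec using (Vec; lookup)
open import Data.Bool using (Bool; T)
open import Data.List using (List; []; _∷_; length)
open import Data.List.Membership.Propositional using (_∈_)
open import Data.List.Relation.Unary.Unique.Propositional using (Unique)
open import Data.Product using (Σ; ∃; _×_; _,_)
open import Data.Sum using (_⊎_)
open import Relation.Nullary using (¬_; yes; no)
open import Relation.Binary.PropositionalEquality using (_≡_; _≢_)
open import Relation.Binary.Construct.Closure.ReflexiveTransitive using (Star)
open import Function.Bundles using (_⇔_)

-- Posets on [n] = Fin n, given by their (Boolean) order matrix.
-- Distinct matrices = distinct order relations = distinct posets.

Relation : ℕ → Set
Relation n = Vec (Vec Bool n) n

Le : ∀ {n} → Relation n → Fin n → Fin n → Set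
Le R x y = T (lookup (lookup R x) y)

Lt : ∀ {n} → Relation n → Fin n → Fin n → Set
Lt R x y = Le R x y × x ≢ y

record IsPoset {n} (R : Relation n) : Set where
  field
    reflexive     : ∀ x → Le R x x
    antisymmetric : ∀ x y → Le R x y → Le R y x → x ≡ y
    transitive    : ∀ x y z → Le R x y → Le R y z → Le R x z

Comparable : ∀ {n} → Relation n → Fin n → Fin n → Set
Comparable R x y = Le R x y ⊎ Le R y x

Incomparable : ∀ {n} → Relation n → Fin n → Fin n → Set
Incomparable R x y = ¬ Comparable R x y

Covers : ∀ {n} → Relation n → Fin n → Fin n → Set
Covers R a b = Lt R a b × (∀ c → ¬ (Lt R a c × Lt R c b))

SameComponent : ∀ {n} → Relation n → Fin n → Fin n → Set
SameComponent R = Star (Comparable R)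

-- weakly graded: a rank function rk : P → ℕ with rk b = rk a + 1 whenever
-- b covers a, whose minimum on each connected component is 0 (since ranks
-- are ≥ 0, this means: every component contains an element of rank 0).
WeaklyGraded : ∀ {n} → Relation n → Set
WeaklyGraded {n} R =
  Σ (Fin n → ℕ) λ rk →
    (∀ a b → Covers R a b → rk b ≡ suc (rk a)) ×
    (∀ a → ∃ λ b → SameComponent R a b × rk b ≡ 0)

Avoids3+1 : ∀ {n} → Relation n → Set
Avoids3+1 R = ∀ x y z w → Lt R x y → Lt R y z →
  ¬ (Incomparable R w x × Incomparable R w y × Incomparable R w z)

data IsChain {n} (R : Relation n) : List (Fin n) → Set where
  []  : IsChain R []
  [_] : ∀ x → IsChain R (x ∷ [])
  _∷_ : ∀ {x y xs} → Lt R x y → IsChain R (y ∷ xs) → IsChain R (x ∷ y ∷ xs)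

HasChainOfSize : ∀ {n} → Relation n → ℕ → Set
HasChainOfSize R k = Σ _ λ xs → IsChain R xs × length xs ≡ k

HasHeight : ∀ {n} → Relation n → ℕ → Set
HasHeight R k = HasChainOfSize R k × (∀ j → HasChainOfSize R j → j ≤ k)

Counted : (n k : ℕ) → Relation n → Set
Counted n k R = IsPoset R × WeaklyGraded R × Avoids3+1 R × HasHeight R k

IsCardinality : ∀ {A : Set} → (A → Set) → ℕ → Set
IsCardinality {A} P m =
  Σ (List A) λ L → Unique L × length L ≡ m × (∀ a → (a ∈ L) ⇔ P a)

-- Formal power series in x, t over ℚ:  f n k = coefficient of x^n t^k.

Series : Set
Series = ℕ → ℕ → ℚ

sumTo : ℕ → (ℕ → ℚ) → ℚ
sumTo zero    f = f 0
sumTo (suc n) f = sumTo n f ℚ.+ f (suc n)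

infixl 6 _⊕_ _⊖_
infixl 7 _⊗_

_⊕_ : Series → Series → Series
(f ⊕ g) n k = f n k ℚ.+ g n k

⊝_ : Series → Series
(⊝ f) n k = - f n k

_⊖_ : Series → Series → Series
f ⊖ g = f ⊕ (⊝ g)

_⊗_ : Series → Series → Series
(f ⊗ g) n k = sumTo n λ i → sumTo k λ j → f i j ℚ.* g (n ℕ.∸ i) (k ℕ.∸ j)

const : ℚ → Series
const c zero zero = c
const c _    _    = 0ℚ

𝟙 : Series
𝟙 = const 1ℚ

𝕥 : Series
𝕥 zero (suc zero) = 1ℚ
𝕥 _    _          = 0ℚ

pow : Series → ℕ → Series
pow f zero    = 𝟙
pow f (suc j) = f ⊗ pow f j

scale : ℚ → Series → Series
scale c f n k = c ℚ.* f n k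

-- multiplicative inverse of a series with nonzero constant term c:
--   1/f = c⁻¹ Σ_{j ≥ 0} (1 - c⁻¹ f)^j,
-- where only j ≤ n + k contributes to the coefficient of x^n t^k.
-- (If c = 0 the series is not invertible; we then return 0.)
inv : Series → Series
inv f with f 0 0 ≟ 0ℚ
... | yes _ = const 0ℚ
... | no c≢0 = λ n k → (scale c⁻¹ (λ n′ k′ → sumTo (n ℕ.+ k) λ j → pow g j n′ k′)) n k
  where
  c⁻¹ : ℚ
  c⁻¹ = 1/_ (f 0 0) {{ℚ.≢-nonZero c≢0}}
  g : Series
  g = 𝟙 ⊖ scale c⁻¹ f

infixl 7 _⊘_
_⊘_ : Series → Series → Series
f ⊘ g = f ⊗ inv g

natℚ : ℕ → ℚ
natℚ m = + m ℚ./ 1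

inv! : ℕ → ℚ
inv! m = (+ 1 ℚ./ (m !)) {{ℕP._!≢0 m}}

eˣ : Series
eˣ n zero    = inv! n
eˣ n (suc _) = 0ℚ

e⁻ˣ : Series
e⁻ˣ n zero    = ((Data.Integer.-_ (+ 1)) Data.Integer.^ n ℚ./ (n !)) {{ℕP._!≢0 n}}
  where import Data.Integer
e⁻ˣ n (suc _) = 0ℚ

Ψ : Series
Ψ N zero    = sumTo N λ m → natℚ (2 ^ (m ℕ.* (N ℕ.∸ m))) ℚ.* inv! m ℚ.* inv! (N ℕ.∸ m)
Ψ N (suc _) = 0ℚ

ℤc : ℕ → Series
ℤc m = const (natℚ m)

e²ˣ e³ˣ : Series
e²ˣ = eˣ ⊗ eˣ
e³ˣ = eˣ ⊗ eˣ ⊗ eˣ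

RHS₁ : Series
RHS₁ = 𝟙 ⊕ (eˣ ⊖ 𝟙) ⊗ 𝕥 ⊕ (e⁻ˣ ⊗ Ψ ⊖ eˣ) ⊗ pow 𝕥 2
     ⊕ pow 𝕥 3 ⊗ (numer ⊘ denom)
  where
  numer denom : Series
  numer = e³ˣ ⊕ e³ˣ ⊗ 𝕥
        ⊖ eˣ ⊗ (ℤc 2 ⊗ eˣ ⊕ (𝟙 ⊕ ℤc 2 ⊗ eˣ ⊖ e²ˣ) ⊗ 𝕥) ⊗ Ψ
        ⊖ ((𝟙 ⊖ ℤc 3 ⊗ eˣ ⊕ e²ˣ) ⊕ (eˣ ⊖ ℤc 2) ⊗ 𝕥) ⊗ pow Ψ 2
  denom = eˣ ⊗ (eˣ ⊕ 𝕥 ⊗ eˣ ⊕ pow 𝕥 2)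
        ⊕ ((𝟙 ⊖ ℤc 3 ⊗ eˣ ⊕ e²ˣ) ⊗ 𝕥 ⊕ (eˣ ⊖ ℤc 2) ⊗ pow 𝕥 2) ⊗ Ψ

RHS₂ : Series
RHS₂ = (e⁻ˣ ⊖ 𝟙) ⊗ Ψ
     ⊕ (ℤc 2 ⊗ e³ˣ ⊕ e²ˣ ⊗ (eˣ ⊖ ℤc 2) ⊗ Ψ)
       ⊘ (eˣ ⊗ (ℤc 2 ⊗ eˣ ⊕ 𝟙) ⊕ (e²ˣ ⊖ ℤc 2 ⊗ eˣ ⊖ 𝟙) ⊗ Ψ)

EGF₂ : (ℕ → ℕ → ℕ) → Series
EGF₂ w n k = natℚ (w n k) ℚ.* inv! n

-- Σ_n w_n x^n/n!  (no t-dependence), w_n = Σ_k w_{n,k}; a poset on [n]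
-- has height ≤ n, so the sum over k can be cut at n.
EGF₁ : (ℕ → ℕ → ℕ) → Series
EGF₁ w n zero    = natℚ (sumℕ n) ℚ.* inv! n
  where
  sumℕ : ℕ → ℕ
  sumℕ zero    = w n 0
  sumℕ (suc k) = sumℕ k ℕ.+ w n (suc k)
EGF₁ w n (suc _) = 0ℚ

{-# OPTIONS --safe #-}

-- Let R have height k ≥ 3.  If two elements of ranks differing by at least 2 were incomparable, or if some
-- element were neither above the whole level below nor below the whole level above it, then there would be
-- a chain of three elements incomparable to a fourth.  Hence R is given by its levels L_i, the sets
-- D_i ⊆ L_i of elements above all of L_{i−1}, with U_i = L_{i+1} ∖ D_{i+1}, and 0/1 matrices K_i on
-- D_i × U_i without full columns; all other relations are forced.  That every cover raises the rank by one
-- means: it never happens that U_{i−1} = ∅ or K_{i−1} has an empty row, and also D_i = ∅ or K_i has an empty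
-- column.  The indicator of this event is a function of K_{i−1} times a function of K_i, so the
-- generating functions by height are computed by a 2 × 2 transfer matrix, whose entries follow from Ψ by
-- inclusion–exclusion.  By Cayley–Hamilton they satisfy a linear recurrence in the height, which yields the
-- fraction in t; summing the recurrence over all heights yields the second formula.

module Submission where

-- Power series

open import Defs
open import Algebra.Bundles using (CommutativeRing)
open import Data.Nat as ℕ using (ℕ; zero; suc; _∸_)
import Data.Nat.Properties as ℕP
open import Data.Rational as ℚ using (ℚ; 0ℚ; 1ℚ)
import Data.Rational.Properties as ℚP
open import Data.Product using (_×_; _,_; proj₁; proj₂)
open import Level using (0ℓ)
open import Relation.Binary.PropositionalEquality as ≡ using (_≡_; refl; cong; cong₂; sym; trans)

-- Products of series are reached through vertex colourings. Attach to a relation the vector of the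
-- blocks and sides of its vertices: the order is then a condition on each matrix entry separately,
-- and the inclusion-exclusion tags turn the conditions on whole rows and columns into conditions of
-- this kind too. So the sum over all relations factorises over pairs of vertices, and what is left
-- is a colour sum whose exponential generating function is multiplicative over colours that do not
-- interact. Untagged lower and upper elements of one block interact with factor 2, the origin of Ψ;
-- each tag of sign -1 gives a factor e⁻ˣ. The vector is unique because levels are values of the
-- rank function and an upper element is one that misses something in the level below, which is what
-- a column that is not full records. Height 3 is the threshold because a chain of three elements
-- makes any two elements two ranks apart comparable, hence the poset connected; in smaller heights
-- isolated elements may occur, and a single block describes them.

module PowerSeries (R : CommutativeRing 0ℓ 0ℓ) where
  open CommutativeRing R renaming (Carrier to A)
  open import Relation.Binary.Reasoning.Setoid setoid
  open import Algebra.Properties.CommutativeSemigroup +-commutativeSemigroup using (interchange)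

  infix 4 _≋_
  _≋_ : (ℕ → A) → (ℕ → A) → Set
  f ≋ g = ∀ n → f n ≈ g n

  -- Recursion on the first factor, so that the ring laws follow by induction on the degree without
  -- handling of truncated differences; `conv-sum` returns to the usual sum.
  conv : (ℕ → A) → (ℕ → A) → ℕ → A
  conv f g zero    = f 0 * g 0
  conv f g (suc n) = f 0 * g (suc n) + conv (λ i → f (suc i)) g n

  sumUpTo : ℕ → (ℕ → A) → A
  sumUpTo zero    h = h 0
  sumUpTo (suc n) h = sumUpTo n h + h (suc n)

  sumUpTo-cong : ∀ n {f g} → (∀ i → i ℕ.≤ n → f i ≈ g i) → sumUpTo n f ≈ sumUpTo n g
  sumUpTo-cong zero    eq = eq 0 ℕ.z≤n
  sumUpTo-cong (suc n) eq =
    +-cong (sumUpTo-cong n (λ i i≤n → eq i (ℕP.m≤n⇒m≤1+n i≤n))) (eq (suc n) ℕP.≤-refl)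

  sumUpTo-first : ∀ n h → sumUpTo (suc n) h ≈ h 0 + sumUpTo n (λ i → h (suc i))
  sumUpTo-first zero    h = CommutativeRing.refl R
  sumUpTo-first (suc n) h =
    CommutativeRing.trans R (+-congʳ (sumUpTo-first n h)) (+-assoc _ _ _)

  conv-sum : ∀ f g n → conv f g n ≈ sumUpTo n (λ i → f i * g (n ∸ i))
  conv-sum f g zero    = CommutativeRing.refl R
  conv-sum f g (suc n) = begin
    f 0 * g (suc n) + conv (λ i → f (suc i)) g n
      ≈⟨ +-congˡ (conv-sum (λ i → f (suc i)) g n) ⟩
    f 0 * g (suc n) + sumUpTo n (λ i → f (suc i) * g (n ∸ i))
      ≈⟨ sumUpTo-first n (λ i → f i * g (suc n ∸ i)) ⟨
    sumUpTo (suc n) (λ i → f i * g (suc n ∸ i)) ∎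

  conv-cong : ∀ {f f′ g g′} → f ≋ f′ → g ≋ g′ → conv f g ≋ conv f′ g′
  conv-cong p q zero    = *-cong (p 0) (q 0)
  conv-cong p q (suc n) = +-cong (*-cong (p 0) (q (suc n))) (conv-cong (λ i → p (suc i)) q n)

  conv-last : ∀ f g n → conv f g (suc n) ≈ conv f (λ i → g (suc i)) n + f (suc n) * g 0
  conv-last f g zero    = CommutativeRing.refl R
  conv-last f g (suc n) =
    CommutativeRing.trans R (+-congˡ (conv-last (λ i → f (suc i)) g n)) (CommutativeRing.sym R (+-assoc _ _ _))

  conv-comm : ∀ f g → conv f g ≋ conv g f
  conv-comm f g zero    = *-comm _ _
  conv-comm f g (suc n) = begin
    f 0 * g (suc n) + conv (λ i → f (suc i)) g n ≈⟨ +-cong (*-comm _ _) (conv-comm _ g n) ⟩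
    g (suc n) * f 0 + conv g (λ i → f (suc i)) n ≈⟨ +-comm _ _ ⟩
    conv g (λ i → f (suc i)) n + g (suc n) * f 0 ≈⟨ conv-last g f n ⟨
    conv g f (suc n) ∎

  conv-distribʳ : ∀ h f g n → conv (λ i → f i + g i) h n ≈ conv f h n + conv g h n
  conv-distribʳ h f g zero    = distribʳ _ _ _
  conv-distribʳ h f g (suc n) = begin
    (f 0 + g 0) * h (suc n) + conv (λ i → f (suc i) + g (suc i)) h n
      ≈⟨ +-cong (distribʳ _ _ _) (conv-distribʳ h _ _ n) ⟩
    (f 0 * h (suc n) + g 0 * h (suc n)) + (conv (λ i → f (suc i)) h n + conv (λ i → g (suc i)) h n)
      ≈⟨ interchange _ _ _ _ ⟩
    conv f h (suc n) + conv g h (suc n) ∎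

  conv-scaleˡ : ∀ a f g n → conv (λ i → a * f i) g n ≈ a * conv f g n
  conv-scaleˡ a f g zero    = *-assoc _ _ _
  conv-scaleˡ a f g (suc n) = begin
    a * f 0 * g (suc n) + conv (λ i → a * f (suc i)) g n ≈⟨ +-cong (*-assoc _ _ _) (conv-scaleˡ a _ g n) ⟩
    a * (f 0 * g (suc n)) + a * conv (λ i → f (suc i)) g n ≈⟨ distribˡ _ _ _ ⟨
    a * conv f g (suc n) ∎

  conv-assoc : ∀ f g h → conv (conv f g) h ≋ conv f (conv g h)
  conv-assoc f g h zero    = *-assoc _ _ _
  conv-assoc f g h (suc n) = begin
    f 0 * g 0 * h (suc n) + conv (λ i → f 0 * g (suc i) + conv f′ g i) h n
      ≈⟨ +-cong (*-assoc _ _ _) (conv-distribʳ h (λ i → f 0 * g (suc i)) (conv f′ g) n) ⟩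
    f 0 * (g 0 * h (suc n)) + (conv (λ i → f 0 * g (suc i)) h n + conv (conv f′ g) h n)
      ≈⟨ +-congˡ (+-cong (conv-scaleˡ (f 0) _ h n) (conv-assoc f′ g h n)) ⟩
    f 0 * (g 0 * h (suc n)) + (f 0 * conv (λ i → g (suc i)) h n + conv f′ (conv g h) n)
      ≈⟨ +-assoc _ _ _ ⟨
    f 0 * (g 0 * h (suc n)) + f 0 * conv (λ i → g (suc i)) h n + conv f′ (conv g h) n
      ≈⟨ +-congʳ (distribˡ _ _ _) ⟨
    conv f (conv g h) (suc n) ∎
    where f′ = λ i → f (suc i)

  one : ℕ → A
  one zero    = 1#
  one (suc _) = 0#

  conv-zeroˡ : ∀ g n → conv (λ _ → 0#) g n ≈ 0#
  conv-zeroˡ g zero    = zeroˡ _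
  conv-zeroˡ g (suc n) =
    CommutativeRing.trans R (+-cong (zeroˡ _) (conv-zeroˡ g n)) (+-identityˡ _)

  conv-oneˡ : ∀ g → conv one g ≋ g
  conv-oneˡ g zero    = *-identityˡ _
  conv-oneˡ g (suc n) =
    CommutativeRing.trans R (+-cong (*-identityˡ _) (conv-zeroˡ g n)) (+-identityʳ _)

  commutativeRing : CommutativeRing 0ℓ 0ℓ
  commutativeRing = record
    { Carrier = ℕ → A ; _≈_ = _≋_
    ; _+_ = λ f g n → f n + g n ; _*_ = conv
    ; -_ = λ f n → - f n ; 0# = λ _ → 0# ; 1# = one
    ; isCommutativeRing = record
      { isRing = record
        { +-isAbelianGroup = record
          { isGroup = record
            { isMonoid = record
              { isSemigroup = record
                { isMagma = record
                  { isEquivalence = record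
                    { refl = λ _ → CommutativeRing.refl R
                    ; sym = λ p n → CommutativeRing.sym R (p n)
                    ; trans = λ p q n → CommutativeRing.trans R (p n) (q n) }
                  ; ∙-cong = λ p q n → +-cong (p n) (q n) }
                ; assoc = λ _ _ _ _ → +-assoc _ _ _ }
              ; identity = (λ _ _ → +-identityˡ _) , (λ _ _ → +-identityʳ _) }
            ; inverse = (λ _ _ → -‿inverseˡ _) , (λ _ _ → -‿inverseʳ _)
            ; ⁻¹-cong = λ p n → -‿cong (p n) }
          ; comm = λ _ _ _ → +-comm _ _ }
        ; *-cong = conv-cong
        ; *-assoc = conv-assoc
        ; *-identity = conv-oneˡ , λ f n → CommutativeRing.trans R (conv-comm f one n) (conv-oneˡ f n)
        ; distrib = (λ f g h n → CommutativeRing.trans R (conv-comm f _ n)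
                       (CommutativeRing.trans R (conv-distribʳ f g h n)
                         (+-cong (conv-comm g f n) (conv-comm h f n))))
                  , conv-distribʳ }
      ; *-comm = conv-comm } }

module PS₁ = PowerSeries ℚP.+-*-commutativeRing
module PS₂ = PowerSeries PS₁.commutativeRing
private module Nested = CommutativeRing PS₂.commutativeRing

infix 4 _≐_
_≐_ : Series → Series → Set
f ≐ g = ∀ n k → f n k ≡ g n k

sumTo-cong : ∀ n {f g} → (∀ i → i ℕ.≤ n → f i ≡ g i) → sumTo n f ≡ sumTo n g
sumTo-cong zero    eq = eq 0 ℕ.z≤n
sumTo-cong (suc n) eq =
  cong₂ ℚ._+_ (sumTo-cong n (λ i i≤n → eq i (ℕP.m≤n⇒m≤1+n i≤n))) (eq (suc n) ℕP.≤-refl)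

sumUpTo≡sumTo : ∀ n h → PS₁.sumUpTo n h ≡ sumTo n h
sumUpTo≡sumTo zero    h = refl
sumUpTo≡sumTo (suc n) h = cong (ℚ._+ h (suc n)) (sumUpTo≡sumTo n h)

sumUpTo-at : ∀ n (h : ℕ → ℕ → ℚ) k → PS₂.sumUpTo n h k ≡ sumTo n (λ i → h i k)
sumUpTo-at zero    h k = refl
sumUpTo-at (suc n) h k = cong (ℚ._+ h (suc n) k) (sumUpTo-at n h k)

-- `Series` is ℚ[[t]][[x]] with the exponent of x as outer index. Addition and negation agree with
-- those of the nested ring by definition, so the product and the two constants are all that must be
-- compared to import the ring laws.
⊗-nested : ∀ f g → f ⊗ g ≐ PS₂.conv f g
⊗-nested f g n k = sym (trans (PS₂.conv-sum f g n k) (trans (sumUpTo-at n _ k)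
  (sumTo-cong n λ i _ → trans (PS₁.conv-sum (f i) (g (n ∸ i)) k) (sumUpTo≡sumTo k _))))

one-nested : 𝟙 ≐ PS₂.one
one-nested zero    zero    = refl
one-nested zero    (suc k) = refl
one-nested (suc n) zero    = refl
one-nested (suc n) (suc k) = refl

zero-nested : const 0ℚ ≐ λ _ _ → 0ℚ
zero-nested zero    zero    = refl
zero-nested zero    (suc k) = refl
zero-nested (suc n) zero    = refl
zero-nested (suc n) (suc k) = refl

⊗-cong : ∀ {f f′ g g′} → f ≐ f′ → g ≐ g′ → f ⊗ g ≐ f′ ⊗ g′
⊗-cong p q n k = sumTo-cong n λ i _ → sumTo-cong k λ j _ → cong₂ ℚ._*_ (p i j) (q _ _)

seriesRing : CommutativeRing 0ℓ 0ℓ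
seriesRing = record
  { Carrier = Series ; _≈_ = _≐_ ; _+_ = _⊕_ ; _*_ = _⊗_ ; -_ = ⊝_
  ; 0# = const 0ℚ ; 1# = 𝟙
  ; isCommutativeRing = record
    { isRing = record
      { +-isAbelianGroup = record
        { isGroup = record
          { isMonoid = record
            { isSemigroup = record
              { isMagma = record
                { isEquivalence = Nested.isEquivalence
                ; ∙-cong = Nested.+-cong }
              ; assoc = Nested.+-assoc }
            ; identity = (λ f n k → trans (cong (ℚ._+ f n k) (zero-nested n k)) (ℚP.+-identityˡ _))
                       , (λ f n k → trans (cong (f n k ℚ.+_) (zero-nested n k)) (ℚP.+-identityʳ _)) }
          ; inverse = (λ f n k → trans (Nested.-‿inverseˡ f n k) (sym (zero-nested n k)))
                    , (λ f n k → trans (Nested.-‿inverseʳ f n k) (sym (zero-nested n k)))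
          ; ⁻¹-cong = Nested.-‿cong }
        ; comm = Nested.+-comm }
      ; *-cong = ⊗-cong
      ; *-assoc = λ f g h n k →
          trans (⊗-nested (f ⊗ g) h n k)
          (trans (Nested.*-congʳ {h} (⊗-nested f g) n k)
          (trans (Nested.*-assoc f g h n k)
          (sym (trans (⊗-nested f (g ⊗ h) n k) (Nested.*-congˡ {f} (⊗-nested g h) n k)))))
      ; *-identity = idˡ , λ f n k → trans (comm f 𝟙 n k) (idˡ f n k)
      ; distrib = (λ f g h n k → trans (comm f (g ⊕ h) n k) (trans (distʳ f g h n k)
                     (cong₂ ℚ._+_ (comm g f n k) (comm h f n k))))
                , distʳ }
    ; *-comm = comm } }
  where
  comm : ∀ f g → f ⊗ g ≐ g ⊗ f
  comm f g n k = trans (⊗-nested f g n k) (trans (Nested.*-comm f g n k) (sym (⊗-nested g f n k)))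
  idˡ : ∀ f → 𝟙 ⊗ f ≐ f
  idˡ f n k = trans (⊗-nested 𝟙 f n k) (trans (Nested.*-congʳ {f} one-nested n k) (Nested.*-identityˡ f n k))
  distʳ : ∀ h f g → (f ⊕ g) ⊗ h ≐ f ⊗ h ⊕ g ⊗ h
  distʳ h f g n k = trans (⊗-nested (f ⊕ g) h n k) (trans (Nested.distribʳ h f g n k)
    (sym (cong₂ ℚ._+_ (⊗-nested f h n k) (⊗-nested g h n k))))

-- Ring solver for series, and the multiplicative inverse

open import Algebra.Bundles using (RawRing)
import Algebra.Solver.Ring
open import Algebra.Solver.Ring.AlmostCommutativeRing using (fromCommutativeRing; _-Raw-AlmostCommutative⟶_)
open import Data.Integer as ℤ using (ℤ; -[1+_]) renaming (+_ to pos)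
import Data.Integer.Properties as ℤP
open import Data.Rational using (mkℚ)
import Algebra.Properties.Group
open import Data.Nat.Coprimality using (1-coprimeTo) renaming (sym to coprime-sym)
open import Data.Maybe using (Maybe; just; nothing)
open import Data.Product using (Σ)
open import Data.Sum using (_⊎_; inj₁; inj₂)
open import Data.Empty using (⊥-elim)
open import Relation.Nullary using (¬_; yes; no)
open import Relation.Binary.PropositionalEquality using (_≢_; subst)

module Ser = CommutativeRing seriesRing
private module ℚG = Algebra.Properties.Group ℚP.+-0-group

integer : ℤ → ℚ
integer z = z ℚ./ 1

private
  -- The denominator is literally 1, so sums and products of such rationals unfold, whereas `z / 1`
  -- is stuck on the normalisation by a gcd.
  integer′ : ℤ → ℚ
  integer′ z = mkℚ z 0 (coprime-sym (1-coprimeTo ℤ.∣ z ∣))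

  integer≡ : ∀ z → integer z ≡ integer′ z
  integer≡ z = ℚP.↥p/↧p≡p (integer′ z)

integer-+ : ∀ a b → integer (a ℤ.+ b) ≡ integer a ℚ.+ integer b
integer-+ a b = sym (trans (cong₂ ℚ._+_ (integer≡ a) (integer≡ b))
  (cong integer (cong₂ ℤ._+_ (ℤP.*-identityʳ a) (ℤP.*-identityʳ b))))

integer-* : ∀ a b → integer (a ℤ.* b) ≡ integer a ℚ.* integer b
integer-* a b = sym (cong₂ ℚ._*_ (integer≡ a) (integer≡ b))

integer-neg : ∀ a → integer (ℤ.- a) ≡ ℚ.- integer a
integer-neg (pos zero)  = refl
integer-neg (pos (suc n)) = refl
integer-neg -[1+ n ]  = sym (ℚG.⁻¹-involutive (integer (pos (suc n))))

natℚ-+ : ∀ a b → natℚ (a ℕ.+ b) ≡ natℚ a ℚ.+ natℚ b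
natℚ-+ a b = integer-+ (pos a) (pos b)

natℚ-* : ∀ a b → natℚ (a ℕ.* b) ≡ natℚ a ℚ.* natℚ b
natℚ-* a b = trans (cong integer (ℤP.pos-* a b)) (integer-* (pos a) (pos b))

*-annihilˡ : ∀ {a} b → a ≡ 0ℚ → a ℚ.* b ≡ 0ℚ
*-annihilˡ b eq = trans (cong (ℚ._* b) eq) (ℚP.*-zeroˡ b)

*-annihilʳ : ∀ a {b} → b ≡ 0ℚ → a ℚ.* b ≡ 0ℚ
*-annihilʳ a eq = trans (cong (a ℚ.*_) eq) (ℚP.*-zeroʳ a)

sumTo-zero : ∀ n {h} → (∀ i → i ℕ.≤ n → h i ≡ 0ℚ) → sumTo n h ≡ 0ℚ
sumTo-zero zero    eq = eq 0 ℕ.z≤n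
sumTo-zero (suc n) eq =
  trans (cong₂ ℚ._+_ (sumTo-zero n λ i i≤n → eq i (ℕP.m≤n⇒m≤1+n i≤n)) (eq (suc n) ℕP.≤-refl)) (ℚP.+-identityˡ 0ℚ)

sumTo-last : ∀ n {h} → (∀ i → i ℕ.< n → h i ≡ 0ℚ) → sumTo n h ≡ h n
sumTo-last zero        eq = refl
sumTo-last (suc n) {h} eq =
  trans (cong (ℚ._+ h (suc n)) (sumTo-zero n λ i i≤n → eq i (ℕ.s≤s i≤n))) (ℚP.+-identityˡ _)

scale-⊗ : ∀ c f → const c ⊗ f ≐ scale c f
scale-⊗ c f n k = trans (⊗-nested (const c) f n k) (outer n k)
  where
  inner : ∀ g k → PS₁.conv (const c 0) g k ≡ c ℚ.* g k
  inner g zero    = refl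
  inner g (suc k) = trans (cong (c ℚ.* g (suc k) ℚ.+_) (PS₁.conv-zeroˡ g k)) (ℚP.+-identityʳ _)
  outer : ∀ n k → PS₂.conv (const c) f n k ≡ c ℚ.* f n k
  outer zero    k = inner (f 0) k
  outer (suc n) k = trans (cong₂ ℚ._+_ (inner (f (suc n)) k) (PS₂.conv-zeroˡ f n k)) (ℚP.+-identityʳ _)

module Solver where
  ℤ-rawRing : RawRing _ _
  ℤ-rawRing = record { Carrier = ℤ ; _≈_ = _≡_ ; _+_ = ℤ._+_ ; _*_ = ℤ._*_ ; -_ = ℤ.-_ ; 0# = ℤ.0ℤ ; 1# = ℤ.1ℤ }

  const-+ : ∀ {c} a b → c ≡ a ℚ.+ b → const c ≐ const a ⊕ const b
  const-+ a b eq zero    zero    = eq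
  const-+ a b eq zero    (suc k) = refl
  const-+ a b eq (suc n) k       = refl

  const-neg : ∀ {c} a → c ≡ ℚ.- a → const c ≐ ⊝ const a
  const-neg a eq zero    zero    = eq
  const-neg a eq zero    (suc k) = refl
  const-neg a eq (suc n) k       = refl

  const-* : ∀ {c} a b → c ≡ a ℚ.* b → const c ≐ const a ⊗ const b
  const-* {c} a b eq n k = trans (lem n k) (sym (scale-⊗ a (const b) n k))
    where
    lem : ∀ n k → const c n k ≡ scale a (const b) n k
    lem zero    zero    = eq
    lem zero    (suc k) = sym (ℚP.*-zeroʳ a)
    lem (suc n) k       = sym (ℚP.*-zeroʳ a)

  -- The solver must decide equality of coefficients, which series do not allow; integers do, and as
  -- constant series they include every `ℤc m`.
  morphism : ℤ-rawRing -Raw-AlmostCommutative⟶ fromCommutativeRing seriesRing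
  morphism = record
    { ⟦_⟧ = λ z → const (integer z)
    ; +-homo = λ a b → const-+ (integer a) (integer b) (integer-+ a b)
    ; *-homo = λ a b → const-* (integer a) (integer b) (integer-* a b)
    ; -‿homo = λ a → const-neg (integer a) (integer-neg a)
    ; 0-homo = λ _ _ → refl ; 1-homo = λ _ _ → refl }

  coeff≟ : ∀ a b → Maybe (const (integer a) ≐ const (integer b))
  coeff≟ a b with a ℤ.≟ b
  ... | yes refl = just λ _ _ → refl
  ... | no _     = nothing

  open Algebra.Solver.Ring ℤ-rawRing (fromCommutativeRing seriesRing) morphism coeff≟ public
    using (solve; _:=_; _:+_; _:*_; _:-_; :-_; con; Polynomial)

  :0 :1 :2 :3 : ∀ {m} → Polynomial m
  :0 = con (pos 0)
  :1 = con (pos 1)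
  :2 = con (pos 2)
  :3 = con (pos 3)

-- The series in x alone. A record keeps `f` inferable where a bare function type would not.
record TConst (f : Series) : Set where
  constructor tconst
  field vanish : ∀ n k → f n (suc k) ≡ 0ℚ

open TConst

-- Multiplication by a series in x alone acts on each power of t separately, which later lets
-- equations between the series of single heights be read as one equation in x and t.
⊗-at : ∀ f g → TConst g → ∀ n k → (f ⊗ g) n k ≡ sumTo n λ i → f i k ℚ.* g (n ∸ i) 0
⊗-at f g tg n k = sumTo-cong n λ i _ →
  trans (sumTo-last k λ j j<k → *-annihilʳ (f i j) (positive (n ∸ i) (ℕP.m<n⇒0<n∸m j<k)))
        (cong (λ j → f i k ℚ.* g (n ∸ i) j) (ℕP.n∸n≡0 k))
  where
  positive : ∀ m {j} → 0 ℕ.< j → g m j ≡ 0ℚ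
  positive m {suc j} _ = vanish tg m j

⊗-tconst : ∀ {f g} → TConst f → TConst g → TConst (f ⊗ g)
⊗-tconst {f} {g} tf tg .vanish n k = trans (⊗-at f g tg n (suc k))
  (sumTo-zero n λ i _ → *-annihilˡ (g (n ∸ i) 0) (vanish tf i k))

⊕-tconst : ∀ {f g} → TConst f → TConst g → TConst (f ⊕ g)
⊕-tconst tf tg .vanish n k = trans (cong₂ ℚ._+_ (vanish tf n k) (vanish tg n k)) (ℚP.+-identityˡ 0ℚ)

⊖-tconst : ∀ {f g} → TConst f → TConst g → TConst (f ⊖ g)
⊖-tconst tf tg = ⊕-tconst tf (tconst λ n k → cong ℚ.-_ (vanish tg n k))

const-tconst : ∀ c → TConst (const c)
const-tconst c .vanish zero    k = refl
const-tconst c .vanish (suc n) k = refl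

private
  𝕥-inner : ∀ g k → PS₁.conv (𝕥 0) g (suc k) ≡ g k
  𝕥-inner g k = trans (cong₂ ℚ._+_ (ℚP.*-zeroˡ (g (suc k))) (PS₁.conv-cong one≡ (λ _ → refl) k))
                (trans (ℚP.+-identityˡ _) (PS₁.conv-oneˡ g k))
    where
    one≡ : ∀ i → 𝕥 0 (suc i) ≡ PS₁.one i
    one≡ zero    = refl
    one≡ (suc i) = refl

  𝕥-rest : ∀ f n k → PS₂.conv (λ i → 𝕥 (suc i)) f n k ≡ 0ℚ
  𝕥-rest f n k = trans (PS₂.conv-cong {g = f} (λ _ _ → refl) (λ _ _ → refl) n k) (PS₂.conv-zeroˡ f n k)

𝕥⊗-zero : ∀ f n → (𝕥 ⊗ f) n 0 ≡ 0ℚ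
𝕥⊗-zero f n = sumTo-zero n λ i _ → *-annihilˡ (f (n ∸ i) 0) (t0 i)
  where
  t0 : ∀ i → 𝕥 i 0 ≡ 0ℚ
  t0 zero    = refl
  t0 (suc i) = refl

𝕥⊗-suc : ∀ f n k → (𝕥 ⊗ f) n (suc k) ≡ f n k
𝕥⊗-suc f n k = trans (⊗-nested 𝕥 f n (suc k)) (lem n)
  where
  lem : ∀ n → PS₂.conv 𝕥 f n (suc k) ≡ f n k
  lem zero    = 𝕥-inner (f 0) k
  lem (suc n) = trans (cong₂ ℚ._+_ (𝕥-inner (f (suc n)) k) (𝕥-rest f n (suc k))) (ℚP.+-identityʳ _)

-- The filtration by total degree in x and t, for which cutting the geometric series of `inv` at j =
-- n + k loses nothing.
VanishesBelow : ℕ → Series → Set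
VanishesBelow d f = ∀ n k → n ℕ.+ k ℕ.< d → f n k ≡ 0ℚ

⊗-vanishes : ∀ {a b f g} → VanishesBelow a f → VanishesBelow b g → VanishesBelow (a ℕ.+ b) (f ⊗ g)
⊗-vanishes {a} {b} {f} {g} va vb n k lt = sumTo-zero n λ i i≤n → sumTo-zero k λ j j≤k → term i j i≤n j≤k
  where
  open import Algebra.Properties.CommutativeSemigroup ℕP.+-commutativeSemigroup using (interchange)
  term : ∀ i j → i ℕ.≤ n → j ℕ.≤ k → f i j ℚ.* g (n ∸ i) (k ∸ j) ≡ 0ℚ
  term i j i≤n j≤k with i ℕ.+ j ℕP.<? a
  ... | yes p = *-annihilˡ (g (n ∸ i) (k ∸ j)) (va i j p)
  ... | no ¬p = *-annihilʳ (f i j) (vb (n ∸ i) (k ∸ j) (ℕP.+-cancelˡ-< (i ℕ.+ j) _ _ bound))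
    where
    open ℕP.≤-Reasoning
    bound : i ℕ.+ j ℕ.+ ((n ∸ i) ℕ.+ (k ∸ j)) ℕ.< i ℕ.+ j ℕ.+ b
    bound = begin-strict
      i ℕ.+ j ℕ.+ ((n ∸ i) ℕ.+ (k ∸ j))   ≡⟨ interchange i j _ _ ⟩
      i ℕ.+ (n ∸ i) ℕ.+ (j ℕ.+ (k ∸ j))   ≡⟨ cong₂ ℕ._+_ (ℕP.m+[n∸m]≡n i≤n) (ℕP.m+[n∸m]≡n j≤k) ⟩
      n ℕ.+ k                              <⟨ lt ⟩
      a ℕ.+ b                              ≤⟨ ℕP.+-monoˡ-≤ b (ℕP.≮⇒≥ ¬p) ⟩
      i ℕ.+ j ℕ.+ b                        ∎

pow-vanishes : ∀ {g} → g 0 0 ≡ 0ℚ → ∀ j → VanishesBelow j (pow g j)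
pow-vanishes g0 zero    n k ()
pow-vanishes {g} g0 (suc j) = ⊗-vanishes {1} {j} {g} {pow g j} base (pow-vanishes {g} g0 j)
  where
  base : VanishesBelow 1 g
  base zero    zero    _ = g0
  base zero    (suc k) (ℕ.s≤s ())
  base (suc n) k       (ℕ.s≤s ())

geometric : Series → ℕ → Series
geometric g N n k = sumTo N λ j → pow g j n k

geometric-sum : ∀ g N → (𝟙 ⊖ g) ⊗ geometric g N ≐ 𝟙 ⊖ pow g (suc N)
geometric-sum g zero = Solver.solve 1 (λ g → (:1 :- g) :* :1 := :1 :- g :* :1) (λ _ _ → refl) g
  where open Solver
geometric-sum g (suc N) n k = trans
  (Solver.solve 3 (λ g s p → (:1 :- g) :* (s :+ p) := (:1 :- g) :* s :+ (p :- g :* p)) (λ _ _ → refl)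
    g (geometric g N) (pow g (suc N)) n k)
  (trans (cong (ℚ._+ (p ⊖ g ⊗ p) n k) (geometric-sum g N n k))
    (Solver.solve 2 (λ p q → (:1 :- p) :+ (p :- q) := :1 :- q) (λ _ _ → refl)
      p (pow g (suc (suc N))) n k))
  where
  open Solver
  p = pow g (suc N)

-- In `inv` the cut depends on the coefficient. A product mixes many coefficients; this brings them
-- all to one common cut, where `geometric-sum` applies.
geometric-stable : ∀ {g} → g 0 0 ≡ 0ℚ → ∀ n k {M N} → n ℕ.+ k ℕ.≤ M → M ℕ.≤ N →
  geometric g N n k ≡ geometric g M n k
geometric-stable {g} g0 n k {M} {N} lo M≤N = go (ℕP.≤⇒≤′ M≤N)
  where
  go : ∀ {N} → M ℕ.≤′ N → geometric g N n k ≡ geometric g M n k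
  go ℕ.≤′-refl     = refl
  go (ℕ.≤′-step {N} p) = trans (cong₂ ℚ._+_ (go p)
    (pow-vanishes {g} g0 (suc N) n k (ℕ.s≤s (ℕP.≤-trans lo (ℕP.≤′⇒≤ p))))) (ℚP.+-identityʳ _)

-- `inv` hides its constant and its series `g` behind a case distinction and local definitions; the
-- existential makes them available outside.
inv-form : ∀ f → f 0 0 ≢ 0ℚ → Σ ℚ λ d → d ℚ.* f 0 0 ≡ 1ℚ ×
  (∀ n k → inv f n k ≡ d ℚ.* geometric (𝟙 ⊖ scale d f) (n ℕ.+ k) n k)
inv-form f f0≢0 with f 0 0 ℚP.≟ 0ℚ
... | yes p = ⊥-elim (f0≢0 p)
... | no c≢0 = ℚ.1/_ (f 0 0) {{ℚ.≢-nonZero c≢0}} , ℚP.*-inverseˡ (f 0 0) {{ℚ.≢-nonZero c≢0}} , λ n k → refl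

inv-correct : ∀ f → f 0 0 ≢ 0ℚ → f ⊗ inv f ≐ 𝟙
inv-correct f f0≢0 n k with inv-form f f0≢0
... | d , df≡1 , form = begin
  (f ⊗ inv f) n k
    ≡⟨ (sumTo-cong n λ i i≤n → sumTo-cong k λ j j≤k → cong (f i j ℚ.*_)
        (trans (form (n ∸ i) (k ∸ j)) (cong (d ℚ.*_) (sym
          (geometric-stable {g} g0 (n ∸ i) (k ∸ j) {N = n ℕ.+ k} ℕP.≤-refl
            (ℕP.+-mono-≤ (ℕP.m∸n≤m n i) (ℕP.m∸n≤m k j))))))) ⟩
  (f ⊗ scale d s) n k           ≡⟨ Ser.*-congˡ {f} (scale-⊗ d s) n k ⟨
  (f ⊗ (const d ⊗ s)) n k       ≡⟨ Solver.solve 3 (λ f c s → f :* (c :* s) := (c :* f) :* s) (λ _ _ → refl) f (const d) s n k ⟩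
  ((const d ⊗ f) ⊗ s) n k       ≡⟨ Ser.*-congʳ {s} (scale-⊗ d f) n k ⟩
  (scale d f ⊗ s) n k           ≡⟨ Ser.*-congʳ {s} (Solver.solve 1 (λ x → x := :1 :- (:1 :- x)) (λ _ _ → refl) (scale d f)) n k ⟩
  ((𝟙 ⊖ g) ⊗ s) n k             ≡⟨ geometric-sum g (n ℕ.+ k) n k ⟩
  (𝟙 ⊖ pow g (suc (n ℕ.+ k))) n k ≡⟨ cong (λ z → 𝟙 n k ℚ.- z) (pow-vanishes {g} g0 (suc (n ℕ.+ k)) n k ℕP.≤-refl) ⟩
  𝟙 n k ℚ.- 0ℚ                  ≡⟨ ℚP.+-identityʳ _ ⟩
  𝟙 n k                         ∎
  where
  open ≡.≡-Reasoning
  open Solver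
  g = 𝟙 ⊖ scale d f
  s = geometric g (n ℕ.+ k)
  g0 : g 0 0 ≡ 0ℚ
  g0 = trans (cong (λ z → 1ℚ ℚ.- z) df≡1) refl

-- Exponential generating functions and colour sums

open import Data.Nat using (_!)
open import Data.Rational using (_+_; _*_; -_)
import Data.Rational.Unnormalised as ℚᵘ
import Data.Rational.Unnormalised.Properties as ℚᵘP
open import Data.Rational.Solver using (module +-*-Solver)
open import Data.List as List using (List; []; _∷_; _++_; map; concatMap)
open import Data.List.Relation.Unary.All as All using (All; []; _∷_)
open import Data.List.Membership.Propositional using (_∈_)
open import Data.List.Relation.Unary.Any using (here; there)
open import Relation.Binary.PropositionalEquality using (module ≡-Reasoning)

private module ℚSolver = +-*-Solver

∑ : {A : Set} → List A → (A → ℚ) → ℚ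
∑ []       f = 0ℚ
∑ (x ∷ xs) f = f x + ∑ xs f

+-interchange : ∀ a b c d → (a + b) + (c + d) ≡ (a + c) + (b + d)
+-interchange = ℚSolver.solve 4 (λ a b c d → (a :+ b) :+ (c :+ d) := (a :+ c) :+ (b :+ d)) refl
  where open ℚSolver

module _ {A : Set} where
  ∑-cong-∈ : ∀ xs {f g : A → ℚ} → (∀ x → x ∈ xs → f x ≡ g x) → ∑ xs f ≡ ∑ xs g
  ∑-cong-∈ []       eq = refl
  ∑-cong-∈ (x ∷ xs) eq = cong₂ _+_ (eq x (here refl)) (∑-cong-∈ xs λ y y∈ → eq y (there y∈))

  ∑-cong : ∀ xs {f g : A → ℚ} → (∀ x → f x ≡ g x) → ∑ xs f ≡ ∑ xs g
  ∑-cong xs eq = ∑-cong-∈ xs λ x _ → eq x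

  ∑-+ : ∀ xs (f g : A → ℚ) → ∑ xs (λ x → f x + g x) ≡ ∑ xs f + ∑ xs g
  ∑-+ []       f g = refl
  ∑-+ (x ∷ xs) f g = trans (cong (_+_ (f x + g x)) (∑-+ xs f g)) (+-interchange (f x) (g x) (∑ xs f) (∑ xs g))

  ∑-*ˡ : ∀ c xs (f : A → ℚ) → ∑ xs (λ x → c * f x) ≡ c * ∑ xs f
  ∑-*ˡ c []       f = sym (ℚP.*-zeroʳ c)
  ∑-*ˡ c (x ∷ xs) f = trans (cong (_+_ (c * f x)) (∑-*ˡ c xs f)) (sym (ℚP.*-distribˡ-+ c (f x) (∑ xs f)))

  ∑-*ʳ : ∀ c xs (f : A → ℚ) → ∑ xs (λ x → f x * c) ≡ ∑ xs f * c
  ∑-*ʳ c xs f = trans (∑-cong xs λ x → ℚP.*-comm (f x) c) (trans (∑-*ˡ c xs f) (ℚP.*-comm c (∑ xs f)))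

  ∑-zero : ∀ xs {f : A → ℚ} → (∀ x → f x ≡ 0ℚ) → ∑ xs f ≡ 0ℚ
  ∑-zero []       eq = refl
  ∑-zero (x ∷ xs) eq = trans (cong₂ _+_ (eq x) (∑-zero xs eq)) (ℚP.+-identityˡ 0ℚ)

  ∑-++ : ∀ xs ys (f : A → ℚ) → ∑ (xs ++ ys) f ≡ ∑ xs f + ∑ ys f
  ∑-++ []       ys f = sym (ℚP.+-identityˡ _)
  ∑-++ (x ∷ xs) ys f = trans (cong (_+_ (f x)) (∑-++ xs ys f)) (sym (ℚP.+-assoc (f x) _ _))

∑-swap : {A B : Set} (xs : List A) (ys : List B) (f : A → B → ℚ) →
  ∑ xs (λ x → ∑ ys (f x)) ≡ ∑ ys (λ y → ∑ xs (λ x → f x y))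
∑-swap []       ys f = sym (∑-zero ys λ _ → refl)
∑-swap (x ∷ xs) ys f = trans (cong (_+_ (∑ ys (f x))) (∑-swap xs ys f)) (sym (∑-+ ys (f x) _))

∑-map : {A B : Set} (g : A → B) (xs : List A) (f : B → ℚ) → ∑ (map g xs) f ≡ ∑ xs (λ x → f (g x))
∑-map g []       f = refl
∑-map g (x ∷ xs) f = cong (_+_ (f (g x))) (∑-map g xs f)

∑-concatMap : {A B : Set} (g : A → List B) (xs : List A) (f : B → ℚ) →
  ∑ (concatMap g xs) f ≡ ∑ xs (λ x → ∑ (g x) f)
∑-concatMap g []       f = refl
∑-concatMap g (x ∷ xs) f = trans (∑-++ (g x) _ f) (cong (_+_ (∑ (g x) f)) (∑-concatMap g xs f))

-- splitSum N n is the sum over all S ⊆ [n] of N |S| (n − |S|).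
splitSum : (ℕ → ℕ → ℚ) → ℕ → ℚ
splitSum N zero    = N 0 0
splitSum N (suc n) = splitSum (λ m k → N (suc m) k) n + splitSum (λ m k → N m (suc k)) n

splitSum-cong : ∀ n {M N : ℕ → ℕ → ℚ} → (∀ m k → M m k ≡ N m k) → splitSum M n ≡ splitSum N n
splitSum-cong zero    eq = eq 0 0
splitSum-cong (suc n) eq =
  cong₂ _+_ (splitSum-cong n λ m k → eq (suc m) k) (splitSum-cong n λ m k → eq m (suc k))

splitSum-*ˡ : ∀ c n N → splitSum (λ m k → c * N m k) n ≡ c * splitSum N n
splitSum-*ˡ c zero    N = refl
splitSum-*ˡ c (suc n) N = trans (cong₂ _+_ (splitSum-*ˡ c n _) (splitSum-*ˡ c n _)) (sym (ℚP.*-distribˡ-+ c (splitSum (λ m k → N (suc m) k) n) (splitSum (λ m k → N m (suc k)) n)))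

splitSum-∑ : {A : Set} (xs : List A) (F : A → ℕ → ℕ → ℚ) → ∀ n →
  splitSum (λ m k → ∑ xs (λ x → F x m k)) n ≡ ∑ xs (λ x → splitSum (F x) n)
splitSum-∑ xs F zero    = refl
splitSum-∑ xs F (suc n) = trans
  (cong₂ _+_ (splitSum-∑ xs (λ x m k → F x (suc m) k) n) (splitSum-∑ xs (λ x m k → F x m (suc k)) n))
  (sym (∑-+ xs _ _))

natℚ-recip : ∀ d .{{_ : ℕ.NonZero d}} → natℚ d * (pos 1 ℚ./ d) ≡ 1ℚ
natℚ-recip (suc k) = ℚP.toℚᵘ-injective (begin
  ℚ.toℚᵘ (natℚ (suc k) * (pos 1 ℚ./ suc k))            ≈⟨ ℚP.toℚᵘ-homo-* (natℚ (suc k)) (pos 1 ℚ./ suc k) ⟩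
  ℚ.toℚᵘ (natℚ (suc k)) ℚᵘ.* ℚ.toℚᵘ (pos 1 ℚ./ suc k)
    ≈⟨ ℚᵘP.*-cong (ℚP.toℚᵘ-fromℚᵘ (ℚᵘ.mkℚᵘ (pos (suc k)) 0)) (ℚP.toℚᵘ-fromℚᵘ (ℚᵘ.mkℚᵘ (pos 1) k)) ⟩
  ℚᵘ.mkℚᵘ (pos (suc k)) 0 ℚᵘ.* ℚᵘ.mkℚᵘ (pos 1) k           ≈⟨ ℚᵘ.*≡* (trans (ℤP.*-identityʳ _)
      (trans (ℤP.*-comm (pos (suc k)) (pos 1)) (cong (λ z → pos 1 ℤ.* pos z) (sym (ℕP.+-identityʳ (suc k)))))) ⟩
  ℚ.toℚᵘ 1ℚ                                          ∎)
  where open ℚᵘP.≃-Reasoning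

natℚ-!-inv! : ∀ n → natℚ (n !) * inv! n ≡ 1ℚ
natℚ-!-inv! n = natℚ-recip (n !) {{ℕP._!≢0 n}}

natℚ-suc-inv! : ∀ n → natℚ (suc n) * inv! (suc n) ≡ inv! n
natℚ-suc-inv! n = begin
  natℚ (suc n) * inv! (suc n)                            ≡⟨ ℚP.*-identityʳ _ ⟨
  natℚ (suc n) * inv! (suc n) * 1ℚ                       ≡⟨ cong (_*_ (natℚ (suc n) * inv! (suc n))) (natℚ-!-inv! n) ⟨
  natℚ (suc n) * inv! (suc n) * (natℚ (n !) * inv! n)    ≡⟨ ℚSolver.solve 4 (λ a b c d → a :* b :* (c :* d) := (a :* c) :* b :* d) refl (natℚ (suc n)) (inv! (suc n)) (natℚ (n !)) (inv! n) ⟩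
  natℚ (suc n) * natℚ (n !) * inv! (suc n) * inv! n      ≡⟨ cong (λ z → z * inv! (suc n) * inv! n) (natℚ-* (suc n) (n !)) ⟨
  natℚ (suc n !) * inv! (suc n) * inv! n                 ≡⟨ cong (_* inv! n) (natℚ-!-inv! (suc n)) ⟩
  1ℚ * inv! n                                            ≡⟨ ℚP.*-identityˡ _ ⟩
  inv! n                                                 ∎
  where open ≡-Reasoning; open ℚSolver

sumTo-first : ∀ n h → sumTo (suc n) h ≡ h 0 + sumTo n (λ i → h (suc i))
sumTo-first n h = trans (sym (sumUpTo≡sumTo (suc n) h))
  (trans (PS₁.sumUpTo-first n h) (cong (_+_ (h 0)) (sumUpTo≡sumTo n _)))

sumTo-+ : ∀ n f g → sumTo n (λ i → f i + g i) ≡ sumTo n f + sumTo n g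
sumTo-+ zero    f g = refl
sumTo-+ (suc n) f g = trans (cong (_+ (f (suc n) + g (suc n))) (sumTo-+ n f g)) (+-interchange (sumTo n f) (sumTo n g) (f (suc n)) (g (suc n)))

sumTo-*ˡ : ∀ c n f → sumTo n (λ i → c * f i) ≡ c * sumTo n f
sumTo-*ˡ c zero    f = refl
sumTo-*ˡ c (suc n) f = trans (cong (λ z → z + c * f (suc n)) (sumTo-*ˡ c n f)) (sym (ℚP.*-distribˡ-+ c (sumTo n f) (f (suc n))))

module _ where
  private
    term : (ℕ → ℕ → ℚ) → ℕ → ℕ → ℚ
    term N n m = N m (n ∸ m) * inv! m * inv! (n ∸ m)

    left : ∀ N n → sumTo (suc n) (λ m → natℚ m * term N (suc n) m) ≡ sumTo n (term (λ m k → N (suc m) k) n)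
    left N n = trans (sumTo-first n (λ m → natℚ m * term N (suc n) m))
      (trans (cong₂ _+_ (ℚP.*-zeroˡ (term N (suc n) 0)) (sumTo-cong n λ m _ → step m)) (ℚP.+-identityˡ _))
      where
      open ≡-Reasoning
      step : ∀ m → natℚ (suc m) * term N (suc n) (suc m) ≡ term (λ m k → N (suc m) k) n m
      step m = trans (ℚSolver.solve 4 (λ s a b c → s :* (a :* b :* c) := a :* (s :* b) :* c) refl (natℚ (suc m)) (N (suc m) (n ∸ m)) (inv! (suc m)) (inv! (n ∸ m)))
                     (cong (λ z → N (suc m) (n ∸ m) * z * inv! (n ∸ m)) (natℚ-suc-inv! m))
        where open ℚSolver

    right : ∀ N n → sumTo (suc n) (λ m → natℚ (suc n ∸ m) * term N (suc n) m) ≡ sumTo n (term (λ m k → N m (suc k)) n)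
    right N n = trans (cong₂ _+_ (sumTo-cong n step)
      (*-annihilˡ (term N (suc n) (suc n)) (cong natℚ (ℕP.n∸n≡0 n)))) (ℚP.+-identityʳ _)
      where
      step : ∀ m → m ℕ.≤ n → natℚ (suc n ∸ m) * term N (suc n) m ≡ term (λ m k → N m (suc k)) n m
      step m m≤n = trans (cong (λ l → natℚ l * (N m l * inv! m * inv! l)) (ℕP.+-∸-assoc 1 m≤n))
        (trans (ℚSolver.solve 4 (λ s a b c → s :* (a :* b :* c) := a :* b :* (s :* c)) refl (natℚ (suc (n ∸ m))) (N m (suc (n ∸ m))) (inv! m) (inv! (suc (n ∸ m))))
               (cong (_*_ (N m (suc (n ∸ m)) * inv! m)) (natℚ-suc-inv! (n ∸ m))))
        where open ℚSolver

  -- No binomial coefficients: in degree n + 1, weighting the term of m by n + 1 = m + (n + 1 - m)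
  -- and cancelling m/m! = 1/(m - 1)! splits the sum into those of the two recursive calls of
  -- `splitSum`.
  splitSum-inv! : ∀ n N → splitSum N n * inv! n ≡ sumTo n λ m → N m (n ∸ m) * inv! m * inv! (n ∸ m)
  splitSum-inv! zero    N = sym (ℚP.*-identityʳ (N 0 0 * inv! 0))
  splitSum-inv! (suc n) N = begin
    (splitSum N₁ n + splitSum N₂ n) * inv! (suc n)   ≡⟨ cong (_* inv! (suc n)) sums ⟩
    natℚ (suc n) * sumTo (suc n) (term N (suc n)) * natℚ (n !) * inv! (suc n)
      ≡⟨ ℚSolver.solve 4 (λ s x f i → s :* x :* f :* i := (s :* f) :* i :* x) refl (natℚ (suc n)) (sumTo (suc n) (term N (suc n))) (natℚ (n !)) (inv! (suc n)) ⟩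
    natℚ (suc n) * natℚ (n !) * inv! (suc n) * sumTo (suc n) (term N (suc n))
      ≡⟨ cong (λ z → z * inv! (suc n) * sumTo (suc n) (term N (suc n))) (natℚ-* (suc n) (n !)) ⟨
    natℚ (suc n !) * inv! (suc n) * sumTo (suc n) (term N (suc n))
      ≡⟨ cong (_* sumTo (suc n) (term N (suc n))) (natℚ-!-inv! (suc n)) ⟩
    1ℚ * sumTo (suc n) (term N (suc n)) ≡⟨ ℚP.*-identityˡ _ ⟩
    sumTo (suc n) (term N (suc n)) ∎
    where
    open ≡-Reasoning
    open ℚSolver
    N₁ N₂ : ℕ → ℕ → ℚ
    N₁ m k = N (suc m) k
    N₂ m k = N m (suc k)
    clear : ∀ M → splitSum M n ≡ sumTo n (term M n) * natℚ (n !)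
    clear M = begin
      splitSum M n                          ≡⟨ ℚP.*-identityʳ _ ⟨
      splitSum M n * 1ℚ                     ≡⟨ cong (_*_ (splitSum M n)) (natℚ-!-inv! n) ⟨
      splitSum M n * (natℚ (n !) * inv! n)  ≡⟨ ℚSolver.solve 3 (λ a b c → a :* (b :* c) := (a :* c) :* b) refl (splitSum M n) (natℚ (n !)) (inv! n) ⟩
      splitSum M n * inv! n * natℚ (n !)    ≡⟨ cong (_* natℚ (n !)) (splitSum-inv! n M) ⟩
      sumTo n (term M n) * natℚ (n !)       ∎
    weights : ∀ m → m ℕ.≤ suc n → natℚ m * term N (suc n) m + natℚ (suc n ∸ m) * term N (suc n) m
                                ≡ natℚ (suc n) * term N (suc n) m
    weights m m≤ = trans (sym (ℚP.*-distribʳ-+ (term N (suc n) m) (natℚ m) (natℚ (suc n ∸ m))))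
      (cong (_* term N (suc n) m) (trans (sym (natℚ-+ m (suc n ∸ m))) (cong natℚ (ℕP.m+[n∸m]≡n m≤))))
    sums : splitSum N₁ n + splitSum N₂ n ≡ natℚ (suc n) * sumTo (suc n) (term N (suc n)) * natℚ (n !)
    sums = begin
      splitSum N₁ n + splitSum N₂ n ≡⟨ cong₂ _+_ (clear N₁) (clear N₂) ⟩
      sumTo n (term N₁ n) * natℚ (n !) + sumTo n (term N₂ n) * natℚ (n !) ≡⟨ ℚP.*-distribʳ-+ (natℚ (n !)) (sumTo n (term N₁ n)) (sumTo n (term N₂ n)) ⟨
      (sumTo n (term N₁ n) + sumTo n (term N₂ n)) * natℚ (n !)
        ≡⟨ cong (_* natℚ (n !)) (trans (cong₂ _+_ (sym (left N n)) (sym (right N n)))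
            (trans (sym (sumTo-+ (suc n) (λ m → natℚ m * term N (suc n) m) (λ m → natℚ (suc n ∸ m) * term N (suc n) m))) (trans (sumTo-cong (suc n) weights) (sumTo-*ˡ (natℚ (suc n)) (suc n) (term N (suc n)))))) ⟩
      natℚ (suc n) * sumTo (suc n) (term N (suc n)) * natℚ (n !) ∎

egf : (ℕ → ℚ) → Series
egf a n zero    = a n * inv! n
egf a n (suc _) = 0ℚ

egf-tconst : ∀ a → TConst (egf a)
egf-tconst a = tconst λ n k → refl

egf-cong : ∀ {a b} → (∀ n → a n ≡ b n) → egf a ≐ egf b
egf-cong eq n zero    = cong (_* inv! n) (eq n)
egf-cong eq n (suc k) = refl

egf-⊗ : ∀ a b → egf (splitSum (λ m k → a m * b k)) ≐ egf a ⊗ egf b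
egf-⊗ a b n zero = trans (splitSum-inv! n (λ m k → a m * b k)) (sumTo-cong n λ m _ →
  ℚSolver.solve 4 (λ a b c d → a :* b :* c :* d := (a :* c) :* (b :* d)) refl (a m) (b (n ∸ m)) (inv! m) (inv! (n ∸ m)))
  where open ℚSolver
egf-⊗ a b n (suc k) = sym (vanish (⊗-tconst (egf-tconst a) (egf-tconst b)) n k)

power : ℚ → ℕ → ℚ
power q zero    = 1ℚ
power q (suc n) = q * power q n

power-* : ∀ p q n → power (p * q) n ≡ power p n * power q n
power-* p q zero    = refl
power-* p q (suc n) = trans (cong (_*_ (p * q)) (power-* p q n))
  (ℚSolver.solve 4 (λ a b c d → a :* b :* (c :* d) := a :* c :* (b :* d)) refl p q (power p n) (power q n))
  where open ℚSolver

power-1 : ∀ n → power 1ℚ n ≡ 1ℚ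
power-1 zero    = refl
power-1 (suc n) = trans (ℚP.*-identityˡ _) (power-1 n)

binomial : ∀ p q n → splitSum (λ m k → power p m * power q k) n ≡ power (p + q) n
binomial p q zero    = refl
binomial p q (suc n) = begin
  splitSum (λ m k → p * power p m * power q k) n + splitSum (λ m k → power p m * (q * power q k)) n
    ≡⟨ cong₂ _+_
        (trans (splitSum-cong n λ m k → ℚP.*-assoc p (power p m) (power q k)) (splitSum-*ˡ p n (λ m k → power p m * power q k)))
        (trans (splitSum-cong n λ m k → ℚSolver.solve 3 (λ a b c → a :* (b :* c) := b :* (a :* c)) refl (power p m) q (power q k)) (splitSum-*ˡ q n (λ m k → power p m * power q k))) ⟩
  p * S + q * S     ≡⟨ ℚP.*-distribʳ-+ S p q ⟨
  (p + q) * S       ≡⟨ cong (_*_ ((p + q))) (binomial p q n) ⟩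
  (p + q) * power (p + q) n ∎
  where
  open ≡-Reasoning
  open ℚSolver
  S = splitSum (λ m k → power p m * power q k) n

egf-power-+ : ∀ p q → egf (power p) ⊗ egf (power q) ≐ egf (power (p + q))
egf-power-+ p q n k = trans (sym (egf-⊗ (power p) (power q) n k)) (egf-cong (binomial p q) n k)

eˣ-egf : egf (power 1ℚ) ≐ eˣ
eˣ-egf n zero    = trans (cong (_* inv! n) (power-1 n)) (ℚP.*-identityˡ _)
eˣ-egf n (suc k) = refl

e⁻ˣ-egf : egf (power (- 1ℚ)) ≐ e⁻ˣ
e⁻ˣ-egf n (suc k) = refl
e⁻ˣ-egf n zero    with parity n
  where
  -- `e⁻ˣ` has the integer power as numerator of a quotient; knowing its two possible values reduces
  -- the claim to ± `inv! n`.
  parity : ∀ n → (ℤ.- pos 1) ℤ.^ n ≡ pos 1 × power (- 1ℚ) n ≡ 1ℚ ⊎ (ℤ.- pos 1) ℤ.^ n ≡ -[1+ 0 ] × power (- 1ℚ) n ≡ - 1ℚ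
  parity zero    = inj₁ (refl , refl)
  parity (suc n) with parity n
  ... | inj₁ (p , q) = inj₂ (cong (-[1+ 0 ] ℤ.*_) p , cong (_*_ (- 1ℚ)) q)
  ... | inj₂ (p , q) = inj₁ (cong (-[1+ 0 ] ℤ.*_) p , cong (_*_ (- 1ℚ)) q)
... | inj₁ (p , q) = trans (cong (_* inv! n) q) (trans (ℚP.*-identityˡ _)
        (cong (λ z → (z ℚ./ (n !)) {{ℕP._!≢0 n}}) (sym p)))
... | inj₂ (p , q) = trans (cong (_* inv! n) q) (trans (sym (ℚP.neg-distribˡ-* 1ℚ (inv! n)))
        (trans (cong -_ (ℚP.*-identityˡ _)) (cong (λ z → (z ℚ./ (n !)) {{ℕP._!≢0 n}}) (sym p))))

𝟙-egf : egf (power 0ℚ) ≐ 𝟙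
𝟙-egf zero    zero    = refl
𝟙-egf zero    (suc k) = refl
𝟙-egf (suc n) zero    = *-annihilˡ (inv! (suc n)) (ℚP.*-zeroˡ (power 0ℚ n))
𝟙-egf (suc n) (suc k) = refl

e⁻ˣ⊗eˣ : e⁻ˣ ⊗ eˣ ≐ 𝟙
e⁻ˣ⊗eˣ n k = trans (sym (⊗-cong e⁻ˣ-egf eˣ-egf n k)) (trans (egf-power-+ (- 1ℚ) 1ℚ n k) (𝟙-egf n k))

Ψ-egf : egf (splitSum (λ m k → natℚ (2 ℕ.^ (m ℕ.* k)))) ≐ Ψ
Ψ-egf n zero    = splitSum-inv! n _
Ψ-egf n (suc k) = refl

-- The sum over all vertex colourings of [n] with colours from a list of (colour, vertex weight),
-- where each unordered pair of vertices contributes the interaction weight w of its two colours.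
module ColourSum {C : Set} (w : C → C → ℚ) (w-sym : ∀ c d → w c d ≡ w d c) where

  Atom : Set
  Atom = C × ℚ

  -- Once a vertex has colour c, its interaction with a later vertex depends only on the colour of
  -- the latter, so it can be absorbed into the vertex weights and the recursion stays among sums of
  -- the same kind.
  dampBy : C → List Atom → List Atom
  dampBy c = map λ (d , q) → d , q * w c d

  colourings : List Atom → ℕ → ℚ
  colourings as zero    = 1ℚ
  colourings as (suc n) = ∑ as λ (c , q) → q * colourings (dampBy c as) n

  -- A colour of weight 0 contributes to no colouring, so it counts as separate from every colour.
  NoInteraction : Atom → Atom → Set
  NoInteraction (c , p) (d , q) = p ≡ 0ℚ ⊎ q ≡ 0ℚ ⊎ w c d ≡ 1ℚ

  Separate : List Atom → List Atom → Set
  Separate as bs = ∀ {a b} → a ∈ as → b ∈ bs → NoInteraction a b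

  private
    unmap : ∀ c as {a} → a ∈ dampBy c as → Σ Atom λ (d , q) → (d , q) ∈ as × a ≡ (d , q * w c d)
    unmap c ((d , q) ∷ as) (here refl) = (d , q) , here refl , refl
    unmap c (_ ∷ as) (there a∈) with unmap c as a∈
    ... | a , a∈′ , eq = a , there a∈′ , eq

  Separate-dampˡ : ∀ c {as bs} → Separate as bs → Separate (dampBy c as) bs
  Separate-dampˡ c {as} sep a∈ b∈ with unmap c as a∈
  ... | (d , q) , a∈′ , refl with sep a∈′ b∈
  ...   | inj₁ q≡0        = inj₁ (*-annihilˡ (w c d) q≡0)
  ...   | inj₂ no-weight  = inj₂ no-weight

  Separate-dampʳ : ∀ c {as bs} → Separate as bs → Separate as (dampBy c bs)
  Separate-dampʳ c {bs = bs} sep a∈ b∈ with unmap c bs b∈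
  ... | (d , q) , b∈′ , refl with sep a∈ b∈′
  ...   | inj₁ p≡0          = inj₁ p≡0
  ...   | inj₂ (inj₁ q≡0)   = inj₂ (inj₁ (*-annihilˡ (w c d) q≡0))
  ...   | inj₂ (inj₂ w≡1)   = inj₂ (inj₂ w≡1)

  damp-trivial : ∀ c bs → (∀ {b} → b ∈ bs → proj₂ b ≡ 0ℚ ⊎ w c (proj₁ b) ≡ 1ℚ) → dampBy c bs ≡ bs
  damp-trivial c []             triv = refl
  damp-trivial c ((d , q) ∷ bs) triv = cong₂ _∷_ (cong (d ,_) (weight (triv (here refl)))) (damp-trivial c bs (λ b∈ → triv (there b∈)))
    where
    weight : q ≡ 0ℚ ⊎ w c d ≡ 1ℚ → q * w c d ≡ q
    weight (inj₁ q≡0) = trans (*-annihilˡ (w c d) q≡0) (sym q≡0)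
    weight (inj₂ w≡1) = trans (cong (q *_) w≡1) (ℚP.*-identityʳ q)

  private
    dampBy-++ : ∀ c as bs → dampBy c (as ++ bs) ≡ dampBy c as ++ dampBy c bs
    dampBy-++ c []       bs = refl
    dampBy-++ c (a ∷ as) bs = cong (_ ∷_) (dampBy-++ c as bs)

    weighted-cong : ∀ q {x y} → (q ≢ 0ℚ → x ≡ y) → q * x ≡ q * y
    weighted-cong q {x} {y} eq with q ℚP.≟ 0ℚ
    ... | yes q≡0 = trans (*-annihilˡ x q≡0) (sym (*-annihilˡ y q≡0))
    ... | no q≢0  = cong (q *_) (eq q≢0)

    pull : ∀ n (as : List Atom) (F : C → ℕ → ℕ → ℚ) →
      ∑ as (λ (c , q) → q * splitSum (F c) n) ≡ splitSum (λ m k → ∑ as (λ (c , q) → q * F c m k)) n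
    pull n as F = trans (∑-cong as λ (c , q) → sym (splitSum-*ˡ q n (F c)))
                        (sym (splitSum-∑ as (λ (c , q) m k → q * F c m k) n))

  -- The first vertex takes its colour from one of the lists, as in the recursion of `splitSum`, and
  -- damping by that colour leaves the other list unchanged unless a weight is 0. On generating
  -- functions this is the product rule.
  colourings-++ : ∀ n as bs → Separate as bs →
    colourings (as ++ bs) n ≡ splitSum (λ m k → colourings as m * colourings bs k) n
  colourings-++ zero    as bs sep = refl
  colourings-++ (suc n) as bs sep = trans (∑-++ as bs _) (cong₂ _+_
    (begin
      ∑ as (λ (c , q) → q * colourings (dampBy c (as ++ bs)) n)
        ≡⟨ (∑-cong-∈ as λ (c , q) a∈ → weighted-cong q λ q≢0 →
             trans (cong (λ l → colourings l n) (trans (dampBy-++ c as bs)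
                     (cong (dampBy c as ++_) (damp-trivial c bs λ b∈ → drop q≢0 (sep a∈ b∈)))))
                   (colourings-++ n (dampBy c as) bs (Separate-dampˡ c sep))) ⟩
      ∑ as (λ (c , q) → q * splitSum (λ m k → colourings (dampBy c as) m * colourings bs k) n)
        ≡⟨ pull n as (λ c m k → colourings (dampBy c as) m * colourings bs k) ⟩
      splitSum (λ m k → ∑ as (λ (c , q) → q * (colourings (dampBy c as) m * colourings bs k))) n
        ≡⟨ (splitSum-cong n λ m k → trans (∑-cong as λ (c , q) → sym (ℚP.*-assoc q _ (colourings bs k)))
             (∑-*ʳ (colourings bs k) as (λ (c , q) → q * colourings (dampBy c as) m))) ⟩
      splitSum (λ m k → colourings as (suc m) * colourings bs k) n ∎)
    (begin
      ∑ bs (λ (c , q) → q * colourings (dampBy c (as ++ bs)) n)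
        ≡⟨ (∑-cong-∈ bs λ (c , q) b∈ → weighted-cong q λ q≢0 →
             trans (cong (λ l → colourings l n) (trans (dampBy-++ c as bs)
                     (cong (_++ dampBy c bs) (damp-trivial c as λ {a} a∈ → flip q≢0 {proj₁ a} (sep a∈ b∈)))))
                   (colourings-++ n as (dampBy c bs) (Separate-dampʳ c sep))) ⟩
      ∑ bs (λ (c , q) → q * splitSum (λ m k → colourings as m * colourings (dampBy c bs) k) n)
        ≡⟨ pull n bs (λ c m k → colourings as m * colourings (dampBy c bs) k) ⟩
      splitSum (λ m k → ∑ bs (λ (c , q) → q * (colourings as m * colourings (dampBy c bs) k))) n
        ≡⟨ (splitSum-cong n λ m k → trans
             (∑-cong bs λ (c , q) → ℚSolver.solve 3 (λ a b c → a :* (b :* c) := b :* (a :* c)) refl q (colourings as m) (colourings (dampBy c bs) k))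
             (∑-*ˡ (colourings as m) bs (λ (c , q) → q * colourings (dampBy c bs) k))) ⟩
      splitSum (λ m k → colourings as m * colourings bs (suc k)) n ∎))
    where
    open ≡-Reasoning
    open ℚSolver
    drop : ∀ {p q c d} → p ≢ 0ℚ → NoInteraction (c , p) (d , q) → q ≡ 0ℚ ⊎ w c d ≡ 1ℚ
    drop p≢0 (inj₁ p≡0) = ⊥-elim (p≢0 p≡0)
    drop p≢0 (inj₂ r)   = r
    flip : ∀ {p q} → q ≢ 0ℚ → ∀ {c d} → NoInteraction (c , p) (d , q) → p ≡ 0ℚ ⊎ w d c ≡ 1ℚ
    flip q≢0 (inj₁ p≡0)        = inj₁ p≡0
    flip q≢0 (inj₂ (inj₁ q≡0)) = ⊥-elim (q≢0 q≡0)
    flip q≢0 {c} {d} (inj₂ (inj₂ w≡1)) = inj₂ (trans (w-sym d c) w≡1)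

  colourings-single : ∀ c q → w c c ≡ 1ℚ → ∀ n → colourings ((c , q) ∷ []) n ≡ power q n
  colourings-single c q w≡1 zero    = refl
  colourings-single c q w≡1 (suc n) = trans (ℚP.+-identityʳ _) (cong (q *_)
    (trans (cong (λ r → colourings ((c , r) ∷ []) n) (trans (cong (q *_) w≡1) (ℚP.*-identityʳ q)))
           (colourings-single c q w≡1 n)))

  -- The weights are arbitrary because each vertex of one colour doubles the weight of the other;
  -- the power of 2 collects these doublings. At p = q = 1 these are the coefficients of Ψ.
  colourings-pair : ∀ c d → w c c ≡ 1ℚ → w d d ≡ 1ℚ → w c d ≡ natℚ 2 → ∀ n p q →
    colourings ((c , p) ∷ (d , q) ∷ []) n ≡ splitSum (λ m k → power p m * power q k * natℚ (2 ℕ.^ (m ℕ.* k))) n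
  colourings-pair c d wc wd wcd zero    p q = refl
  colourings-pair c d wc wd wcd (suc n) p q = cong₂ _+_
    (begin
      p * colourings ((c , p * w c c) ∷ (d , q * w c d) ∷ []) n
        ≡⟨ cong₂ (λ x y → p * colourings ((c , x) ∷ (d , y) ∷ []) n) (trans (cong (p *_) wc) (ℚP.*-identityʳ p)) (cong (q *_) wcd) ⟩
      p * colourings ((c , p) ∷ (d , q * natℚ 2) ∷ []) n
        ≡⟨ cong (p *_) (colourings-pair c d wc wd wcd n p (q * natℚ 2)) ⟩
      p * splitSum (λ m k → power p m * power (q * natℚ 2) k * natℚ (2 ℕ.^ (m ℕ.* k))) n
        ≡⟨ splitSum-*ˡ p n _ ⟨
      splitSum (λ m k → p * (power p m * power (q * natℚ 2) k * natℚ (2 ℕ.^ (m ℕ.* k)))) n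
        ≡⟨ (splitSum-cong n λ m k → stepˡ m k) ⟩
      splitSum (λ m k → power p (suc m) * power q k * natℚ (2 ℕ.^ (suc m ℕ.* k))) n ∎)
    (trans (ℚP.+-identityʳ _) (begin
      q * colourings ((c , p * w d c) ∷ (d , q * w d d) ∷ []) n
        ≡⟨ cong₂ (λ x y → q * colourings ((c , x) ∷ (d , y) ∷ []) n) (cong (p *_) (trans (w-sym d c) wcd)) (trans (cong (q *_) wd) (ℚP.*-identityʳ q)) ⟩
      q * colourings ((c , p * natℚ 2) ∷ (d , q) ∷ []) n
        ≡⟨ cong (q *_) (colourings-pair c d wc wd wcd n (p * natℚ 2) q) ⟩
      q * splitSum (λ m k → power (p * natℚ 2) m * power q k * natℚ (2 ℕ.^ (m ℕ.* k))) n
        ≡⟨ splitSum-*ˡ q n _ ⟨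
      splitSum (λ m k → q * (power (p * natℚ 2) m * power q k * natℚ (2 ℕ.^ (m ℕ.* k)))) n
        ≡⟨ (splitSum-cong n λ m k → stepʳ m k) ⟩
      splitSum (λ m k → power p m * power q (suc k) * natℚ (2 ℕ.^ (m ℕ.* suc k))) n ∎))
    where
    open ≡-Reasoning
    open ℚSolver
    power-2 : ∀ k → power (natℚ 2) k ≡ natℚ (2 ℕ.^ k)
    power-2 zero    = refl
    power-2 (suc k) = trans (cong (_*_ (natℚ 2)) (power-2 k)) (sym (natℚ-* 2 (2 ℕ.^ k)))
    doubled : ∀ p k → power (p * natℚ 2) k ≡ power p k * natℚ (2 ℕ.^ k)
    doubled p k = trans (power-* p (natℚ 2) k) (cong (_*_ (power p k)) (power-2 k))
    exponent : ∀ a b → natℚ (2 ℕ.^ a) * natℚ (2 ℕ.^ b) ≡ natℚ (2 ℕ.^ (a ℕ.+ b))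
    exponent a b = trans (sym (natℚ-* (2 ℕ.^ a) (2 ℕ.^ b))) (cong natℚ (sym (ℕP.^-distribˡ-+-* 2 a b)))
    stepˡ : ∀ m k → p * (power p m * power (q * natℚ 2) k * natℚ (2 ℕ.^ (m ℕ.* k))) ≡ power p (suc m) * power q k * natℚ (2 ℕ.^ (suc m ℕ.* k))
    stepˡ m k = trans (cong (λ z → p * (power p m * z * natℚ (2 ℕ.^ (m ℕ.* k)))) (doubled q k))
      (trans (ℚSolver.solve 5 (λ a b c d e → a :* (b :* (c :* d) :* e) := a :* b :* c :* (d :* e)) refl p (power p m) (power q k) (natℚ (2 ℕ.^ k)) (natℚ (2 ℕ.^ (m ℕ.* k))))
             (cong (_*_ (power p (suc m) * power q k)) (exponent k (m ℕ.* k))))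
    stepʳ : ∀ m k → q * (power (p * natℚ 2) m * power q k * natℚ (2 ℕ.^ (m ℕ.* k))) ≡ power p m * power q (suc k) * natℚ (2 ℕ.^ (m ℕ.* suc k))
    stepʳ m k = trans (cong (λ z → q * (z * power q k * natℚ (2 ℕ.^ (m ℕ.* k)))) (doubled p m))
      (trans (ℚSolver.solve 5 (λ a b c d e → a :* (b :* c :* d :* e) := b :* (a :* d) :* (c :* e)) refl q (power p m) (natℚ (2 ℕ.^ m)) (power q k) (natℚ (2 ℕ.^ (m ℕ.* k))))
             (cong (_*_ (power p m * power q (suc k))) (trans (exponent m (m ℕ.* k)) (cong (λ z → natℚ (2 ℕ.^ z)) (sym (ℕP.*-suc m k))))))

  colourSeries : List Atom → Series
  colourSeries as = egf (colourings as)

  colourSeries-++ : ∀ as bs → Separate as bs → colourSeries (as ++ bs) ≐ colourSeries as ⊗ colourSeries bs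
  colourSeries-++ as bs sep n k = trans (egf-cong (λ n → colourings-++ n as bs sep) n k) (egf-⊗ (colourings as) (colourings bs) n k)

-- Relations of a fixed block structure

open import Data.Nat using (_<ᵇ_)
open import Data.Bool using (Bool; true; false; if_then_else_; not)
open import Data.Fin as Fin using (Fin; zero; suc; toℕ)
import Data.Fin.Properties as FinP
open import Data.List.Properties using (map-∘; concatMap-map)
open import Data.List.Relation.Binary.Permutation.Propositional as Perm using (_↭_; ↭-refl; prep; swap; ↭-trans)
open import Data.List.Relation.Binary.Permutation.Propositional.Properties using (map⁺)
open import Data.List.Membership.Propositional.Properties using (∈-++⁻)
open import Data.Vec as Vec using (Vec; []; _∷_; lookup)
open import Data.Vec.Properties using (lookup-zip)
open import Data.Product using (∃)
open import Relation.Nullary using (does)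
open import Relation.Nullary.Decidable using (dec-true; dec-false)

∏ : ∀ {n} → (Fin n → ℚ) → ℚ
∏ {zero}  f = 1ℚ
∏ {suc n} f = f zero * ∏ (λ x → f (suc x))

*-interchange : ∀ a b c d → (a * b) * (c * d) ≡ (a * c) * (b * d)
*-interchange = ℚSolver.solve 4 (λ a b c d → (a :* b) :* (c :* d) := (a :* c) :* (b :* d)) refl
  where open ℚSolver

∏-cong : ∀ {n} {f g : Fin n → ℚ} → (∀ x → f x ≡ g x) → ∏ f ≡ ∏ g
∏-cong {zero}  eq = refl
∏-cong {suc n} eq = cong₂ _*_ (eq zero) (∏-cong λ x → eq (suc x))

∏-one : ∀ {n} {f : Fin n → ℚ} → (∀ x → f x ≡ 1ℚ) → ∏ f ≡ 1ℚ
∏-one {zero}  eq = refl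
∏-one {suc n} eq = cong₂ _*_ (eq zero) (∏-one λ x → eq (suc x))

∏-* : ∀ {n} (f g : Fin n → ℚ) → ∏ (λ x → f x * g x) ≡ ∏ f * ∏ g
∏-* {zero}  f g = refl
∏-* {suc n} f g = trans (cong (_*_ (f zero * g zero)) (∏-* (λ x → f (suc x)) (λ x → g (suc x))))
  (*-interchange (f zero) (g zero) (∏ λ x → f (suc x)) (∏ λ x → g (suc x)))

∏-swap : ∀ {m n} (f : Fin m → Fin n → ℚ) → ∏ (λ x → ∏ (f x)) ≡ ∏ (λ y → ∏ (λ x → f x y))
∏-swap {zero} {n} f = sym (∏-one {n} λ _ → refl)
∏-swap {suc m} f = trans (cong (_*_ (∏ (f zero))) (∏-swap λ x → f (suc x)))
  (sym (∏-* (f zero) (λ y → ∏ λ x → f (suc x) y)))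

same : ∀ {n} → Fin n → Fin n → Bool
same x y = does (x Fin.≟ y)

∏-select : ∀ {k} (i : Fin k) (h : Fin k → ℚ) → ∏ (λ j → if same j i then h j else 1ℚ) ≡ h i
∏-select {suc k} zero h = trans (cong (_*_ (h zero)) (∏-one {k} λ j → refl)) (ℚP.*-identityʳ (h zero))
∏-select (suc i) h = trans (ℚP.*-identityˡ _) (∏-select i λ j → h (suc j))

vecs : {A : Set} → List A → ∀ n → List (Vec A n)
vecs as zero    = [] ∷ []
vecs as (suc n) = concatMap (λ a → map (a ∷_) (vecs as n)) as

∑-vecs : {A : Set} (as : List A) → ∀ n (F : Vec A (suc n) → ℚ) →
  ∑ (vecs as (suc n)) F ≡ ∑ as (λ a → ∑ (vecs as n) (λ v → F (a ∷ v)))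
∑-vecs as n F = trans (∑-concatMap _ as F) (∑-cong as λ a → ∑-map (a ∷_) (vecs as n) F)

∑-vecs-∏ : {A : Set} (as : List A) → ∀ {n} (g : Fin n → A → ℚ) →
  ∑ (vecs as n) (λ v → ∏ λ x → g x (lookup v x)) ≡ ∏ λ x → ∑ as (g x)
∑-vecs-∏ as {zero}  g = refl
∑-vecs-∏ as {suc n} g = trans (∑-vecs as n _) (trans
  (∑-cong as λ a → trans (∑-*ˡ (g zero a) (vecs as n) _) (cong (g zero a *_) (∑-vecs-∏ as λ x → g (suc x))))
  (∑-*ʳ (∏ λ x → ∑ as (g (suc x))) as (g zero)))

pairs : {A B : Set} → List A → List B → List (A × B)
pairs as bs = concatMap (λ a → map (a ,_) bs) as

∑-pairs : {A B : Set} (as : List A) (bs : List B) (F : A × B → ℚ) →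
  ∑ (pairs as bs) F ≡ ∑ as (λ a → ∑ bs (λ b → F (a , b)))
∑-pairs as bs F = trans (∑-concatMap _ as F) (∑-cong as λ a → ∑-map (a ,_) bs F)

∑-vecs-pairs : {A B : Set} (as : List A) (bs : List B) → ∀ n (F : Vec (A × B) n → ℚ) →
  ∑ (vecs as n) (λ u → ∑ (vecs bs n) (λ v → F (Vec.zip u v))) ≡ ∑ (vecs (pairs as bs) n) F
∑-vecs-pairs as bs zero    F = trans (cong (_+ 0ℚ) (ℚP.+-identityʳ (F []))) refl
∑-vecs-pairs as bs (suc n) F = begin
  ∑ (vecs as (suc n)) (λ u → ∑ (vecs bs (suc n)) (λ v → F (Vec.zip u v)))
    ≡⟨ ∑-vecs as n _ ⟩
  ∑ as (λ a → ∑ (vecs as n) (λ u → ∑ (vecs bs (suc n)) (λ v → F (Vec.zip (a ∷ u) v))))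
    ≡⟨ (∑-cong as λ a → ∑-cong (vecs as n) λ u → ∑-vecs bs n _) ⟩
  ∑ as (λ a → ∑ (vecs as n) (λ u → ∑ bs (λ b → ∑ (vecs bs n) (λ v → F ((a , b) ∷ Vec.zip u v)))))
    ≡⟨ (∑-cong as λ a → ∑-swap (vecs as n) bs _) ⟩
  ∑ as (λ a → ∑ bs (λ b → ∑ (vecs as n) (λ u → ∑ (vecs bs n) (λ v → F ((a , b) ∷ Vec.zip u v)))))
    ≡⟨ (∑-cong as λ a → ∑-cong bs λ b → ∑-vecs-pairs as bs n λ v → F ((a , b) ∷ v)) ⟩
  ∑ as (λ a → ∑ bs (λ b → ∑ (vecs (pairs as bs) n) (λ v → F ((a , b) ∷ v))))
    ≡⟨ ∑-pairs as bs _ ⟨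
  ∑ (pairs as bs) (λ c → ∑ (vecs (pairs as bs) n) (λ v → F (c ∷ v)))
    ≡⟨ ∑-vecs (pairs as bs) n F ⟨
  ∑ (vecs (pairs as bs) (suc n)) F ∎
  where open ≡-Reasoning

bits : List Bool
bits = true ∷ false ∷ []

relations : ∀ n → List (Relation n)
relations n = vecs (vecs bits n) n

entry : ∀ {n} → Relation n → Fin n → Fin n → Bool
entry R x y = lookup (lookup R x) y

∑-relations-∏ : ∀ {n} (p : Fin n → Fin n → Bool → ℚ) →
  ∑ (relations n) (λ R → ∏ λ x → ∏ λ y → p x y (entry R x y)) ≡ ∏ λ x → ∏ λ y → ∑ bits (p x y)
∑-relations-∏ {n} p = trans (∑-vecs-∏ (vecs bits n) λ x row → ∏ λ y → p x y (lookup row y))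
  (∏-cong λ x → ∑-vecs-∏ bits (p x))

∑-↭ : {A : Set} {xs ys : List A} (f : A → ℚ) → xs ↭ ys → ∑ xs f ≡ ∑ ys f
∑-↭ f Perm.refl          = refl
∑-↭ f (prep x p)         = cong (f x +_) (∑-↭ f p)
∑-↭ {ys = _ ∷ _ ∷ ys} f (swap x y p) = trans (cong (λ z → f x + (f y + z)) (∑-↭ f p))
  (ℚSolver.solve 3 (λ a b c → a :+ (b :+ c) := b :+ (a :+ c)) refl (f x) (f y) (∑ ys f))
  where open ℚSolver
∑-↭ f (Perm.trans p q)   = trans (∑-↭ f p) (∑-↭ f q)

-- An unordered pair x, y of vertices carries two matrix entries, one for (x, y) and one for (y, x),
-- which are summed over independently; the product of both weights is the symmetric interaction.
module DirectedColourSum {C : Set} (d : C → C → ℚ) where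
  open ColourSum (λ c c′ → d c c′ * d c′ c) (λ c c′ → ℚP.*-comm (d c c′) (d c′ c)) public

  interaction : Bool → C → C → ℚ
  interaction s c c′ = if s then 1ℚ else d c c′

  -- The vertex weight γ varies because the induction hypothesis is needed for the weights damped by
  -- the colour of the first vertex.
  ∑-colourings : ∀ cs n (γ : C → ℚ) →
    ∑ (vecs cs n) (λ v → ∏ (λ x → γ (lookup v x)) * ∏ λ x → ∏ λ y → interaction (same x y) (lookup v x) (lookup v y))
      ≡ colourings (map (λ c → c , γ c) cs) n
  ∑-colourings cs zero    γ = refl
  ∑-colourings cs (suc n) γ = begin
    ∑ (vecs cs (suc n)) _ ≡⟨ ∑-vecs cs n _ ⟩
    ∑ cs (λ c → ∑ (vecs cs n) (λ v → (γ c * ∏ (λ x → γ (lookup v x))) *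
      ((1ℚ * ∏ (λ y → d c (lookup v y))) * ∏ (λ x → d (lookup v x) c * ∏ λ y → interaction (same x y) (lookup v x) (lookup v y)))))
      ≡⟨ (∑-cong cs λ c → ∑-cong (vecs cs n) λ v → rearrange c v) ⟩
    ∑ cs (λ c → ∑ (vecs cs n) (λ v → γ c * (∏ (λ x → γ (lookup v x) * (d c (lookup v x) * d (lookup v x) c)) *
      ∏ λ x → ∏ λ y → interaction (same x y) (lookup v x) (lookup v y))))
      ≡⟨ (∑-cong cs λ c → trans (∑-*ˡ (γ c) (vecs cs n) _)
            (cong (γ c *_) (trans (∑-colourings cs n λ c′ → γ c′ * (d c c′ * d c′ c))
              (cong (λ l → colourings l n) (map-∘ cs))))) ⟩
    ∑ cs (λ c → γ c * colourings (dampBy c (map (λ c → c , γ c) cs)) n)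
      ≡⟨ ∑-map (λ c → c , γ c) cs _ ⟨
    colourings (map (λ c → c , γ c) cs) (suc n) ∎
    where
    open ≡-Reasoning
    open ℚSolver
    rearrange : ∀ c (v : Vec C n) → (γ c * ∏ (λ x → γ (lookup v x))) *
      ((1ℚ * ∏ (λ y → d c (lookup v y))) * ∏ (λ x → d (lookup v x) c * ∏ λ y → interaction (same x y) (lookup v x) (lookup v y)))
      ≡ γ c * (∏ (λ x → γ (lookup v x) * (d c (lookup v x) * d (lookup v x) c)) *
      ∏ λ x → ∏ λ y → interaction (same x y) (lookup v x) (lookup v y))
    rearrange c v = trans
      (cong (λ z → (γ c * Γ) * ((1ℚ * D) * z)) (∏-* (λ x → d (lookup v x) c) (λ x → ∏ λ y → interaction (same x y) (lookup v x) (lookup v y))))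
      (trans (ℚSolver.solve 5 (λ g p a b e → (g :* p) :* ((con 1ℚ :* a) :* (b :* e)) := g :* ((p :* (a :* b)) :* e)) refl (γ c) Γ D D′ I)
        (cong (λ z → γ c * (z * I)) (sym (trans (∏-* (λ x → γ (lookup v x)) (λ x → d c (lookup v x) * d (lookup v x) c))
          (cong (Γ *_) (∏-* (λ x → d c (lookup v x)) (λ x → d (lookup v x) c)))))))
      where
      Γ = ∏ (λ x → γ (lookup v x))
      D = ∏ (λ y → d c (lookup v y))
      D′ = ∏ (λ x → d (lookup v x) c)
      I = ∏ λ x → ∏ λ y → interaction (same x y) (lookup v x) (lookup v y)

  colourings-↭ : ∀ n {as bs} → as ↭ bs → colourings as n ≡ colourings bs n
  colourings-↭ zero    p = refl
  colourings-↭ (suc n) {as} {bs} p = trans (∑-↭ _ p)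
    (∑-cong bs λ (c , q) → cong (q *_) (colourings-↭ n (map⁺ _ p)))

-- Block i consists of the elements of level i that lie above all of level i − 1 (lower) and of those
-- of level i + 1 that do not lie above all of level i (upper).  Only the relations from the lower to
-- the upper part of a block are not forced; they form the matrix of the block.
data Side : Set where
  lower upper : Side

lower≢upper : lower ≢ upper
lower≢upper ()

data Tag : Set where
  plain empty full : Tag

Base : ℕ → Set
Base k = Fin k × Side

Colour : ℕ → Set
Colour k = Base k × Tag

level : ∀ {k} → Base k → ℕ
level (i , lower) = toℕ i
level (i , upper) = suc (toℕ i)

free : ∀ {k} → Base k → Base k → Bool
free (i , lower) (j , upper) = same i j
free (i , lower) (j , lower) = false
free (i , upper) _           = false

⟦_⟧ : Bool → ℚ
⟦ true  ⟧ = 1ℚ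
⟦ false ⟧ = 0ℚ

agree : Bool → Bool → ℚ
agree a true  = ⟦ a ⟧
agree a false = ⟦ not a ⟧

forced : ∀ {k} → Bool → Base k → Base k → Bool → ℚ
forced s b c β = if s then ⟦ β ⟧ else if free b c then 1ℚ else agree β (level b <ᵇ level c)

rowFactor colFactor : Tag → Bool → ℚ
rowFactor empty β = ⟦ not β ⟧
rowFactor plain β = 1ℚ
rowFactor full  β = 1ℚ
colFactor empty β = ⟦ not β ⟧
colFactor full  β = ⟦ β ⟧
colFactor plain β = 1ℚ

outTag inTag : ∀ {k} → Base k → Tag → Base k → Bool → ℚ
outTag b t c β = if free b c then rowFactor t β else 1ℚ
inTag  b t c β = if free c b then colFactor t β else 1ℚ

-- Inclusion–exclusion over the rows (lower elements) and columns (upper elements) of a block matrix: an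
-- element tagged empty or full claims that its line consists of zeros or ones.  So noFullCol is the
-- product of (1 − [y is full]) over the columns y, and properCols that of (1 − [y is empty] − [y is full]).
-- With no rows every column is both, and the latter product is (−1)^(number of columns), signedUpper.
data Term : Set where
  anyMatrix noFullCol noEmptyRow noEmptyCol properCols noEmptyLine signedUpper noVertex lowerOnly : Term

weight : Term → Side → Tag → ℚ
weight anyMatrix   _     plain = 1ℚ
weight noFullCol   _     plain = 1ℚ
weight noFullCol   upper full  = - 1ℚ
weight noEmptyRow  _     plain = 1ℚ
weight noEmptyRow  lower empty = - 1ℚ
weight noEmptyCol  _     plain = 1ℚ
weight noEmptyCol  upper empty = - 1ℚ
weight properCols  _     plain = 1ℚ
weight properCols  upper empty = - 1ℚ
weight properCols  upper full  = - 1ℚ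
weight noEmptyLine _     plain = 1ℚ
weight noEmptyLine _     empty = - 1ℚ
weight signedUpper upper plain = - 1ℚ
weight lowerOnly   lower plain = 1ℚ
weight _           _     _     = 0ℚ

tags : List Tag
tags = plain ∷ empty ∷ full ∷ []

sides : List Side
sides = lower ∷ upper ∷ []

fins : ∀ k → List (Fin k)
fins zero    = []
fins (suc k) = zero ∷ map suc (fins k)

bases : ∀ k → List (Base k)
bases k = pairs (fins k) sides

module Pointwise {k n} (b : Vec (Base k) n) (R : Relation n) where
  base : Fin n → Base k
  base = lookup b

  orderForced : ℚ
  orderForced = ∏ λ x → ∏ λ y → forced (same x y) (base x) (base y) (entry R x y)

  -- The product runs effectively over the entries that the tag constrains: the row of x in its
  -- block if x is lower, the column if x is upper. All other factors are 1.
  line : Fin n → Tag → ℚ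
  line x t = ∏ λ y → outTag (base x) t (base y) (entry R x y) * inTag (base x) t (base y) (entry R y x)

  vertexValue : Term → Fin n → ℚ
  vertexValue τ x = ∑ tags λ t → weight τ (proj₂ (base x)) t * line x t

  blockValue : Fin k → Term → ℚ
  blockValue i τ = ∏ λ x → if same i (proj₁ (base x)) then vertexValue τ x else 1ℚ

  blockValues : Vec Term k → ℚ
  blockValues τs = ∏ λ i → blockValue i (lookup τs i)

  blockValues-vertices : ∀ τs → blockValues τs ≡ ∏ λ x → vertexValue (lookup τs (proj₁ (base x))) x
  blockValues-vertices τs = trans (∏-swap λ i x → if same i (proj₁ (base x)) then vertexValue (lookup τs i) x else 1ℚ) (∏-cong λ x →
    ∏-select (proj₁ (base x)) λ i → vertexValue (lookup τs i) x)

-- The sum over the one matrix entry between two vertices of known colours: its order condition, the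
-- row tag of its source and the column tag of its target.
directed : ∀ {k} → Colour k → Colour k → ℚ
directed (b , t) (c , u) = ∑ bits λ β → forced false b c β * (outTag b t c β * inTag c u b β)

module Blocks k = DirectedColourSum (directed {k})

free-irrefl : ∀ {k} (b : Base k) → free b b ≡ false
free-irrefl (i , lower) = refl
free-irrefl (i , upper) = refl

-- A forced entry has exactly one admissible value, and no tag reads it.
directed-unfree : ∀ {k} (b c : Base k) t u → free b c ≡ false → directed (b , t) (c , u) ≡ 1ℚ
directed-unfree b c t u eq with free b c
directed-unfree b c t u refl | false with level b <ᵇ level c
... | true  = refl
... | false = refl

module _ {k : ℕ} (τs : Vec Term k) where
  open Blocks k

  colourWeight : Colour k → ℚ
  colourWeight ((i , s) , t) = weight (lookup τs i) s t

  -- Once every vertex value is expanded over the tags, the summand for fixed blocks and tags is a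
  -- product of functions of single matrix entries. The sum over relations then factorises over
  -- ordered pairs, leaving a colour sum with pairs of base and tag as colours.
  ∑-blockValues : ∀ n →
    ∑ (vecs (bases k) n) (λ b → ∑ (relations n) λ R → Pointwise.orderForced b R * Pointwise.blockValues b R τs)
      ≡ colourings (map (λ c → c , colourWeight c) (pairs (bases k) tags)) n
  ∑-blockValues n = begin
    ∑ (vecs (bases k) n) (λ b → ∑ (relations n) λ R → Pointwise.orderForced b R * Pointwise.blockValues b R τs)
      ≡⟨ (∑-cong (vecs (bases k) n) λ b → trans (∑-cong (relations n) (expand b)) (∑-swap (relations n) (vecs tags n) _)) ⟩
    ∑ (vecs (bases k) n) (λ b → ∑ (vecs tags n) λ t → ∑ (relations n) λ R → summand b t R)
      ≡⟨ (∑-cong (vecs (bases k) n) λ b → ∑-cong (vecs tags n) λ t → collect b t) ⟩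
    ∑ (vecs (bases k) n) (λ b → ∑ (vecs tags n) λ t → colourValue (Vec.zip b t))
      ≡⟨ ∑-vecs-pairs (bases k) tags n colourValue ⟩
    ∑ (vecs (pairs (bases k) tags) n) colourValue
      ≡⟨ ∑-colourings (pairs (bases k) tags) n colourWeight ⟩
    colourings (map (λ c → c , colourWeight c) (pairs (bases k) tags)) n ∎
    where
    open ≡-Reasoning
    open ℚSolver
    colourValue : Vec (Colour k) n → ℚ
    colourValue v = ∏ (λ x → colourWeight (lookup v x)) * ∏ λ x → ∏ λ y → interaction (same x y) (lookup v x) (lookup v y)
    module _ (b : Vec (Base k) n) where
      summand : Vec Tag n → Relation n → ℚ
      summand t R = Pointwise.orderForced b R *
        ∏ λ x → colourWeight (lookup b x , lookup t x) * Pointwise.line b R x (lookup t x)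

      expand : ∀ R → Pointwise.orderForced b R * Pointwise.blockValues b R τs ≡ ∑ (vecs tags n) (λ t → summand t R)
      expand R = trans (cong (Pointwise.orderForced b R *_)
          (trans (Pointwise.blockValues-vertices b R τs) (sym (∑-vecs-∏ tags λ x t → colourWeight (lookup b x , t) * Pointwise.line b R x t))))
        (sym (∑-*ˡ (Pointwise.orderForced b R) (vecs tags n) _))

      module _ (t : Vec Tag n) where
        pairFactor : Fin n → Fin n → Bool → ℚ
        pairFactor x y β = forced (same x y) (lookup b x) (lookup b y) β *
          (outTag (lookup b x) (lookup t x) (lookup b y) β * inTag (lookup b y) (lookup t y) (lookup b x) β)

        factor : ∀ R → summand t R ≡ ∏ (λ x → colourWeight (lookup b x , lookup t x)) * ∏ (λ x → ∏ λ y → pairFactor x y (entry R x y))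
        factor R = begin
          F * ∏ (λ x → γ x * ∏ (λ y → o x y * i x y))
            -- Regrouping by entry: the column factor of y that reads the entry (x, y) joins the row
            -- factor of x that reads it.
            ≡⟨ cong (F *_) (trans (∏-* γ (λ x → ∏ λ y → o x y * i x y)) (cong (∏ γ *_)
                 (trans (∏-cong λ x → ∏-* (o x) (i x)) (trans (∏-* (λ x → ∏ (o x)) (λ x → ∏ (i x)))
                   (trans (cong (∏ (λ x → ∏ (o x)) *_) (∏-swap i)) (sym (trans (∏-cong λ x → ∏-* (o x) (λ y → i y x)) (∏-* (λ x → ∏ (o x)) (λ x → ∏ λ y → i y x))))))))) ⟩
          F * (∏ γ * ∏ (λ x → ∏ λ y → o x y * i y x))
            ≡⟨ ℚSolver.solve 3 (λ a b c → a :* (b :* c) := b :* (a :* c)) refl F (∏ γ) (∏ (λ x → ∏ λ y → o x y * i y x)) ⟩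
          ∏ γ * (F * ∏ (λ x → ∏ λ y → o x y * i y x))
            ≡⟨ cong (∏ γ *_) (sym (trans (∏-cong λ x → ∏-* (f x) (λ y → o x y * i y x)) (∏-* (λ x → ∏ (f x)) (λ x → ∏ λ y → o x y * i y x)))) ⟩
          ∏ γ * ∏ (λ x → ∏ λ y → pairFactor x y (entry R x y)) ∎
          where
          F = Pointwise.orderForced b R
          f = λ x y → forced (same x y) (lookup b x) (lookup b y) (entry R x y)
          γ = λ x → colourWeight (lookup b x , lookup t x)
          o i : Fin n → Fin n → ℚ
          o x y = outTag (lookup b x) (lookup t x) (lookup b y) (entry R x y)
          i x y = inTag (lookup b x) (lookup t x) (lookup b y) (entry R y x)

        pairSum : ∀ x y → ∑ bits (pairFactor x y) ≡ interaction (same x y) (lookup b x , lookup t x) (lookup b y , lookup t y)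
        pairSum x y with x Fin.≟ y
        ... | no _ = refl
        ... | yes refl rewrite free-irrefl (lookup b x) = refl

        collect : ∑ (relations n) (summand t) ≡ colourValue (Vec.zip b t)
        collect = begin
          ∑ (relations n) (summand t) ≡⟨ ∑-cong (relations n) factor ⟩
          ∑ (relations n) (λ R → ∏ γ * ∏ (λ x → ∏ λ y → pairFactor x y (entry R x y)))
            ≡⟨ ∑-*ˡ (∏ γ) (relations n) _ ⟩
          ∏ γ * ∑ (relations n) (λ R → ∏ (λ x → ∏ λ y → pairFactor x y (entry R x y)))
            ≡⟨ cong (∏ γ *_) (trans (∑-relations-∏ pairFactor) (∏-cong λ x → ∏-cong λ y → pairSum x y)) ⟩
          ∏ γ * ∏ (λ x → ∏ λ y → interaction (same x y) (lookup b x , lookup t x) (lookup b y , lookup t y))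
            ≡⟨ cong₂ _*_ (∏-cong λ x → cong colourWeight (sym (lookup-zip x b t)))
                (∏-cong λ x → ∏-cong λ y → cong₂ (interaction (same x y)) (sym (lookup-zip x b t)) (sym (lookup-zip y b t))) ⟩
          colourValue (Vec.zip b t) ∎
          where
          γ = λ x → colourWeight (lookup b x , lookup t x)

-- Generating series of a single block

import Data.Sum
open import Function using (_∘_)

same-refl : ∀ {n} (x : Fin n) → same x x ≡ true
same-refl x = dec-true (x Fin.≟ x) refl

same-≢ : ∀ {n} {x y : Fin n} → x ≢ y → same x y ≡ false
same-≢ {x = x} {y} x≢y = dec-false (x Fin.≟ y) x≢y

directed-free : ∀ {k} (i : Fin k) t u →
  directed ((i , lower) , t) ((i , upper) , u) ≡ ∑ bits λ β → 1ℚ * (rowFactor t β * colFactor u β)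
directed-free i t u rewrite same-refl i = refl

∏ˢ : ∀ {m} → (Fin m → Series) → Series
∏ˢ {zero}  f = 𝟙
∏ˢ {suc m} f = f zero ⊗ ∏ˢ (λ i → f (suc i))

module _ {k : ℕ} where
  open Blocks k

  blockAtoms : Fin k → (Side → Tag → ℚ) → List Atom
  blockAtoms i v = concatMap (λ s → map (λ t → ((i , s) , t) , v s t) tags) sides

  colourAtoms : ∀ (τs : Vec Term k) js →
    map (λ c → c , colourWeight τs c) (pairs (pairs js sides) tags) ≡ concatMap (λ i → blockAtoms i (weight (lookup τs i))) js
  colourAtoms τs []       = refl
  colourAtoms τs (j ∷ js) = cong (λ l → blockAtoms j (weight (lookup τs j)) ++ l) (colourAtoms τs js)

  blockAtoms-block : ∀ i v {a} → a ∈ blockAtoms i v → proj₁ (proj₁ (proj₁ a)) ≡ i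
  blockAtoms-block i v (here refl) = refl
  blockAtoms-block i v (there (here refl)) = refl
  blockAtoms-block i v (there (there (here refl))) = refl
  blockAtoms-block i v (there (there (there (here refl)))) = refl
  blockAtoms-block i v (there (there (there (there (here refl))))) = refl
  blockAtoms-block i v (there (there (there (there (there (here refl)))))) = refl

  free-distinct : ∀ (b c : Base k) → proj₁ b ≢ proj₁ c → free b c ≡ false
  free-distinct (i , lower) (j , lower) i≢j = refl
  free-distinct (i , lower) (j , upper) i≢j = same-≢ i≢j
  free-distinct (i , upper) (j , s)     i≢j = refl

  no-interaction : ∀ (b c : Base k) t u → free b c ≡ false → free c b ≡ false →
    directed (b , t) (c , u) * directed (c , u) (b , t) ≡ 1ℚ
  no-interaction b c t u p q = cong₂ _*_ (directed-unfree b c t u p) (directed-unfree c b u t q)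

  block-interaction : ∀ (i : Fin k) t u → ∑ bits (λ β → 1ℚ * (rowFactor t β * colFactor u β)) ≡ 1ℚ →
    directed ((i , lower) , t) ((i , upper) , u) * directed ((i , upper) , u) ((i , lower) , t) ≡ 1ℚ
  block-interaction i t u eq = cong₂ _*_ (trans (directed-free i t u) eq) (directed-unfree (i , upper) (i , lower) u t refl)

  blocks-separate : ∀ i j v v′ → i ≢ j → Separate (blockAtoms i v) (blockAtoms j v′)
  blocks-separate i j v v′ i≢j {((b , t) , _)} {((c , u) , _)} a∈ b∈ =
    inj₂ (inj₂ (no-interaction b c t u (free-distinct b c distinct) (free-distinct c b (distinct ∘ sym))))
    where distinct = λ eq → i≢j (trans (sym (blockAtoms-block i v a∈)) (trans eq (blockAtoms-block j v′ b∈)))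

  -- The injection ρ lets the induction drop a block while the type of colours stays fixed.
  colourSeries-blocks : ∀ {m} (ρ : Fin m → Fin k) → (∀ {i j} → ρ i ≡ ρ j → i ≡ j) → ∀ (v : Fin m → Side → Tag → ℚ) →
    colourSeries (concatMap (λ i → blockAtoms (ρ i) (v i)) (fins m)) ≐ ∏ˢ (λ i → colourSeries (blockAtoms (ρ i) (v i)))
  colourSeries-blocks {zero} ρ inj v = λ where
    zero    zero    → refl
    zero    (suc k) → refl
    (suc n) zero    → ℚP.*-zeroˡ (inv! (suc n))
    (suc n) (suc k) → refl
  colourSeries-blocks {suc m} ρ inj v n l = trans
    (cong (λ as → colourSeries (blockAtoms (ρ zero) (v zero) ++ as) n l) (concatMap-map (λ i → blockAtoms (ρ i) (v i)) suc (fins m)))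
    (trans (colourSeries-++ (blockAtoms (ρ zero) (v zero)) rest separate n l)
      (Ser.*-congˡ {colourSeries (blockAtoms (ρ zero) (v zero))}
        (colourSeries-blocks (ρ ∘ suc) (FinP.suc-injective ∘ inj) (v ∘ suc)) n l))
    where
    rest = concatMap (λ i → blockAtoms (ρ (suc i)) (v (suc i))) (fins m)
    find : ∀ js {a} → a ∈ concatMap (λ i → blockAtoms (ρ (suc i)) (v (suc i))) js → ∃ λ j → a ∈ blockAtoms (ρ (suc j)) (v (suc j))
    find (j ∷ js) a∈ with ∈-++⁻ (blockAtoms (ρ (suc j)) (v (suc j))) a∈
    ... | inj₁ a∈j = j , a∈j
    ... | inj₂ a∈′ = find js a∈′
    separate : Separate (blockAtoms (ρ zero) (v zero)) rest
    separate a∈ b∈ with find (fins m) b∈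
    ... | j , b∈j = blocks-separate (ρ zero) (ρ (suc j)) (v zero) (v (suc j)) (λ eq → FinP.0≢1+n (inj eq)) a∈ b∈j

  colourSeries-single : ∀ b t q → colourSeries (((b , t) , q) ∷ []) ≐ egf (power q)
  colourSeries-single b t q = egf-cong (colourings-single (b , t) q
    (no-interaction b b t t (free-irrefl b) (free-irrefl b)))

  module _ (i : Fin k) (v : Side → Tag → ℚ) where
    private
      at : Side → Tag → Atom
      at s t = ((i , s) , t) , v s t

    plainPair : Series
    plainPair = colourSeries (at lower plain ∷ at upper plain ∷ [])

    -- Between an untagged lower and an untagged upper vertex the entry takes both values, so the
    -- interaction is 2 and m lower with l upper vertices give 2^(m l).
    plainPair-Ψ : v lower plain ≡ 1ℚ → v upper plain ≡ 1ℚ → plainPair ≐ Ψ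
    plainPair-Ψ p q n l = trans (egf-cong (λ n → trans
      (colourings-pair ((i , lower) , plain) ((i , upper) , plain)
        (no-interaction (i , lower) (i , lower) plain plain refl refl) (no-interaction (i , upper) (i , upper) plain plain refl refl)
        (cong₂ _*_ (directed-free i plain plain) (directed-unfree (i , upper) (i , lower) plain plain refl)) n (v lower plain) (v upper plain))
      (splitSum-cong n λ m l → trans (cong (_* natℚ (2 ℕ.^ (m ℕ.* l)))
        (cong₂ _*_ (trans (cong (λ z → power z m) p) (power-1 m)) (trans (cong (λ z → power z l) q) (power-1 l)))) (ℚP.*-identityˡ _))) n l)
      (Ψ-egf n l)

    plainPair-⊗ : v lower plain ≡ 0ℚ ⊎ v upper plain ≡ 0ℚ → plainPair ≐ egf (power (v lower plain)) ⊗ egf (power (v upper plain))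
    plainPair-⊗ z n l = trans (colourSeries-++ (at lower plain ∷ []) (at upper plain ∷ []) separate n l)
      (⊗-cong (colourSeries-single (i , lower) plain (v lower plain)) (colourSeries-single (i , upper) plain (v upper plain)) n l)
      where
      separate : Separate (at lower plain ∷ []) (at upper plain ∷ [])
      separate (here refl) (here refl) = Data.Sum.map₂ inj₁ z

    -- Once the first hypothesis removes full rows, a tagged line leaves a single value for each of
    -- its entries, so that besides the two plain colours only an empty row and a full column
    -- interact: they contradict each other. The second hypothesis excludes this pair.
    colourSeries-block : v lower full ≡ 0ℚ → v lower empty ≡ 0ℚ ⊎ v upper full ≡ 0ℚ →
      colourSeries (blockAtoms i v) ≐
        plainPair ⊗ (egf (power (v lower empty)) ⊗ (egf (power (v upper empty)) ⊗ egf (power (v upper full))))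
    colourSeries-block lf≡0 conflict n l = begin
      colourSeries (blockAtoms i v) n l
        ≡⟨ egf-cong (λ n → colourings-↭ n reorder) n l ⟩
      colourSeries ((at lower plain ∷ at upper plain ∷ []) ++ at lower full ∷ at lower empty ∷ at upper empty ∷ at upper full ∷ []) n l
        ≡⟨ colourSeries-++ _ _ sep₁ n l ⟩
      (plainPair ⊗ colourSeries (at lower full ∷ at lower empty ∷ at upper empty ∷ at upper full ∷ [])) n l
        ≡⟨ Ser.*-congˡ {plainPair} (λ n l → trans (colourSeries-++ (at lower full ∷ []) _ sep₂ n l)
            (trans (Ser.*-congʳ {colourSeries (at lower empty ∷ at upper empty ∷ at upper full ∷ [])} (λ n l → trans (colourSeries-single (i , lower) full (v lower full) n l)
                             (trans (cong (λ z → egf (power z) n l) lf≡0) (𝟙-egf n l))) n l)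
             (trans (Ser.*-identityˡ (colourSeries (at lower empty ∷ at upper empty ∷ at upper full ∷ [])) n l)
             (trans (colourSeries-++ (at lower empty ∷ []) _ sep₃ n l)
               (⊗-cong (colourSeries-single (i , lower) empty (v lower empty))
                 (λ n l → trans (colourSeries-++ (at upper empty ∷ []) (at upper full ∷ []) sep₄ n l)
                   (⊗-cong (colourSeries-single (i , upper) empty (v upper empty)) (colourSeries-single (i , upper) full (v upper full)) n l)) n l))))) n l ⟩
      (plainPair ⊗ (egf (power (v lower empty)) ⊗ (egf (power (v upper empty)) ⊗ egf (power (v upper full))))) n l ∎
      where
      open ≡-Reasoning
      reorder : blockAtoms i v ↭ at lower plain ∷ at upper plain ∷ at lower full ∷ at lower empty ∷ at upper empty ∷ at upper full ∷ []
      reorder = prep _ (↭-trans (swap _ _ ↭-refl) (↭-trans (prep _ (swap _ _ ↭-refl)) (swap _ _ ↭-refl)))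
      w1 : ∀ s t u → directed ((i , s) , t) ((i , s) , u) * directed ((i , s) , u) ((i , s) , t) ≡ 1ℚ
      w1 s t u = no-interaction (i , s) (i , s) t u (free-irrefl (i , s)) (free-irrefl (i , s))
      sep₁ : Separate (at lower plain ∷ at upper plain ∷ []) (at lower full ∷ at lower empty ∷ at upper empty ∷ at upper full ∷ [])
      sep₁ (here refl)         (here refl)                         = inj₂ (inj₁ lf≡0)
      sep₁ (here refl)         (there (here refl))                 = inj₂ (inj₂ (w1 lower plain empty))
      sep₁ (here refl)         (there (there (here refl)))         = inj₂ (inj₂ (block-interaction i plain empty refl))
      sep₁ (here refl)         (there (there (there (here refl)))) = inj₂ (inj₂ (block-interaction i plain full refl))
      sep₁ (there (here refl)) (here refl)                         = inj₂ (inj₁ lf≡0)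
      sep₁ (there (here refl)) (there (here refl))                 =
        inj₂ (inj₂ (trans (ℚP.*-comm (directed ((i , upper) , plain) ((i , lower) , empty)) (directed ((i , lower) , empty) ((i , upper) , plain))) (block-interaction i empty plain refl)))
      sep₁ (there (here refl)) (there (there (here refl)))         = inj₂ (inj₂ (w1 upper plain empty))
      sep₁ (there (here refl)) (there (there (there (here refl)))) = inj₂ (inj₂ (w1 upper plain full))
      sep₂ : Separate (at lower full ∷ []) (at lower empty ∷ at upper empty ∷ at upper full ∷ [])
      sep₂ (here refl) _ = inj₁ lf≡0
      sep₃ : Separate (at lower empty ∷ []) (at upper empty ∷ at upper full ∷ [])
      sep₃ (here refl) (here refl)         = inj₂ (inj₂ (block-interaction i empty empty refl))
      sep₃ (here refl) (there (here refl)) = Data.Sum.map₂ inj₁ conflict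
      sep₄ : Separate (at upper empty ∷ []) (at upper full ∷ [])
      sep₄ (here refl) (here refl) = inj₂ (inj₂ (w1 upper empty full))

-- Each tag of weight -1 contributes e⁻ˣ. The two plain colours contribute Ψ when both have weight
-- 1; otherwise they do not interact and contribute a product of exponentials.
termSeries : Term → Series
termSeries anyMatrix   = Ψ
termSeries noFullCol   = e⁻ˣ ⊗ Ψ
termSeries noEmptyRow  = e⁻ˣ ⊗ Ψ
termSeries noEmptyCol  = e⁻ˣ ⊗ Ψ
termSeries properCols  = e⁻ˣ ⊗ (e⁻ˣ ⊗ Ψ)
termSeries noEmptyLine = e⁻ˣ ⊗ (e⁻ˣ ⊗ Ψ)
termSeries signedUpper = e⁻ˣ
termSeries noVertex    = 𝟙
termSeries lowerOnly   = eˣ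

module _ {k : ℕ} (i : Fin k) where
  open Blocks k
  open Solver
  private
    collect : ∀ {p a c d p′ a′ c′ d′ : Series} → p ≐ p′ → a ≐ a′ → c ≐ c′ → d ≐ d′ →
      p ⊗ (a ⊗ (c ⊗ d)) ≐ p′ ⊗ (a′ ⊗ (c′ ⊗ d′))
    collect p a c d = ⊗-cong p (⊗-cong a (⊗-cong c d))

  colourSeries-term : ∀ τ → colourSeries (blockAtoms i (weight τ)) ≐ termSeries τ
  colourSeries-term τ@anyMatrix n l = trans (colourSeries-block i (weight τ) refl (inj₁ refl) n l)
    (trans (collect (plainPair-Ψ i (weight τ) refl refl) 𝟙-egf 𝟙-egf 𝟙-egf n l)
      (solve 1 (λ p → p :* (:1 :* (:1 :* :1)) := p) (λ _ _ → refl) Ψ n l))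
  colourSeries-term τ@noFullCol n l = trans (colourSeries-block i (weight τ) refl (inj₁ refl) n l)
    (trans (collect (plainPair-Ψ i (weight τ) refl refl) 𝟙-egf 𝟙-egf e⁻ˣ-egf n l)
      (solve 2 (λ p u → p :* (:1 :* (:1 :* u)) := u :* p) (λ _ _ → refl) Ψ e⁻ˣ n l))
  colourSeries-term τ@noEmptyRow n l = trans (colourSeries-block i (weight τ) refl (inj₂ refl) n l)
    (trans (collect (plainPair-Ψ i (weight τ) refl refl) e⁻ˣ-egf 𝟙-egf 𝟙-egf n l)
      (solve 2 (λ p u → p :* (u :* (:1 :* :1)) := u :* p) (λ _ _ → refl) Ψ e⁻ˣ n l))
  colourSeries-term τ@noEmptyCol n l = trans (colourSeries-block i (weight τ) refl (inj₁ refl) n l)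
    (trans (collect (plainPair-Ψ i (weight τ) refl refl) 𝟙-egf e⁻ˣ-egf 𝟙-egf n l)
      (solve 2 (λ p u → p :* (:1 :* (u :* :1)) := u :* p) (λ _ _ → refl) Ψ e⁻ˣ n l))
  colourSeries-term τ@properCols n l = trans (colourSeries-block i (weight τ) refl (inj₁ refl) n l)
    (trans (collect (plainPair-Ψ i (weight τ) refl refl) 𝟙-egf e⁻ˣ-egf e⁻ˣ-egf n l)
      (solve 2 (λ p u → p :* (:1 :* (u :* u)) := u :* (u :* p)) (λ _ _ → refl) Ψ e⁻ˣ n l))
  colourSeries-term τ@noEmptyLine n l = trans (colourSeries-block i (weight τ) refl (inj₂ refl) n l)
    (trans (collect (plainPair-Ψ i (weight τ) refl refl) e⁻ˣ-egf e⁻ˣ-egf 𝟙-egf n l)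
      (solve 2 (λ p u → p :* (u :* (u :* :1)) := u :* (u :* p)) (λ _ _ → refl) Ψ e⁻ˣ n l))
  colourSeries-term τ@signedUpper n l = trans (colourSeries-block i (weight τ) refl (inj₁ refl) n l)
    (trans (collect (λ n l → trans (plainPair-⊗ i (weight τ) (inj₁ refl) n l) (⊗-cong 𝟙-egf e⁻ˣ-egf n l)) 𝟙-egf 𝟙-egf 𝟙-egf n l)
      (solve 1 (λ u → (:1 :* u) :* (:1 :* (:1 :* :1)) := u) (λ _ _ → refl) e⁻ˣ n l))
  colourSeries-term τ@noVertex n l = trans (colourSeries-block i (weight τ) refl (inj₁ refl) n l)
    (trans (collect (λ n l → trans (plainPair-⊗ i (weight τ) (inj₁ refl) n l) (⊗-cong 𝟙-egf 𝟙-egf n l)) 𝟙-egf 𝟙-egf 𝟙-egf n l)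
      (solve 0 ((:1 :* :1) :* (:1 :* (:1 :* :1)) := :1) (λ _ _ → refl) n l))
  colourSeries-term τ@lowerOnly n l = trans (colourSeries-block i (weight τ) refl (inj₁ refl) n l)
    (trans (collect (λ n l → trans (plainPair-⊗ i (weight τ) (inj₂ refl) n l) (⊗-cong eˣ-egf 𝟙-egf n l)) 𝟙-egf 𝟙-egf 𝟙-egf n l)
      (solve 1 (λ u → (u :* :1) :* (:1 :* (:1 :* :1)) := u) (λ _ _ → refl) eˣ n l))

∏ˢ-cong : ∀ {m} {f g : Fin m → Series} → (∀ i → f i ≐ g i) → ∏ˢ {m} f ≐ ∏ˢ {m} g
∏ˢ-cong {zero}  eq n l = refl
∏ˢ-cong {suc m} eq = ⊗-cong (eq zero) (∏ˢ-cong λ i → eq (suc i))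

∑-blockValues-series : ∀ {k} (τs : Vec Term k) n →
  ∑ (vecs (bases k) n) (λ b → ∑ (relations n) λ R → Pointwise.orderForced b R * Pointwise.blockValues b R τs) * inv! n
    ≡ ∏ˢ (λ i → termSeries (lookup τs i)) n 0
∑-blockValues-series {k} τs n = trans (cong (_* inv! n) (trans (∑-blockValues τs n)
    (cong (λ as → colourings as n) (colourAtoms τs (fins k)))))
  (trans (colourSeries-blocks (λ i → i) (λ eq → eq) (λ i → weight (lookup τs i)) n 0)
    (∏ˢ-cong (λ i → colourSeries-term i (lookup τs i)) n 0))
  where open Blocks k

-- Indicators

import Algebra.Properties.Ring
open import Data.Bool using (T)
open import Data.Unit using (tt)
open import Data.Sum using () renaming ([_,_]′ to either)
open import Relation.Nullary using (Dec)
open import Relation.Nullary.Decidable using (_×-dec_; T?; ¬?)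

-- Signed sums; true marks the positive summands.
FormalSum : Set → Set
FormalSum A = List (Bool × A)

opposite : {A : Set} → FormalSum A → FormalSum A
opposite = map λ (s , x) → not s , x

times : Bool → Bool → Bool
times true  s = s
times false s = not s

infixr 7 _⊠_
_⊠_ : ∀ {A m} → FormalSum A → FormalSum (Vec A m) → FormalSum (Vec A (suc m))
L ⊠ M = concatMap (λ (s , x) → map (λ (s′ , xs) → times s s′ , x ∷ xs) M) L

unit : {A : Set} → FormalSum (Vec A 0)
unit = (true , []) ∷ []

-- One formal sum is evaluated twice: over ℚ it is an indicator on a single structure, over the
-- series ring it is the generating function of the structures so selected. Linearity links both
-- readings.
module Evaluate (R : CommutativeRing 0ℓ 0ℓ) where
  open CommutativeRing R renaming (Carrier to K; _+_ to _⊹_; _*_ to _∙_; -_ to ⁻_)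
  open Algebra.Properties.Ring ring using (-‿distribˡ-*; -‿distribʳ-*; -‿involutive; -‿+-comm; -0#≈0#)
  open import Relation.Binary.Reasoning.Setoid setoid

  signed : Bool → K → K
  signed true  a = a
  signed false a = ⁻ a

  apply : {A : Set} → FormalSum A → (A → K) → K
  apply []            Φ = 0#
  apply ((s , x) ∷ L) Φ = signed s (Φ x) ⊹ apply L Φ

  signed-cong : ∀ s {a b} → a ≈ b → signed s a ≈ signed s b
  signed-cong true  eq = eq
  signed-cong false eq = -‿cong eq

  signed-times : ∀ s s′ a b → signed (times s s′) (a ∙ b) ≈ signed s a ∙ signed s′ b
  signed-times true  true  a b = CommutativeRing.refl R
  signed-times true  false a b = -‿distribʳ-* a b
  signed-times false true  a b = -‿distribˡ-* a b
  signed-times false false a b = begin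
    a ∙ b           ≈⟨ -‿involutive (a ∙ b) ⟨
    ⁻ ⁻ (a ∙ b)     ≈⟨ -‿cong (-‿distribʳ-* a b) ⟩
    ⁻ (a ∙ ⁻ b)     ≈⟨ -‿distribˡ-* a (⁻ b) ⟩
    ⁻ a ∙ ⁻ b       ∎

  apply-cong : {A : Set} (L : FormalSum A) {Φ Θ : A → K} → (∀ x → Φ x ≈ Θ x) → apply L Φ ≈ apply L Θ
  apply-cong []            eq = CommutativeRing.refl R
  apply-cong ((s , x) ∷ L) eq = +-cong (signed-cong s (eq x)) (apply-cong L eq)

  apply-++ : {A : Set} (L M : FormalSum A) (Φ : A → K) → apply (L ++ M) Φ ≈ apply L Φ ⊹ apply M Φ
  apply-++ []      M Φ = CommutativeRing.sym R (+-identityˡ _)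
  apply-++ (x ∷ L) M Φ = CommutativeRing.trans R (+-congˡ (apply-++ L M Φ)) (CommutativeRing.sym R (+-assoc _ _ _))

  apply-opposite : {A : Set} (L : FormalSum A) (Φ : A → K) → apply (opposite L) Φ ≈ ⁻ apply L Φ
  apply-opposite []                Φ = CommutativeRing.sym R -0#≈0#
  apply-opposite ((true  , x) ∷ L) Φ = CommutativeRing.trans R (+-congˡ (apply-opposite L Φ)) (-‿+-comm _ _)
  apply-opposite ((false , x) ∷ L) Φ = CommutativeRing.trans R
    (+-cong (CommutativeRing.sym R (-‿involutive _)) (apply-opposite L Φ)) (-‿+-comm _ _)

  apply-⊠ : ∀ {A m} (L : FormalSum A) (M : FormalSum (Vec A m)) {Φ : Vec A (suc m) → K} {f : A → K} {g : Vec A m → K} →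
    (∀ x xs → Φ (x ∷ xs) ≈ f x ∙ g xs) → apply (L ⊠ M) Φ ≈ apply L f ∙ apply M g
  apply-⊠ []            M eq = CommutativeRing.sym R (zeroˡ _)
  apply-⊠ ((s , x) ∷ L) M {Φ} {f} {g} eq = begin
    apply (map (λ (s′ , xs) → times s s′ , x ∷ xs) M ++ L ⊠ M) Φ ≈⟨ apply-++ (map _ M) (L ⊠ M) Φ ⟩
    apply (map (λ (s′ , xs) → times s s′ , x ∷ xs) M) Φ ⊹ apply (L ⊠ M) Φ ≈⟨ +-cong (row M) (apply-⊠ L M eq) ⟩
    signed s (f x) ∙ apply M g ⊹ apply L f ∙ apply M g ≈⟨ distribʳ _ _ _ ⟨
    apply ((s , x) ∷ L) f ∙ apply M g ∎
    where
    row : ∀ M → apply (map (λ (s′ , xs) → times s s′ , x ∷ xs) M) Φ ≈ signed s (f x) ∙ apply M g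
    row []              = CommutativeRing.sym R (zeroʳ _)
    row ((s′ , xs) ∷ M) = begin
      signed (times s s′) (Φ (x ∷ xs)) ⊹ apply (map (λ (s′ , xs) → times s s′ , x ∷ xs) M) Φ
        ≈⟨ +-cong (CommutativeRing.trans R (signed-cong (times s s′) (eq x xs)) (signed-times s s′ (f x) (g xs))) (row M) ⟩
      signed s (f x) ∙ signed s′ (g xs) ⊹ signed s (f x) ∙ apply M g ≈⟨ distribˡ _ _ _ ⟨
      signed s (f x) ∙ apply ((s′ , xs) ∷ M) g ∎

  apply-⊠-difference : ∀ {A m} (L L′ : FormalSum A) (M M′ : FormalSum (Vec A m)) {Φ : Vec A (suc m) → K} {f : A → K} {g : Vec A m → K} →
    (∀ x xs → Φ (x ∷ xs) ≈ f x ∙ g xs) →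
    apply (L ⊠ M ++ opposite (L′ ⊠ M′)) Φ ≈ apply L f ∙ apply M g ⊹ ⁻ (apply L′ f ∙ apply M′ g)
  apply-⊠-difference L L′ M M′ {Φ} eq = CommutativeRing.trans R (apply-++ (L ⊠ M) _ Φ)
    (+-cong (apply-⊠ L M eq) (CommutativeRing.trans R (apply-opposite (L′ ⊠ M′) Φ) (-‿cong (apply-⊠ L′ M′ eq))))

module Eℚ = Evaluate ℚP.+-*-commutativeRing
module Eˢ = Evaluate seriesRing

-- A row of zeros excludes full columns, so where an empty row is demanded the plain matrix count
-- `anyMatrix` replaces `noFullCol`. The terms `noVertex` correct the block without vertices, and
-- `signedUpper` cancels `properCols` on blocks without rows.
noFull¬rows noFull¬cols noFull¬both noFullFirst noFull¬rowsFirst noFull onlyLower emptyBlock : FormalSum Term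
noFull           = (true , noFullCol) ∷ []
noFull¬rows      = (true , anyMatrix) ∷ (false , noEmptyRow) ∷ (true , noVertex) ∷ []
noFull¬cols      = (true , noFullCol) ∷ (false , properCols) ∷ (true , signedUpper) ∷ []
noFull¬both      = (true , anyMatrix) ∷ (false , noEmptyRow) ∷ (false , noEmptyCol) ∷ (true , noEmptyLine) ∷ (true , noVertex) ∷ []
noFullFirst      = (true , noFullCol) ∷ (false , noVertex) ∷ []
noFull¬rowsFirst = (true , anyMatrix) ∷ (false , noEmptyRow) ∷ []
onlyLower        = (true , lowerOnly) ∷ []
emptyBlock          = (true , noVertex) ∷ []

-- "rows" and "cols" refer to RowsMeet and ColsMeet below.  The condition RowsMeet i ⊎ ColsMeet (i + 1)
-- linking two blocks has indicator 1 − [¬ RowsMeet i] [¬ ColsMeet (i + 1)], so two sums over the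
-- last j + 2 blocks suffice: all structures, and those where ColsMeet fails in the first block.
tail tail¬cols : ∀ j → FormalSum (Vec Term (suc (suc j)))
tail zero         = noFull ⊠ onlyLower ⊠ unit ++ opposite (onlyLower ⊠ emptyBlock ⊠ unit)
tail (suc j)      = noFull ⊠ tail j ++ opposite (noFull¬rows ⊠ tail¬cols j)
tail¬cols zero    = noFull¬cols ⊠ onlyLower ⊠ unit ++ opposite (emptyBlock ⊠ emptyBlock ⊠ unit)
tail¬cols (suc j) = noFull¬cols ⊠ tail j ++ opposite (noFull¬both ⊠ tail¬cols j)

-- From height 3 on there is one block for each level, the last one without upper part. Smaller
-- heights use a single block; in height 2 its upper elements are the non-minimal ones, and full
-- columns are allowed.
blockCount : ℕ → ℕ
blockCount (suc (suc (suc j))) = suc (suc (suc j))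
blockCount _                   = 1

recipe : ∀ k → FormalSum (Vec Term (blockCount k))
recipe 0 = emptyBlock ⊠ unit
recipe 1 = onlyLower ⊠ unit ++ opposite (emptyBlock ⊠ unit)
recipe 2 = ((true , noEmptyCol) ∷ []) ⊠ unit ++ opposite (onlyLower ⊠ unit)
recipe (suc (suc (suc j))) = noFullFirst ⊠ tail j ++ opposite (noFull¬rowsFirst ⊠ tail¬cols j)

Ind : Set → ℚ → Set
Ind P q = (P × q ≡ 1ℚ) ⊎ (¬ P × q ≡ 0ℚ)

ind-yes : ∀ {P q} → Ind P q → P → q ≡ 1ℚ
ind-yes (inj₁ (_ , e))  p = e
ind-yes (inj₂ (¬p , _)) p = ⊥-elim (¬p p)

ind-no : ∀ {P q} → Ind P q → ¬ P → q ≡ 0ℚ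
ind-no (inj₁ (p , _)) ¬p = ⊥-elim (¬p p)
ind-no (inj₂ (_ , e)) ¬p = e

ind-dec : ∀ {P q} → Ind P q → Dec P
ind-dec (inj₁ (p , _))  = yes p
ind-dec (inj₂ (¬p , _)) = no ¬p

ind-¬ : ∀ {P q} → Ind P q → Ind (¬ P) (1ℚ + - q)
ind-¬ (inj₁ (p , refl))  = inj₂ ((λ ¬p → ¬p p) , refl)
ind-¬ (inj₂ (¬p , refl)) = inj₁ (¬p , refl)

ind-⇔ : ∀ {P Q q} → Ind P q → (P → Q) → (Q → P) → Ind Q q
ind-⇔ (inj₁ (p , e))  f g = inj₁ (f p , e)
ind-⇔ (inj₂ (¬p , e)) f g = inj₂ (¬p ∘ g , e)

ind-≡ : ∀ {P q r} → Ind P q → q ≡ r → Ind P r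
ind-≡ i refl = i

ind-× : {P Q : Set} {p q : ℚ} → Ind P p → Ind Q q → Ind (P × Q) (p * q)
ind-× (inj₁ (p , refl))  (inj₁ (q , refl))  = inj₁ ((p , q) , refl)
ind-× (inj₁ (p , refl))  (inj₂ (¬q , refl)) = inj₂ (¬q ∘ proj₂ , refl)
ind-× {q = q} (inj₂ (¬p , refl)) _          = inj₂ (¬p ∘ proj₁ , ℚP.*-zeroˡ q)

ind-∀ : ∀ {n} {P : Fin n → Set} {f : Fin n → ℚ} → (∀ x → Ind (P x) (f x)) → Ind (∀ x → P x) (∏ f)
ind-∀ {zero}  i = inj₁ ((λ ()) , refl)
ind-∀ {suc n} i = ind-⇔ (ind-× (i zero) (ind-∀ λ x → i (suc x)))
  (λ { (p , ps) zero → p ; (p , ps) (suc x) → ps x }) (λ p → p zero , λ x → p (suc x))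

ind-∃ : ∀ {n} {G Q : Fin n → Set} {f : Fin n → ℚ} → (∀ x → Dec (G x)) → (∀ x → Dec (Q x)) →
  (∀ x → G x → Ind (¬ Q x) (f x)) → (∀ x → ¬ G x → f x ≡ 1ℚ) → Ind (∃ λ x → G x × Q x) (1ℚ + - ∏ f)
ind-∃ {G = G} {Q} {f} G? Q? inside outside = ind-⇔ (ind-¬ (ind-∀ step)) find (λ (x , g , q) none → none x g q)
  where
  step : ∀ x → Ind (G x → ¬ Q x) (f x)
  step x with G? x
  ... | yes g = ind-⇔ (inside x g) (λ ¬q _ → ¬q) (λ h → h g)
  ... | no ¬g = inj₁ ((λ g → ⊥-elim (¬g g)) , outside x ¬g)
  find : ¬ (∀ x → G x → ¬ Q x) → ∃ λ x → G x × Q x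
  find ¬none with FinP.any? (λ x → G? x ×-dec Q? x)
  ... | yes e = e
  ... | no ¬e = ⊥-elim (¬none λ x g q → ¬e (x , g , q))

ind-⟦⟧ : ∀ β → Ind (T β) ⟦ β ⟧
ind-⟦⟧ true  = inj₁ (tt , refl)
ind-⟦⟧ false = inj₂ ((λ ()) , refl)

ind-⟦not⟧ : ∀ β → Ind (¬ T β) ⟦ not β ⟧
ind-⟦not⟧ true  = inj₂ ((λ ¬t → ¬t tt) , refl)
ind-⟦not⟧ false = inj₁ ((λ ()) , refl)

-- Inclusion-exclusion terms as indicators on one block

module BlockPredicates {k n} (b : Vec (Base k) n) (R : Relation n) where
  open Pointwise b R public

  Below : Fin n → Fin n → Set
  Below x y = T (entry R x y)

  -- Indexing by natural numbers allows conditions that link block i to block i + 1 without a bound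
  -- on i; a block beyond the last one is simply empty.
  Low Up : ℕ → Fin n → Set
  Low i x = toℕ (proj₁ (base x)) ≡ i × proj₂ (base x) ≡ lower
  Up  i x = toℕ (proj₁ (base x)) ≡ i × proj₂ (base x) ≡ upper

  -- Given the forced relations, `RowsMeet i` puts an element of U_i above every element of level i,
  -- and `ColsMeet (i + 1)` puts an element of D_{i+1} below every element of level i + 2. Either
  -- one yields an element between any two elements of these levels, so that no cover jumps from
  -- level i to level i + 2.
  NoFull Rows Cols NoLow NoUp RowsMeet ColsMeet : ℕ → Set
  NoFull i = ∀ y → Up i y → ∃ λ x → Low i x × ¬ Below x y
  Rows i   = ∀ x → Low i x → ∃ λ y → Up i y × Below x y
  Cols i   = ∀ y → Up i y → ∃ λ x → Low i x × Below x y
  NoLow i  = ∀ x → ¬ Low i x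
  NoUp i   = ∀ x → ¬ Up i x
  RowsMeet i = ∃ (Up i) × Rows i
  ColsMeet i = ∃ (Low i) × Cols i

  -- The conditions on blocks i to i + j + 1. The last clause says that the top level is inhabited;
  -- for the levels i + 1 to i + j this follows from the linking conditions, each of which provides
  -- an element.
  Tail : ℕ → ℕ → Set
  Tail zero    i = NoFull i × NoUp (suc i) × (∃ (Up i) ⊎ ∃ (Low (suc i)))
  Tail (suc j) i = NoFull i × (RowsMeet i ⊎ ColsMeet (suc i)) × Tail j (suc i)

  side? : ∀ (s s′ : Side) → Dec (s ≡ s′)
  side? lower lower = yes refl
  side? lower upper = no λ ()
  side? upper lower = no λ ()
  side? upper upper = yes refl

  low? : ∀ i x → Dec (Low i x)
  low? i x = (toℕ (proj₁ (base x)) ℕ.≟ i) ×-dec side? (proj₂ (base x)) lower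

  up? : ∀ i x → Dec (Up i x)
  up? i x = (toℕ (proj₁ (base x)) ℕ.≟ i) ×-dec side? (proj₂ (base x)) upper

  line-plain : ∀ x → line x plain ≡ 1ℚ
  line-plain x = ∏-one λ y → cong₂ _*_ (unit-weight (free (base x) (base y))) (unit-weight (free (base y) (base x)))
    where
    unit-weight : ∀ f → (if f then 1ℚ else 1ℚ) ≡ 1ℚ
    unit-weight true  = refl
    unit-weight false = refl

  module _ (i : Fin k) where
    private
      ι = toℕ i

    empty-row : ∀ x → base x ≡ (i , lower) → Ind (∃ λ y → Up ι y × Below x y) (1ℚ + - line x empty)
    empty-row x eq = ind-∃ (up? ι) (λ y → T? (entry R x y))
      (λ y u → ind-≡ (ind-⟦not⟧ (entry R x y)) (sym (inside (base x) (base y) (entry R x y) (entry R y x) eq u)))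
      (λ y ¬u → outside (base x) (base y) (entry R x y) (entry R y x) eq ¬u)
      where
      inside : ∀ c d β γ → c ≡ (i , lower) → toℕ (proj₁ d) ≡ ι × proj₂ d ≡ upper → outTag c empty d β * inTag c empty d γ ≡ ⟦ not β ⟧
      inside c (j , upper) β γ refl (e , refl) rewrite FinP.toℕ-injective {i = j} {i} e | same-refl i = ℚP.*-identityʳ ⟦ not β ⟧
      outside : ∀ c d β γ → c ≡ (i , lower) → ¬ (toℕ (proj₁ d) ≡ ι × proj₂ d ≡ upper) → outTag c empty d β * inTag c empty d γ ≡ 1ℚ
      outside c (j , lower) β γ refl ¬u = refl
      outside c (j , upper) β γ refl ¬u rewrite same-≢ {x = i} {j} (λ e → ¬u (cong toℕ (sym e) , refl)) = refl

    private
      column-inside : ∀ t c d β γ → d ≡ (i , upper) → toℕ (proj₁ c) ≡ ι × proj₂ c ≡ lower → outTag d t c β * inTag d t c γ ≡ colFactor t γ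
      column-inside t (j , lower) d β γ refl (e , refl) rewrite FinP.toℕ-injective {i = j} {i} e | same-refl i = ℚP.*-identityˡ (colFactor t γ)

      column-outside : ∀ t c d β γ → d ≡ (i , upper) → ¬ (toℕ (proj₁ c) ≡ ι × proj₂ c ≡ lower) → outTag d t c β * inTag d t c γ ≡ 1ℚ
      column-outside t (j , upper) d β γ refl ¬l = refl
      column-outside t (j , lower) d β γ refl ¬l rewrite same-≢ {x = j} {i} (λ e → ¬l (cong toℕ e , refl)) = refl

    empty-col : ∀ y → base y ≡ (i , upper) → Ind (∃ λ x → Low ι x × Below x y) (1ℚ + - line y empty)
    empty-col y eq = ind-∃ (low? ι) (λ x → T? (entry R x y))
      (λ x l → ind-≡ (ind-⟦not⟧ (entry R x y)) (sym (column-inside empty (base x) (base y) (entry R y x) (entry R x y) eq l)))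
      (λ x ¬l → column-outside empty (base x) (base y) (entry R y x) (entry R x y) eq ¬l)

    full-col : ∀ y → base y ≡ (i , upper) → Ind (∃ λ x → Low ι x × ¬ Below x y) (1ℚ + - line y full)
    full-col y eq = ind-∃ (low? ι) (λ x → ¬? (T? (entry R x y)))
      (λ x l → ind-≡ (ind-⟦¬¬⟧ (entry R x y)) (sym (column-inside full (base x) (base y) (entry R y x) (entry R x y) eq l)))
      (λ x ¬l → column-outside full (base x) (base y) (entry R y x) (entry R x y) eq ¬l)
      where
      ind-⟦¬¬⟧ : ∀ β → Ind (¬ ¬ T β) ⟦ β ⟧
      ind-⟦¬¬⟧ true  = inj₁ ((λ ¬t → ¬t tt) , refl)
      ind-⟦¬¬⟧ false = inj₂ ((λ ¬¬t → ¬¬t λ ()) , refl)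

    private
      module Q = +-*-Solver
      open Q using (solve; con; _:+_; _:*_; _:-_; :-_; _:=_)

      values : ∀ a e f l m → ℚ
      values a e f l m = a * 1ℚ + (e * l + (f * m + 0ℚ))

      value-at : ∀ τ x {s} → base x ≡ (i , s) → vertexValue τ x ≡
        values (weight τ s plain) (weight τ s empty) (weight τ s full) (line x empty) (line x full)
      value-at τ x {s} eq = trans (cong (λ (_ , s) → ∑ tags λ t → weight τ s t * line x t) eq)
        (cong (λ z → weight τ s plain * z + (weight τ s empty * line x empty + (weight τ s full * line x full + 0ℚ))) (line-plain x))

      one : ∀ l m → values 1ℚ 0ℚ 0ℚ l m ≡ 1ℚ
      one = solve 2 (λ l m → con 1ℚ :* con 1ℚ :+ (con 0ℚ :* l :+ (con 0ℚ :* m :+ con 0ℚ)) := con 1ℚ) refl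

      not-empty : ∀ l m → values 1ℚ (- 1ℚ) 0ℚ l m ≡ 1ℚ + - l
      not-empty = solve 2 (λ l m → con 1ℚ :* con 1ℚ :+ (con (- 1ℚ) :* l :+ (con 0ℚ :* m :+ con 0ℚ)) := con 1ℚ :+ :- l) refl

      not-full : ∀ l m → values 1ℚ 0ℚ (- 1ℚ) l m ≡ 1ℚ + - m
      not-full = solve 2 (λ l m → con 1ℚ :* con 1ℚ :+ (con 0ℚ :* l :+ (con (- 1ℚ) :* m :+ con 0ℚ)) := con 1ℚ :+ :- m) refl

      neither : ∀ l m → values 1ℚ (- 1ℚ) (- 1ℚ) l m ≡ (1ℚ + - l) + - m
      neither = solve 2 (λ l m → con 1ℚ :* con 1ℚ :+ (con (- 1ℚ) :* l :+ (con (- 1ℚ) :* m :+ con 0ℚ)) := (con 1ℚ :+ :- l) :+ :- m) refl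

      none : ∀ l m → values 0ℚ 0ℚ 0ℚ l m ≡ 0ℚ
      none = solve 2 (λ l m → con 0ℚ :* con 1ℚ :+ (con 0ℚ :* l :+ (con 0ℚ :* m :+ con 0ℚ)) := con 0ℚ) refl

      minus : ∀ l m → values (- 1ℚ) 0ℚ 0ℚ l m ≡ - 1ℚ
      minus = solve 2 (λ l m → con (- 1ℚ) :* con 1ℚ :+ (con 0ℚ :* l :+ (con 0ℚ :* m :+ con 0ℚ)) := con (- 1ℚ)) refl

      data At (x : Fin n) : Set where
        at-lower  : base x ≡ (i , lower) → At x
        at-upper  : base x ≡ (i , upper) → At x
        elsewhere : proj₁ (base x) ≢ i → At x

      where-is : ∀ x → At x
      where-is x with base x in eq
      ... | j , s with j Fin.≟ i
      where-is x | j , lower | yes refl = at-lower eq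
      where-is x | j , upper | yes refl = at-upper eq
      where-is x | j , s     | no j≢i   = elsewhere λ e → j≢i (trans (sym (cong proj₁ eq)) e)

      low-base : ∀ {x} → Low ι x → base x ≡ (i , lower)
      low-base (p , q) = cong₂ _,_ (FinP.toℕ-injective p) q

      up-base : ∀ {x} → Up ι x → base x ≡ (i , upper)
      up-base (p , q) = cong₂ _,_ (FinP.toℕ-injective p) q

      base-low : ∀ {x} → base x ≡ (i , lower) → Low ι x
      base-low eq = cong (toℕ ∘ proj₁) eq , cong proj₂ eq

      base-up : ∀ {x} → base x ≡ (i , upper) → Up ι x
      base-up eq = cong (toℕ ∘ proj₁) eq , cong proj₂ eq

      low-up : ∀ {x} → base x ≡ (i , lower) → ¬ Up ι x
      low-up eq (_ , q) = lower≢upper (trans (sym (cong proj₂ eq)) q)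

      up-low : ∀ {x} → base x ≡ (i , upper) → ¬ Low ι x
      up-low eq (_ , q) = lower≢upper (trans (sym q) (cong proj₂ eq))

      inside : ∀ τ x {s} → base x ≡ (i , s) → (if same i (proj₁ (base x)) then vertexValue τ x else 1ℚ) ≡ vertexValue τ x
      inside τ x eq = cong (if_then vertexValue τ x else 1ℚ) (trans (cong (same i ∘ proj₁) eq) (same-refl i))

      outside : ∀ τ x → proj₁ (base x) ≢ i → (if same i (proj₁ (base x)) then vertexValue τ x else 1ℚ) ≡ 1ℚ
      outside τ x j≢i = cong (if_then vertexValue τ x else 1ℚ) (same-≢ (j≢i ∘ sym))

      blockValue-ind : ∀ τ {P Q : Fin n → Set} →
        (∀ x → base x ≡ (i , lower) → Ind (P x) (vertexValue τ x)) →
        (∀ x → base x ≡ (i , upper) → Ind (Q x) (vertexValue τ x)) →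
        Ind (∀ x → (Low ι x → P x) × (Up ι x → Q x)) (blockValue i τ)
      blockValue-ind τ {P} {Q} lo up = ind-∀ step
        where
        step : ∀ x → Ind ((Low ι x → P x) × (Up ι x → Q x)) (if same i (proj₁ (base x)) then vertexValue τ x else 1ℚ)
        step x with where-is x
        ... | at-lower eq = ind-⇔ (ind-≡ (lo x eq) (sym (inside τ x eq)))
          (λ p → (λ _ → p) , λ u → ⊥-elim (low-up eq u)) λ (p , _) → p (base-low eq)
        ... | at-upper eq = ind-⇔ (ind-≡ (up x eq) (sym (inside τ x eq)))
          (λ q → (λ l → ⊥-elim (up-low eq l)) , λ _ → q) λ (_ , q) → q (base-up eq)
        ... | elsewhere j≢i = inj₁
          (((λ l → ⊥-elim (j≢i (cong proj₁ (low-base l)))) , λ u → ⊥-elim (j≢i (cong proj₁ (up-base u)))) , outside τ x j≢i)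

      always : ∀ τ x s → base x ≡ (i , s) → weight τ s plain ≡ 1ℚ → weight τ s empty ≡ 0ℚ → weight τ s full ≡ 0ℚ →
        Ind (Fin 1) (vertexValue τ x)
      always τ x s eq p q r = inj₁ (zero , trans (value-at τ x eq) (trans
        (cong (λ (a , e , f) → values a e f (line x empty) (line x full)) (cong₂ _,_ p (cong₂ _,_ q r))) (one (line x empty) (line x full))))

      never : ∀ τ x s → base x ≡ (i , s) → weight τ s plain ≡ 0ℚ → weight τ s empty ≡ 0ℚ → weight τ s full ≡ 0ℚ →
        Ind (Fin 0) (vertexValue τ x)
      never τ x s eq p q r = inj₂ ((λ ()) , trans (value-at τ x eq) (trans
        (cong (λ (a , e , f) → values a e f (line x empty) (line x full)) (cong₂ _,_ p (cong₂ _,_ q r))) (none (line x empty) (line x full))))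

    anyMatrix-one : blockValue i anyMatrix ≡ 1ℚ
    anyMatrix-one = ind-yes (blockValue-ind anyMatrix
      (λ x eq → always anyMatrix x lower eq refl refl refl) (λ x eq → always anyMatrix x upper eq refl refl refl))
      (λ x → (λ _ → zero) , λ _ → zero)

    noFullCol-ind : Ind (NoFull ι) (blockValue i noFullCol)
    noFullCol-ind = ind-⇔ (blockValue-ind noFullCol
      (λ x eq → always noFullCol x lower eq refl refl refl)
      (λ x eq → ind-≡ (full-col x eq) (sym (trans (value-at noFullCol x eq) (not-full (line x empty) (line x full))))))
      (λ h y → proj₂ (h y)) (λ h x → (λ _ → zero) , h x)

    noEmptyRow-ind : Ind (Rows ι) (blockValue i noEmptyRow)
    noEmptyRow-ind = ind-⇔ (blockValue-ind noEmptyRow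
      (λ x eq → ind-≡ (empty-row x eq) (sym (trans (value-at noEmptyRow x eq) (not-empty (line x empty) (line x full)))))
      (λ x eq → always noEmptyRow x upper eq refl refl refl))
      (λ h y → proj₁ (h y)) (λ h x → h x , (λ _ → zero))

    noEmptyCol-ind : Ind (Cols ι) (blockValue i noEmptyCol)
    noEmptyCol-ind = ind-⇔ (blockValue-ind noEmptyCol
      (λ x eq → always noEmptyCol x lower eq refl refl refl)
      (λ x eq → ind-≡ (empty-col x eq) (sym (trans (value-at noEmptyCol x eq) (not-empty (line x empty) (line x full))))))
      (λ h y → proj₂ (h y)) (λ h x → (λ _ → zero) , h x)

    noEmptyLine-ind : Ind (Rows ι × Cols ι) (blockValue i noEmptyLine)
    noEmptyLine-ind = ind-⇔ (blockValue-ind noEmptyLine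
      (λ x eq → ind-≡ (empty-row x eq) (sym (trans (value-at noEmptyLine x eq) (not-empty (line x empty) (line x full)))))
      (λ x eq → ind-≡ (empty-col x eq) (sym (trans (value-at noEmptyLine x eq) (not-empty (line x empty) (line x full))))))
      (λ h → (λ x → proj₁ (h x)) , λ x → proj₂ (h x)) (λ (r , c) x → r x , c x)

    noVertex-ind : Ind (NoLow ι × NoUp ι) (blockValue i noVertex)
    noVertex-ind = ind-⇔ (blockValue-ind noVertex
      (λ x eq → never noVertex x lower eq refl refl refl) (λ x eq → never noVertex x upper eq refl refl refl))
      (λ h → (λ x l → FinP.¬Fin0 (proj₁ (h x) l)) , λ x u → FinP.¬Fin0 (proj₂ (h x) u))
      (λ (nl , nu) x → (λ l → ⊥-elim (nl x l)) , λ u → ⊥-elim (nu x u))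

    lowerOnly-ind : Ind (NoUp ι) (blockValue i lowerOnly)
    lowerOnly-ind = ind-⇔ (blockValue-ind lowerOnly
      (λ x eq → always lowerOnly x lower eq refl refl refl) (λ x eq → never lowerOnly x upper eq refl refl refl))
      (λ h x u → FinP.¬Fin0 (proj₂ (h x) u)) (λ nu x → (λ _ → zero) , λ u → ⊥-elim (nu x u))

    -- A row prevents a column from being empty and full at once, so 1 - [empty] - [full] takes only
    -- the values 0 and 1.
    properCols-ind : ∃ (Low ι) → Ind (NoFull ι × Cols ι) (blockValue i properCols)
    properCols-ind (x₀ , l₀) = ind-⇔ (blockValue-ind properCols {Q = λ y → (∃ λ x → Low ι x × ¬ Below x y) × (∃ λ x → Low ι x × Below x y)}
      (λ x eq → always properCols x lower eq refl refl refl)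
      (λ y eq → ind-≡ (both y {line y empty} {line y full} (full-col y eq) (empty-col y eq)) (sym (trans (value-at properCols y eq) (neither (line y empty) (line y full))))))
      (λ h → (λ y u → proj₁ (proj₂ (h y) u)) , λ y u → proj₂ (proj₂ (h y) u))
      (λ (f , c) y → (λ _ → zero) , λ u → f y u , c y u)
      where
      both : ∀ y {e f} → Ind (∃ λ x → Low ι x × ¬ Below x y) (1ℚ + - f) → Ind (∃ λ x → Low ι x × Below x y) (1ℚ + - e) →
        Ind ((∃ λ x → Low ι x × ¬ Below x y) × (∃ λ x → Low ι x × Below x y)) ((1ℚ + - e) + - f)
      both y {e} {f} (inj₁ (p , pe)) (inj₁ (q , qe)) = inj₁ ((p , q) , trans (cong (_+ - f) qe) pe)
      both y {e} {f} (inj₁ (p , pe)) (inj₂ (¬q , qe)) = inj₂ (¬q ∘ proj₂ , trans (cong (_+ - f) qe)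
        (trans (solve 1 (λ f → con 0ℚ :+ :- f := (con 1ℚ :+ :- f) :+ con (- 1ℚ)) refl f) (cong (_+ - 1ℚ) pe)))
      both y {e} {f} (inj₂ (¬p , pe)) (inj₁ (q , qe)) = inj₂ (¬p ∘ proj₁ , trans (cong (_+ - f) qe) pe)
      both y (inj₂ (¬p , _)) (inj₂ (¬q , _)) with T? (entry R x₀ y)
      ... | yes r = ⊥-elim (¬q (x₀ , l₀ , r))
      ... | no ¬r = ⊥-elim (¬p (x₀ , l₀ , ¬r))

    signedUpper-zero : ∃ (Low ι) → blockValue i signedUpper ≡ 0ℚ
    signedUpper-zero (x , l) = factor-zero x (trans (inside signedUpper x (low-base l))
      (trans (value-at signedUpper x (low-base l)) (none (line x empty) (line x full))))
      where
      factor-zero : ∀ {m} {f : Fin m → ℚ} x → f x ≡ 0ℚ → ∏ f ≡ 0ℚ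
      factor-zero {f = f} zero    eq = *-annihilˡ (∏ λ x → f (suc x)) eq
      factor-zero {f = f} (suc x) eq = *-annihilʳ (f zero) (factor-zero x eq)

    properCols-signedUpper : NoLow ι → blockValue i properCols ≡ blockValue i signedUpper
    properCols-signedUpper nl = ∏-cong λ x → step x
      where
      step : ∀ x → (if same i (proj₁ (base x)) then vertexValue properCols x else 1ℚ)
                 ≡ (if same i (proj₁ (base x)) then vertexValue signedUpper x else 1ℚ)
      step x with where-is x
      ... | at-lower eq = ⊥-elim (nl x (base-low eq))
      ... | elsewhere j≢i = trans (outside properCols x j≢i) (sym (outside signedUpper x j≢i))
      ... | at-upper eq = cong (if same i (proj₁ (base x)) then_else 1ℚ)
        (trans (value-at properCols x eq) (trans (neither (line x empty) (line x full))
          -- Without rows both 1 - e and 1 - f are 0; the rewriting exposes them and leaves -1.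
          (trans (trans (solve 2 (λ e f → (con 1ℚ :+ :- e) :+ :- f := (con 1ℚ :+ :- e) :+ con (- 1ℚ) :+ (con 1ℚ :+ :- f)) refl (line x empty) (line x full))
            (trans (cong₂ (λ p q → p + - 1ℚ + q) (ind-no (empty-col x eq) (λ (z , l , _) → nl z l)) (refl {x = 1ℚ + - line x full}))
             (cong (λ q → 0ℚ + - 1ℚ + q) (ind-no (full-col x eq) (λ (z , l , _) → nl z l)))))
           (sym (trans (value-at signedUpper x eq) (minus (line x empty) (line x full)))))))

-- Combined conditions on one block

module BlockShape {n} (Low Up : Fin n → Set) (Below : Fin n → Fin n → Set) where
  NoFull Rows Cols NoLow NoUp RowsMeet ColsMeet : Set
  NoFull = ∀ y → Up y → ∃ λ x → Low x × ¬ Below x y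
  Rows   = ∀ x → Low x → ∃ λ y → Up y × Below x y
  Cols   = ∀ y → Up y → ∃ λ x → Low x × Below x y
  NoLow  = ∀ x → ¬ Low x
  NoUp   = ∀ x → ¬ Up x
  RowsMeet = ∃ Up × Rows
  ColsMeet = ∃ Low × Cols

some-or-none : ∀ {n} {P : Fin n → Set} → (∀ x → Dec (P x)) → ∃ P ⊎ (∀ x → ¬ P x)
some-or-none P? with FinP.any? P?
... | yes e = inj₁ e
... | no ¬e = inj₂ λ x p → ¬e (x , p)

module BlockCombination {n} {Low Up : Fin n → Set} {Below : Fin n → Fin n → Set}
  (low? : ∀ x → Dec (Low x)) (up? : ∀ x → Dec (Up x)) (below? : ∀ x y → Dec (Below x y)) (v : Term → ℚ)
  (anyMatrix-one : v anyMatrix ≡ 1ℚ) (noFullCol-ind : Ind (BlockShape.NoFull Low Up Below) (v noFullCol))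
  (noEmptyRow-ind : Ind (BlockShape.Rows Low Up Below) (v noEmptyRow)) (noEmptyCol-ind : Ind (BlockShape.Cols Low Up Below) (v noEmptyCol))
  (noEmptyLine-ind : Ind (BlockShape.Rows Low Up Below × BlockShape.Cols Low Up Below) (v noEmptyLine))
  (noVertex-ind : Ind ((∀ x → ¬ Low x) × (∀ x → ¬ Up x)) (v noVertex)) (lowerOnly-ind : Ind (∀ x → ¬ Up x) (v lowerOnly))
  (properCols-ind : ∃ Low → Ind (BlockShape.NoFull Low Up Below × BlockShape.Cols Low Up Below) (v properCols))
  (signedUpper-zero : ∃ Low → v signedUpper ≡ 0ℚ) (properCols-signedUpper : (∀ x → ¬ Low x) → v properCols ≡ v signedUpper) where
  open BlockShape Low Up Below

  noFull-ind : Ind (NoFull) (Eℚ.apply noFull v)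
  noFull-ind = ind-≡ (noFullCol-ind) (sym (ℚP.+-identityʳ _))

  onlyLower-ind : Ind (NoUp) (Eℚ.apply onlyLower v)
  onlyLower-ind = ind-≡ (lowerOnly-ind) (sym (ℚP.+-identityʳ _))

  emptyBlock-ind : Ind (NoLow × NoUp) (Eℚ.apply emptyBlock v)
  emptyBlock-ind = ind-≡ (noVertex-ind) (sym (ℚP.+-identityʳ _))

  private
    -- A full column gives every row an entry.
    noFull-from-emptyRow : ¬ Rows → NoFull
    noFull-from-emptyRow ¬rows y u with some-or-none (λ x → low? x ×-dec ¬? (below? x y))
    ... | inj₁ (x , l , ¬r) = x , l , ¬r
    ... | inj₂ all = ⊥-elim (¬rows λ x l → y , u , r x l)
      where
      r : ∀ x → Low x → Below x y
      r x l with below? x y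
      ... | yes r = r
      ... | no ¬r = ⊥-elim (all x (l , ¬r))

  noFullFirst-ind : Ind (∃ (Low) × NoFull) (Eℚ.apply noFullFirst v)
  noFullFirst-ind with some-or-none (low?)
  ... | inj₁ (x , l) = ind-⇔ (ind-≡ (noFullCol-ind)
          (sym (trans (cong (λ z → v noFullCol + (- z + 0ℚ)) (ind-no (noVertex-ind) λ (nl , _) → nl x l)) (ℚP.+-identityʳ _))))
          (λ f → (x , l) , f) proj₂
  ... | inj₂ nl with some-or-none (up?)
  ...   | inj₁ (y , u) = inj₂ ((λ ((x , l) , _) → nl x l) ,
            cong₂ (λ p q → p + (- q + 0ℚ)) (ind-no (noFullCol-ind) λ f → nl _ (proj₁ (proj₂ (f y u)))) (ind-no (noVertex-ind) λ (_ , nu) → nu y u))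
  ...   | inj₂ nu = inj₂ ((λ ((x , l) , _) → nl x l) ,
            cong₂ (λ p q → p + (- q + 0ℚ)) (ind-yes (noFullCol-ind) λ y u → ⊥-elim (nu y u)) (ind-yes (noVertex-ind) (nl , nu)))

  noFull¬rowsFirst-ind : Ind (∃ (Low) × NoFull × ¬ RowsMeet) (Eℚ.apply noFull¬rowsFirst v)
  noFull¬rowsFirst-ind with some-or-none (low?) | ind-dec (noEmptyRow-ind)
  ... | inj₂ nl | _ = inj₂ ((λ ((x , l) , _) → nl x l) ,
          cong₂ (λ p q → p + (- q + 0ℚ)) (anyMatrix-one) (ind-yes (noEmptyRow-ind) λ x l → ⊥-elim (nl x l)))
  ... | inj₁ (x , l) | yes rows = inj₂ ((λ (_ , _ , ¬a) → ¬a ((_ , proj₁ (proj₂ (rows x l))) , rows)) ,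
          cong₂ (λ p q → p + (- q + 0ℚ)) (anyMatrix-one) (ind-yes (noEmptyRow-ind) rows))
  ... | inj₁ (x , l) | no ¬rows = inj₁ (((x , l) , noFull-from-emptyRow ¬rows , ¬rows ∘ proj₂) ,
          cong₂ (λ p q → p + (- q + 0ℚ)) (anyMatrix-one) (ind-no (noEmptyRow-ind) ¬rows))

  noFull¬rows-ind : Ind (NoFull × ¬ RowsMeet) (Eℚ.apply noFull¬rows v)
  noFull¬rows-ind with some-or-none (up?)
  noFull¬rows-ind | inj₁ (y , u) with ind-dec (noEmptyRow-ind)
  ... | yes rows = inj₂ ((λ (_ , ¬a) → ¬a ((y , u) , rows)) , result (ind-yes (noEmptyRow-ind) rows))
    where result = λ e → cong₂ (λ p (q , r) → p + (- q + (r + 0ℚ))) (anyMatrix-one) (cong₂ _,_ e (ind-no (noVertex-ind) λ (_ , nu) → nu y u))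
  ... | no ¬rows = inj₁ ((noFull-from-emptyRow ¬rows , ¬rows ∘ proj₂) , result (ind-no (noEmptyRow-ind) ¬rows))
    where result = λ e → cong₂ (λ p (q , r) → p + (- q + (r + 0ℚ))) (anyMatrix-one) (cong₂ _,_ e (ind-no (noVertex-ind) λ (_ , nu) → nu y u))
  noFull¬rows-ind | inj₂ nu with some-or-none (low?)
  ... | inj₁ (x , l) = inj₁ (((λ y u → ⊥-elim (nu y u)) , λ ((y , u) , _) → nu y u) ,
          cong₂ (λ p (q , r) → p + (- q + (r + 0ℚ))) (anyMatrix-one)
            (cong₂ _,_ (ind-no (noEmptyRow-ind) λ rows → nu _ (proj₁ (proj₂ (rows x l)))) (ind-no (noVertex-ind) λ (nl , _) → nl x l)))
  ... | inj₂ nl = inj₁ (((λ y u → ⊥-elim (nu y u)) , λ ((y , u) , _) → nu y u) ,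
          cong₂ (λ p (q , r) → p + (- q + (r + 0ℚ))) (anyMatrix-one)
            (cong₂ _,_ (ind-yes (noEmptyRow-ind) λ x l → ⊥-elim (nl x l)) (ind-yes (noVertex-ind) (nl , nu))))

  noFull¬cols-ind : Ind (NoFull × ¬ ColsMeet) (Eℚ.apply noFull¬cols v)
  noFull¬cols-ind with some-or-none (low?)
  ... | inj₂ nl = ind-⇔ (ind-≡ (noFullCol-ind) (sym (trans
          (cong (λ z → v noFullCol + (- z + (v signedUpper + 0ℚ))) (properCols-signedUpper nl))
          (trans (cong (λ z → v noFullCol + (- v signedUpper + z)) (ℚP.+-identityʳ _))
            (trans (cong (v noFullCol +_) (ℚP.+-inverseˡ (v signedUpper))) (ℚP.+-identityʳ _))))))
          (λ f → f , λ ((x , l) , _) → nl x l) proj₁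
  ... | inj₁ (x , l) with ind-dec (noFullCol-ind) | ind-dec (noEmptyCol-ind)
  ...   | no ¬f | _ = inj₂ (¬f ∘ proj₁ , cong₂ (λ p (q , r) → p + (- q + (r + 0ℚ))) (ind-no (noFullCol-ind) ¬f)
            (cong₂ _,_ (ind-no (properCols-ind (x , l)) (¬f ∘ proj₁)) (signedUpper-zero (x , l))))
  ...   | yes f | yes c = inj₂ ((λ (_ , ¬b) → ¬b ((x , l) , c)) , cong₂ (λ p (q , r) → p + (- q + (r + 0ℚ))) (ind-yes (noFullCol-ind) f)
            (cong₂ _,_ (ind-yes (properCols-ind (x , l)) (f , c)) (signedUpper-zero (x , l))))
  ...   | yes f | no ¬c = inj₁ ((f , ¬c ∘ proj₂) , cong₂ (λ p (q , r) → p + (- q + (r + 0ℚ))) (ind-yes (noFullCol-ind) f)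
            (cong₂ _,_ (ind-no (properCols-ind (x , l)) (¬c ∘ proj₂)) (signedUpper-zero (x , l))))

  private
    both-value : ∀ {p q r s} → v noEmptyRow ≡ p → v noEmptyCol ≡ q → v noEmptyLine ≡ r → v noVertex ≡ s →
      Eℚ.apply noFull¬both v ≡ 1ℚ + (- p + (- q + (r + (s + 0ℚ))))
    both-value refl refl refl refl = cong (λ z → z + (- v noEmptyRow + (- v noEmptyCol + (v noEmptyLine + (v noVertex + 0ℚ))))) (anyMatrix-one)

  noFull¬both-ind : Ind (NoFull × ¬ RowsMeet × ¬ ColsMeet) (Eℚ.apply noFull¬both v)
  noFull¬both-ind with some-or-none (low?) | some-or-none (up?)
  ... | inj₂ nl | inj₂ nu = inj₁ (((λ y u → ⊥-elim (nu y u)) , (λ ((y , u) , _) → nu y u) , λ ((x , l) , _) → nl x l) ,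
          both-value (ind-yes (noEmptyRow-ind) λ x l → ⊥-elim (nl x l)) (ind-yes (noEmptyCol-ind) λ y u → ⊥-elim (nu y u))
            (ind-yes (noEmptyLine-ind) ((λ x l → ⊥-elim (nl x l)) , λ y u → ⊥-elim (nu y u))) (ind-yes (noVertex-ind) (nl , nu)))
  ... | inj₂ nl | inj₁ (y , u) = inj₂ ((λ (f , _) → nl _ (proj₁ (proj₂ (f y u)))) ,
          both-value (ind-yes (noEmptyRow-ind) λ x l → ⊥-elim (nl x l)) (ind-no (noEmptyCol-ind) λ c → nl _ (proj₁ (proj₂ (c y u))))
            (ind-no (noEmptyLine-ind) λ (_ , c) → nl _ (proj₁ (proj₂ (c y u)))) (ind-no (noVertex-ind) λ (_ , nu) → nu y u))
  ... | inj₁ (x , l) | inj₂ nu = inj₂ ((λ (_ , _ , ¬b) → ¬b ((x , l) , λ y u → ⊥-elim (nu y u))) ,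
          both-value (ind-no (noEmptyRow-ind) λ r → nu _ (proj₁ (proj₂ (r x l)))) (ind-yes (noEmptyCol-ind) λ y u → ⊥-elim (nu y u))
            (ind-no (noEmptyLine-ind) λ (r , _) → nu _ (proj₁ (proj₂ (r x l)))) (ind-no (noVertex-ind) λ (nl , _) → nl x l))
  ... | inj₁ (x , l) | inj₁ (y , u) with ind-dec (noEmptyRow-ind) | ind-dec (noEmptyCol-ind) | ind-no (noVertex-ind) (λ (nl , _) → nl x l)
  ...   | yes r | yes c | e = inj₂ ((λ (_ , ¬a , _) → ¬a ((y , u) , r)) ,
            both-value (ind-yes (noEmptyRow-ind) r) (ind-yes (noEmptyCol-ind) c) (ind-yes (noEmptyLine-ind) (r , c)) e)
  ...   | yes r | no ¬c | e = inj₂ ((λ (_ , ¬a , _) → ¬a ((y , u) , r)) ,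
            both-value (ind-yes (noEmptyRow-ind) r) (ind-no (noEmptyCol-ind) ¬c) (ind-no (noEmptyLine-ind) (¬c ∘ proj₂)) e)
  ...   | no ¬r | yes c | e = inj₂ ((λ (_ , _ , ¬b) → ¬b ((x , l) , c)) ,
            both-value (ind-no (noEmptyRow-ind) ¬r) (ind-yes (noEmptyCol-ind) c) (ind-no (noEmptyLine-ind) (¬r ∘ proj₁)) e)
  ...   | no ¬r | no ¬c | e = inj₁ ((noFull-from-emptyRow ¬r , ¬r ∘ proj₂ , ¬c ∘ proj₂) ,
            both-value (ind-no (noEmptyRow-ind) ¬r) (ind-no (noEmptyCol-ind) ¬c) (ind-no (noEmptyLine-ind) (¬r ∘ proj₁)) e)

-- The indicator of a whole block structure

open import Data.Empty using (⊥)

one-of : {A B : Set} → Dec A → Dec B → (¬ A → ¬ B → ⊥) → A ⊎ B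
one-of (yes a) _       h = inj₁ a
one-of (no _)  (yes b) h = inj₂ b
one-of (no ¬a) (no ¬b) h = ⊥-elim (h ¬a ¬b)

module PatternIndicator {k n} (b : Vec (Base k) n) (R : Relation n) where
  open BlockPredicates b R public

  module Block (i : Fin k) = BlockCombination {Low = Low (toℕ i)} {Up (toℕ i)} {Below}
    (low? (toℕ i)) (up? (toℕ i)) (λ x y → T? (entry R x y)) (blockValue i)
    (anyMatrix-one i) (noFullCol-ind i) (noEmptyRow-ind i) (noEmptyCol-ind i) (noEmptyLine-ind i)
    (noVertex-ind i) (lowerOnly-ind i) (properCols-ind i) (signedUpper-zero i) (properCols-signedUpper i)

  open Block

  rowsMeet? : ∀ i → Dec (RowsMeet (toℕ i))
  rowsMeet? i = FinP.any? (up? (toℕ i)) ×-dec ind-dec (noEmptyRow-ind i)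

  colsMeet? : ∀ i → Dec (ColsMeet (toℕ i))
  colsMeet? i = FinP.any? (low? (toℕ i)) ×-dec ind-dec (noEmptyCol-ind i)

  valuation : ∀ {m} → (Fin m → Fin k) → Vec Term m → ℚ
  valuation ρ τs = ∏ λ l → blockValue (ρ l) (lookup τs l)

  -- The implication rules out the value -1.
  ind-difference : ∀ {P Q p q} → Ind P p → Ind Q q → (Q → P) → Ind (P × ¬ Q) (p + - q)
  ind-difference (inj₁ (p , refl))  (inj₁ (q , refl))  f = inj₂ ((λ (_ , ¬q) → ¬q q) , refl)
  ind-difference (inj₁ (p , refl))  (inj₂ (¬q , refl)) f = inj₁ ((p , ¬q) , refl)
  ind-difference (inj₂ (¬p , refl)) (inj₁ (q , refl))  f = ⊥-elim (¬p (f q))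
  ind-difference (inj₂ (¬p , refl)) (inj₂ (¬q , refl)) f = inj₂ (¬p ∘ proj₁ , refl)

  factored : ∀ {m} (ρ : Fin (suc m) → Fin k) τ τs →
    valuation ρ (τ ∷ τs) ≡ blockValue (ρ zero) τ * valuation (ρ ∘ suc) τs
  factored ρ τ τs = refl

  difference : ∀ {m} (ρ : Fin (suc m) → Fin k) L L′ (M M′ : FormalSum (Vec Term m)) {P Q P′ Q′} →
    Ind P (Eℚ.apply L (blockValue (ρ zero))) → Ind Q (Eℚ.apply M (valuation (ρ ∘ suc))) →
    Ind P′ (Eℚ.apply L′ (blockValue (ρ zero))) → Ind Q′ (Eℚ.apply M′ (valuation (ρ ∘ suc))) → (P′ × Q′ → P × Q) →
    ∀ {F} → L ⊠ M ++ opposite (L′ ⊠ M′) ≡ F → Ind ((P × Q) × ¬ (P′ × Q′)) (Eℚ.apply F (valuation ρ))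
  difference ρ L L′ M M′ p q p′ q′ f refl = ind-≡ (ind-difference (ind-× p q) (ind-× p′ q′) f)
    (sym (Eℚ.apply-⊠-difference L L′ M M′ (factored ρ)))

  one-block : ∀ (ρ : Fin 1 → Fin k) L {P} → Ind P (Eℚ.apply L (blockValue (ρ zero))) → Ind P (Eℚ.apply (L ⊠ unit) (valuation ρ))
  one-block ρ L p = ind-≡ p (sym (trans (Eℚ.apply-⊠ L unit (factored ρ)) (ℚP.*-identityʳ _)))

  private
    step : ∀ {m} {ρ : Fin (suc m) → Fin k} {i} → (∀ l → toℕ (ρ l) ≡ i ℕ.+ toℕ l) → ∀ l → toℕ (ρ (suc l)) ≡ suc i ℕ.+ toℕ l
    step {i = i} eq l = trans (eq (suc l)) (ℕP.+-suc i (toℕ l))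

    index₀ : ∀ {m} {ρ : Fin (suc m) → Fin k} {i} → (∀ l → toℕ (ρ l) ≡ i ℕ.+ toℕ l) → toℕ (ρ zero) ≡ i
    index₀ {i = i} eq = trans (eq zero) (ℕP.+-identityʳ i)

    index₁ : ∀ {m} {ρ : Fin (suc (suc m)) → Fin k} {i} → (∀ l → toℕ (ρ l) ≡ i ℕ.+ toℕ l) → toℕ (ρ (suc zero)) ≡ suc i
    index₁ {ρ = ρ} eq = index₀ {ρ = ρ ∘ suc} (step {ρ = ρ} eq)

    at : ∀ {P : ℕ → Set} {q i j} → i ≡ j → Ind (P i) q → Ind (P j) q
    at refl x = x

  tail-ind : ∀ j (ρ : Fin (suc (suc j)) → Fin k) i → (∀ l → toℕ (ρ l) ≡ i ℕ.+ toℕ l) →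
    Ind (Tail j i) (Eℚ.apply (tail j) (valuation ρ))
  tail¬cols-ind : ∀ j (ρ : Fin (suc (suc j)) → Fin k) i → (∀ l → toℕ (ρ l) ≡ i ℕ.+ toℕ l) →
    Ind (Tail j i × ¬ ColsMeet i) (Eℚ.apply (tail¬cols j) (valuation ρ))

  tail-ind zero ρ i eq = ind-⇔
    (difference ρ noFull onlyLower (onlyLower ⊠ unit) (emptyBlock ⊠ unit)
      (at {NoFull} e₀ (noFull-ind (ρ zero))) (one-block (ρ ∘ suc) onlyLower (at {NoUp} e₁ (onlyLower-ind (ρ (suc zero)))))
      (at {NoUp} e₀ (onlyLower-ind (ρ zero))) (one-block (ρ ∘ suc) emptyBlock (at {λ l → NoLow l × NoUp l} e₁ (emptyBlock-ind (ρ (suc zero)))))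
      (λ (nu , _ , nu′) → (λ y u → ⊥-elim (nu y u)) , nu′) {tail zero} refl)
    (λ ((f , nu) , h) → f , nu , top nu h) λ (f , nu , t) → (f , nu) , λ (nu₀ , nl₁ , _) → either (λ (y , u) → nu₀ y u) (λ (x , l) → nl₁ x l) t
    where
    e₀ = index₀ {ρ = ρ} eq
    e₁ = index₁ {ρ = ρ} eq
    top : NoUp (suc i) → ¬ (NoUp i × NoLow (suc i) × NoUp (suc i)) → ∃ (Up i) ⊎ ∃ (Low (suc i))
    top nu h with some-or-none (up? i) | some-or-none (low? (suc i))
    ... | inj₁ u  | _       = inj₁ u
    ... | inj₂ _  | inj₁ l  = inj₂ l
    ... | inj₂ nu₀ | inj₂ nl = ⊥-elim (h (nu₀ , nl , nu))
  tail-ind (suc j) ρ i eq = ind-⇔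
    (difference ρ noFull noFull¬rows (tail j) (tail¬cols j)
      (at {NoFull} e₀ (noFull-ind (ρ zero))) (tail-ind j (ρ ∘ suc) (suc i) (step {ρ = ρ} eq))
      (at {λ l → NoFull l × ¬ RowsMeet l} e₀ (noFull¬rows-ind (ρ zero))) (tail¬cols-ind j (ρ ∘ suc) (suc i) (step {ρ = ρ} eq))
      (λ ((f , _) , (t , _)) → f , t) {tail (suc j)} refl)
    (λ ((f , t) , h) → f , meet f t h , t) λ (f , m , t) → (f , t) , λ ((_ , ¬r) , (_ , ¬c)) → either ¬r ¬c m
    where
    e₀ = index₀ {ρ = ρ} eq
    e₁ = index₁ {ρ = ρ} eq
    meet : NoFull i → Tail j (suc i) → ¬ ((NoFull i × ¬ RowsMeet i) × (Tail j (suc i) × ¬ ColsMeet (suc i))) → RowsMeet i ⊎ ColsMeet (suc i)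
    meet f t h = one-of (subst (Dec ∘ RowsMeet) e₀ (rowsMeet? (ρ zero))) (subst (Dec ∘ ColsMeet) e₁ (colsMeet? (ρ (suc zero))))
      λ ¬r ¬c → h ((f , ¬r) , (t , ¬c))

  tail¬cols-ind zero ρ i eq = ind-⇔
    (difference ρ noFull¬cols emptyBlock (onlyLower ⊠ unit) (emptyBlock ⊠ unit)
      (at {λ l → NoFull l × ¬ ColsMeet l} e₀ (noFull¬cols-ind (ρ zero))) (one-block (ρ ∘ suc) onlyLower (at {NoUp} e₁ (onlyLower-ind (ρ (suc zero)))))
      (at {λ l → NoLow l × NoUp l} e₀ (emptyBlock-ind (ρ zero))) (one-block (ρ ∘ suc) emptyBlock (at {λ l → NoLow l × NoUp l} e₁ (emptyBlock-ind (ρ (suc zero)))))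
      (λ ((nl , nu) , _ , nu′) → ((λ y u → ⊥-elim (nu y u)) , λ ((x , l) , _) → nl x l) , nu′) {tail¬cols zero} refl)
    (λ (((f , ¬c) , nu) , h) → (f , nu , top ¬c nu h) , ¬c)
    λ ((f , nu , t) , ¬c) → ((f , ¬c) , nu) , λ ((_ , nu₀) , nl₁ , _) → either (λ (y , u) → nu₀ y u) (λ (x , l) → nl₁ x l) t
    where
    e₀ = index₀ {ρ = ρ} eq
    e₁ = index₁ {ρ = ρ} eq
    -- When U_i is empty, `ColsMeet i` can fail only if D_i is empty too. So the case to exclude, an
    -- empty top level, is that of two empty blocks.
    top : ¬ ColsMeet i → NoUp (suc i) → ¬ ((NoLow i × NoUp i) × NoLow (suc i) × NoUp (suc i)) → ∃ (Up i) ⊎ ∃ (Low (suc i))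
    top ¬c nu h with some-or-none (up? i) | some-or-none (low? (suc i)) | some-or-none (low? i)
    ... | inj₁ u   | _       | _      = inj₁ u
    ... | inj₂ _   | inj₁ l  | _      = inj₂ l
    ... | inj₂ nu₀ | inj₂ nl | inj₁ l = ⊥-elim (¬c (l , λ y u → ⊥-elim (nu₀ y u)))
    ... | inj₂ nu₀ | inj₂ nl | inj₂ nl₀ = ⊥-elim (h ((nl₀ , nu₀) , nl , nu))
  tail¬cols-ind (suc j) ρ i eq = ind-⇔
    (difference ρ noFull¬cols noFull¬both (tail j) (tail¬cols j)
      (at {λ l → NoFull l × ¬ ColsMeet l} e₀ (noFull¬cols-ind (ρ zero))) (tail-ind j (ρ ∘ suc) (suc i) (step {ρ = ρ} eq))
      (at {λ l → NoFull l × ¬ RowsMeet l × ¬ ColsMeet l} e₀ (noFull¬both-ind (ρ zero))) (tail¬cols-ind j (ρ ∘ suc) (suc i) (step {ρ = ρ} eq))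
      (λ ((f , _ , ¬c) , (t , _)) → (f , ¬c) , t) {tail¬cols (suc j)} refl)
    (λ (((f , ¬c) , t) , h) → (f , meet f ¬c t h , t) , ¬c)
    λ ((f , m , t) , ¬c) → ((f , ¬c) , t) , λ ((_ , ¬r , _) , (_ , ¬c′)) → either ¬r ¬c′ m
    where
    e₀ = index₀ {ρ = ρ} eq
    e₁ = index₁ {ρ = ρ} eq
    meet : NoFull i → ¬ ColsMeet i → Tail j (suc i) →
      ¬ ((NoFull i × ¬ RowsMeet i × ¬ ColsMeet i) × (Tail j (suc i) × ¬ ColsMeet (suc i))) → RowsMeet i ⊎ ColsMeet (suc i)
    meet f ¬c t h = one-of (subst (Dec ∘ RowsMeet) e₀ (rowsMeet? (ρ zero))) (subst (Dec ∘ ColsMeet) e₁ (colsMeet? (ρ (suc zero))))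
      λ ¬r ¬c′ → h ((f , ¬r , ¬c) , (t , ¬c′))

  Pattern : ℕ → Set
  Pattern 0 = NoLow 0 × NoUp 0
  Pattern 1 = ∃ (Low 0) × NoUp 0
  Pattern 2 = ∃ (Up 0) × Cols 0
  Pattern (suc (suc (suc j))) = (∃ (Low 0) × NoFull 0) × (RowsMeet 0 ⊎ ColsMeet 1) × Tail j 1

  Ordered : Fin n → Fin n → Set
  Ordered x y = (x ≡ y → Below x y) ×
    (x ≢ y → free (base x) (base y) ≡ false → (Below x y → level (base x) ℕ.< level (base y)) × (level (base x) ℕ.< level (base y) → Below x y))

  orderForced-ind : Ind (∀ x y → Ordered x y) orderForced
  orderForced-ind = ind-∀ λ x → ind-∀ λ y → factor x y
    where
    factor : ∀ x y → Ind (Ordered x y) (forced (same x y) (base x) (base y) (entry R x y))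
    factor x y with x Fin.≟ y
    ... | yes refl = ind-⇔ (ind-⟦⟧ (entry R x x)) (λ r → (λ _ → r) , λ x≢x → ⊥-elim (x≢x refl)) λ (r , _) → r refl
    ... | no x≢y with free (base x) (base y)
    ...   | true  = inj₁ (((λ e → ⊥-elim (x≢y e)) , λ _ ()) , refl)
    ...   | false = ind-⇔ (agree-ind (entry R x y) (level (base x) <ᵇ level (base y)))
              (λ (f , g) → (λ e → ⊥-elim (x≢y e)) , λ _ _ → (λ r → ℕP.<ᵇ⇒< _ _ (f r)) , λ l → g (ℕP.<⇒<ᵇ l))
              (λ (_ , h) → (λ r → ℕP.<⇒<ᵇ (proj₁ (h x≢y refl) r)) , λ l → proj₂ (h x≢y refl) (ℕP.<ᵇ⇒< _ _ l))
      where
      agree-ind : ∀ β γ → Ind ((T β → T γ) × (T γ → T β)) (agree β γ)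
      agree-ind true  true  = inj₁ (((λ _ → tt) , λ _ → tt) , refl)
      agree-ind true  false = inj₂ ((λ (f , _) → f tt) , refl)
      agree-ind false true  = inj₂ ((λ (_ , g) → g tt) , refl)
      agree-ind false false = inj₁ (((λ ()) , λ ()) , refl)

-- Cardinalities as sums of indicators

import Data.Bool.Properties as BoolP
open import Data.List using (length)
open import Data.List.Membership.Propositional using (_∉_)
open import Data.List.Relation.Unary.AllPairs using ([]; _∷_)
open import Data.List.Relation.Unary.Unique.Propositional using (Unique)
import Data.Vec.Properties as VecP
open import Function.Bundles using (Equivalence)

private module ℚR = Algebra.Properties.Ring ℚP.+-*-ring

-- Says that every element occurs exactly once, phrased through sums so that it passes to pairs and
-- vectors by iterated summation instead of reasoning about membership.
Enumerates : {A : Set} → List A → Set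
Enumerates {A} xs = ∀ x (F : A → ℚ) → (∀ y → y ≢ x → F y ≡ 0ℚ) → ∑ xs F ≡ F x

bits-enumerate : Enumerates bits
bits-enumerate true  F z = trans (cong (λ q → F true + (q + 0ℚ)) (z false λ ())) (ℚP.+-identityʳ _)
bits-enumerate false F z = trans (cong (_+ (F false + 0ℚ)) (z true λ ())) (trans (ℚP.+-identityˡ _) (ℚP.+-identityʳ _))

sides-enumerate : Enumerates sides
sides-enumerate lower F z = trans (cong (λ q → F lower + (q + 0ℚ)) (z upper λ ())) (ℚP.+-identityʳ _)
sides-enumerate upper F z = trans (cong (_+ (F upper + 0ℚ)) (z lower λ ())) (trans (ℚP.+-identityˡ _) (ℚP.+-identityʳ _))

fins-enumerate : ∀ k → Enumerates (fins k)
fins-enumerate (suc k) zero    F z = trans (cong (F zero +_)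
  (trans (∑-map suc (fins k) F) (∑-zero (fins k) λ y → z (suc y) λ ()))) (ℚP.+-identityʳ _)
fins-enumerate (suc k) (suc x) F z = trans (cong (_+ ∑ (map suc (fins k)) F) (z zero λ ()))
  (trans (ℚP.+-identityˡ _) (trans (∑-map suc (fins k) F)
    (fins-enumerate k x (F ∘ suc) λ y y≢x → z (suc y) (y≢x ∘ FinP.suc-injective))))

pairs-enumerate : {A B : Set} {as : List A} {bs : List B} → Enumerates as → Enumerates bs → Enumerates (pairs as bs)
pairs-enumerate {as = as} {bs} ea eb (a , b) F z = trans (∑-pairs as bs F)
  (trans (ea a (λ a′ → ∑ bs λ b′ → F (a′ , b′)) (λ a′ a′≢a → ∑-zero bs λ b′ → z (a′ , b′) (a′≢a ∘ cong proj₁)))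
         (eb b (λ b′ → F (a , b′)) λ b′ b′≢b → z (a , b′) (b′≢b ∘ cong proj₂)))

vecs-enumerate : {A : Set} {as : List A} → Enumerates as → ∀ n → Enumerates (vecs as n)
vecs-enumerate {as = as} ea zero    []      F z = ℚP.+-identityʳ _
vecs-enumerate {as = as} ea (suc n) (a ∷ v) F z = trans (∑-vecs as n F)
  (trans (ea a (λ a′ → ∑ (vecs as n) λ v′ → F (a′ ∷ v′)) (λ a′ a′≢a → ∑-zero (vecs as n) λ v′ → z (a′ ∷ v′) (a′≢a ∘ VecP.∷-injectiveˡ)))
         (vecs-enumerate ea n v (λ v′ → F (a ∷ v′)) λ v′ v′≢v → z (a ∷ v′) (v′≢v ∘ VecP.∷-injectiveʳ)))

bases-enumerate : ∀ k → Enumerates (bases k)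
bases-enumerate k = pairs-enumerate {as = fins k} {sides} (fins-enumerate k) sides-enumerate

relations-enumerate : ∀ n → Enumerates (relations n)
relations-enumerate n = vecs-enumerate {as = vecs bits n} (vecs-enumerate {as = bits} bits-enumerate n) n

module _ {A : Set} (_≟_ : (x y : A) → Dec (x ≡ y)) where
  private
    δ : A → A → ℚ
    δ x y = ⟦ does (x ≟ y) ⟧

    δ-same : ∀ x → δ x x ≡ 1ℚ
    δ-same x with x ≟ x
    ... | yes _   = refl
    ... | no x≢x = ⊥-elim (x≢x refl)

    δ-distinct : ∀ {x y} → x ≢ y → δ x y ≡ 0ℚ
    δ-distinct {x} {y} x≢y with x ≟ y
    ... | yes x≡y = ⊥-elim (x≢y x≡y)
    ... | no _    = refl

    δ-∉ : ∀ L {y} → All (y ≢_) L → ∑ L (λ x → δ x y) ≡ 0ℚ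
    δ-∉ []      _            = refl
    δ-∉ (x ∷ L) (y≢x ∷ rest) = cong₂ _+_ (δ-distinct (y≢x ∘ sym)) (δ-∉ L rest)

    δ-∈ : ∀ L → Unique L → ∀ {y} → y ∈ L → ∑ L (λ x → δ x y) ≡ 1ℚ
    δ-∈ (x ∷ L) (fresh ∷ u) (here refl) = cong₂ _+_ (δ-same x) (δ-∉ L fresh)
    δ-∈ (x ∷ L) (fresh ∷ u) (there y∈) = cong₂ _+_ (δ-distinct (All.lookup fresh y∈)) (δ-∈ L u y∈)

    ones : (L : List A) → ∑ L (λ _ → 1ℚ) ≡ natℚ (length L)
    ones []      = refl
    ones (x ∷ L) = trans (cong (1ℚ +_) (ones L)) (sym (natℚ-+ 1 (length L)))

  -- Double counting of the coincidences between L and the enumeration.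
  length-as-sum : ∀ {xs} → Enumerates xs → ∀ L → Unique L → (X : A → ℚ) →
    (∀ x → x ∈ L → X x ≡ 1ℚ) → (∀ x → x ∉ L → X x ≡ 0ℚ) → natℚ (length L) ≡ ∑ xs X
  length-as-sum {xs} exs L u X one zer = begin
    natℚ (length L)                     ≡⟨ ones L ⟨
    ∑ L (λ _ → 1ℚ)                      ≡⟨ (∑-cong L λ ℓ → sym (trans (exs ℓ (δ ℓ) λ y y≢ℓ → δ-distinct (y≢ℓ ∘ sym)) (δ-same ℓ))) ⟩
    ∑ L (λ ℓ → ∑ xs (δ ℓ))              ≡⟨ ∑-swap L xs δ ⟩
    ∑ xs (λ x → ∑ L (λ ℓ → δ ℓ x))      ≡⟨ ∑-cong xs agree′ ⟩
    ∑ xs X ∎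
    where
    open ≡-Reasoning
    open import Data.List.Membership.DecPropositional _≟_ using (_∈?_)
    agree′ : ∀ x → ∑ L (λ ℓ → δ ℓ x) ≡ X x
    agree′ x with x ∈? L
    ... | yes x∈ = trans (δ-∈ L u x∈) (sym (one x x∈))
    ... | no x∉  = trans (δ-∉ L (All.tabulate λ y∈ x≡y → x∉ (subst (_∈ L) (sym x≡y) y∈))) (sym (zer x x∉))

apply-∑ : {A B : Set} (P : FormalSum A) (xs : List B) (Φ : B → A → ℚ) →
  ∑ xs (λ x → Eℚ.apply P (Φ x)) ≡ Eℚ.apply P (λ a → ∑ xs (λ x → Φ x a))
apply-∑ []            xs Φ = ∑-zero xs λ _ → refl
apply-∑ ((s , a) ∷ P) xs Φ = trans (∑-+ xs (λ x → Eℚ.signed s (Φ x a)) (λ x → Eℚ.apply P (Φ x)))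
  (cong₂ _+_ (sign s) (apply-∑ P xs Φ))
  where
  sign : ∀ s → ∑ xs (λ x → Eℚ.signed s (Φ x a)) ≡ Eℚ.signed s (∑ xs (λ x → Φ x a))
  sign true  = refl
  sign false = trans (∑-cong xs λ x → sym (ℚR.-1*x≈-x (Φ x a)))
    (trans (∑-*ˡ (- 1ℚ) xs (λ x → Φ x a)) (ℚR.-1*x≈-x (∑ xs (λ x → Φ x a))))

apply-*ˡ : {A : Set} (P : FormalSum A) (c : ℚ) (Φ : A → ℚ) → c * Eℚ.apply P Φ ≡ Eℚ.apply P (λ a → c * Φ a)
apply-*ˡ []            c Φ = ℚP.*-zeroʳ c
apply-*ˡ ((s , a) ∷ P) c Φ = trans (ℚP.*-distribˡ-+ c (Eℚ.signed s (Φ a)) (Eℚ.apply P Φ)) (cong₂ _+_ (sign s) (apply-*ˡ P c Φ))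
  where
  sign : ∀ s → c * Eℚ.signed s (Φ a) ≡ Eℚ.signed s (c * Φ a)
  sign true  = refl
  sign false = sym (ℚP.neg-distribʳ-* c (Φ a))

apply-series-at : {A : Set} (P : FormalSum A) (Φ : A → Series) → ∀ n k → Eˢ.apply P Φ n k ≡ Eℚ.apply P (λ a → Φ a n k)
apply-series-at []                Φ n k = zero-nested n k
apply-series-at ((true  , a) ∷ P) Φ n k = cong (Φ a n k +_) (apply-series-at P Φ n k)
apply-series-at ((false , a) ∷ P) Φ n k = cong (- Φ a n k +_) (apply-series-at P Φ n k)

pattern-ind : ∀ k {n} (b : Vec (Base (blockCount k)) n) (R : Relation n) →
  Ind (PatternIndicator.Pattern b R k) (Eℚ.apply (recipe k) (Pointwise.blockValues b R))
pattern-ind k b R = go k b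
  where
  factored : ∀ {m n} (b : Vec (Base (suc m)) n) (R : Relation n) τ τs → Pointwise.blockValues b R (τ ∷ τs) ≡
    Pointwise.blockValue b R zero τ * ∏ (λ i → Pointwise.blockValue b R (suc i) (lookup τs i))
  factored b R τ τs = refl
  one-block-difference : ∀ {n} (b : Vec (Base 1) n) (R : Relation n) L L′ {P Q} → Ind P (Eℚ.apply L (Pointwise.blockValue b R zero)) →
    Ind Q (Eℚ.apply L′ (Pointwise.blockValue b R zero)) → (Q → P) → ∀ {F} → L ⊠ unit ++ opposite (L′ ⊠ unit) ≡ F →
    Ind (P × ¬ Q) (Eℚ.apply F (Pointwise.blockValues b R))
  one-block-difference b R L L′ p q f refl = ind-≡ (PatternIndicator.ind-difference b R p q f)
    (sym (trans (Eℚ.apply-⊠-difference L L′ unit unit {Pointwise.blockValues b R} {v} {λ _ → 1ℚ} (factored b R))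
      (cong₂ (λ x y → x + - y) (ℚP.*-identityʳ (Eℚ.apply L v)) (ℚP.*-identityʳ (Eℚ.apply L′ v)))))
    where v = Pointwise.blockValue b R zero
  renamed : ∀ {A : Set} {F G : FormalSum A} {Φ P} → F ≡ G → Ind P (Eℚ.apply F Φ) → Ind P (Eℚ.apply G Φ)
  renamed refl i = i
  go : ∀ k {n} (b : Vec (Base (blockCount k)) n) {R : Relation n} →
    Ind (PatternIndicator.Pattern b R k) (Eℚ.apply (recipe k) (Pointwise.blockValues b R))
  go 0 b {R} = renamed {F = emptyBlock ⊠ unit} {recipe 0} {Pointwise.blockValues b R} refl (ind-≡ (PatternIndicator.Block.emptyBlock-ind b R zero)
    (sym (trans (Eℚ.apply-⊠ emptyBlock unit {Pointwise.blockValues b R} {v} {λ _ → 1ℚ} (factored b R)) (ℚP.*-identityʳ (Eℚ.apply emptyBlock v)))))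
    where v = Pointwise.blockValue b R zero
  go 1 b {R} = ind-⇔ (one-block-difference b R onlyLower emptyBlock (Block.onlyLower-ind zero) (Block.emptyBlock-ind zero) proj₂ {recipe 1} refl)
    (λ (nu , h) → lower-exists nu h) (λ ((x , l) , nu) → nu , λ (nl , _) → nl x l)
    where
    open PatternIndicator b R
    lower-exists : NoUp 0 → ¬ (NoLow 0 × NoUp 0) → ∃ (Low 0) × NoUp 0
    lower-exists nu h with some-or-none (low? 0)
    ... | inj₁ l  = l , nu
    ... | inj₂ nl = ⊥-elim (h (nl , nu))
  go 2 b {R} = ind-⇔ (one-block-difference b R ((true , noEmptyCol) ∷ []) onlyLower
      (ind-≡ (noEmptyCol-ind zero) (sym (ℚP.+-identityʳ (blockValue zero noEmptyCol)))) (Block.onlyLower-ind zero) (λ nu y u → ⊥-elim (nu y u)) {recipe 2} refl)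
    (λ (c , h) → upper-exists h , c) (λ ((y , u) , c) → c , λ nu → nu y u)
    where
    open PatternIndicator b R
    upper-exists : ¬ NoUp 0 → ∃ (Up 0)
    upper-exists h with some-or-none (up? 0)
    ... | inj₁ u  = u
    ... | inj₂ nu = ⊥-elim (h nu)
  go (suc (suc (suc j))) {n} b {R} = ind-⇔ value to from
    where
    open PatternIndicator b R
    P = recipe (suc (suc (suc j)))
    Conditions : Set
    Conditions = ((∃ (Low 0) × NoFull 0) × Tail j 1) ×
      ¬ ((∃ (Low 0) × NoFull 0 × ¬ RowsMeet 0) × (Tail j 1 × ¬ ColsMeet 1))
    value : Ind Conditions (Eℚ.apply P (Pointwise.blockValues b R))
    value = ind-≡ (difference (λ i → i) noFullFirst noFull¬rowsFirst (tail j) (tail¬cols j)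
        (Block.noFullFirst-ind zero) (tail-ind j suc 1 λ l → refl) (Block.noFull¬rowsFirst-ind zero) (tail¬cols-ind j suc 1 λ l → refl)
        (λ ((l , f , _) , (t , _)) → (l , f) , t) {P} refl)
      (Eℚ.apply-cong P {valuation λ i → i} {Pointwise.blockValues b R} λ τs → refl)
    to : Conditions → Pattern (suc (suc (suc j)))
    to (((l , f) , t) , h) = (l , f) , one-of (rowsMeet? zero) (colsMeet? (suc zero)) (λ ¬r ¬c → h ((l , f , ¬r) , t , ¬c)) , t
    from : Pattern (suc (suc (suc j))) → Conditions
    from ((l , f) , m , t) = ((l , f) , t) , λ ((_ , _ , ¬r) , (_ , ¬c)) → either ¬r ¬c m

Compatible : ∀ k {n} → Vec (Base (blockCount k)) n → Relation n → Set
Compatible k b R = (∀ x y → PatternIndicator.Ordered b R x y) × PatternIndicator.Pattern b R k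

module _ {n k : ℕ}
  (decompose : ∀ R → Counted n k R → Σ (Vec (Base (blockCount k)) n) λ b → Compatible k b R × (∀ b′ → Compatible k b′ R → b′ ≡ b))
  (compose : ∀ b R → Compatible k b R → Counted n k R) where

  private
    value : Relation n → Vec (Base (blockCount k)) n → ℚ
    value R b = Pointwise.orderForced b R * Eℚ.apply (recipe k) (Pointwise.blockValues b R)

    X : Relation n → ℚ
    X R = ∑ (vecs (bases (blockCount k)) n) (value R)

    summand-ind : ∀ b R → Ind (Compatible k b R) (value R b)
    summand-ind b R = ind-× (PatternIndicator.orderForced-ind b R) (pattern-ind k b R)

    X-one : ∀ R → Counted n k R → X R ≡ 1ℚ
    X-one R counted = let b , ok , unique = decompose R counted in
      trans (vecs-enumerate {as = bases (blockCount k)} (bases-enumerate (blockCount k)) n b (value R) λ b′ b′≢b → ind-no (summand-ind b′ R) λ ok′ → b′≢b (unique b′ ok′))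
            (ind-yes (summand-ind b R) ok)

    X-zero : ∀ R → ¬ Counted n k R → X R ≡ 0ℚ
    X-zero R ¬counted = ∑-zero (vecs (bases (blockCount k)) n) λ b → ind-no (summand-ind b R) λ ok → ¬counted (compose b R ok)

  -- A counted relation has exactly one compatible block vector and any other relation has none, so
  -- summing the indicators over all vectors gives the indicator of `Counted`. Exchanging the two
  -- sums leaves, for each term of the recipe, the sum already evaluated as a product of series.
  count-series : ∀ {m} → IsCardinality (Counted n k) m →
    natℚ m * inv! n ≡ Eˢ.apply (recipe k) (λ τs → ∏ˢ λ i → termSeries (lookup τs i)) n 0
  count-series (L , u , refl , member) = begin
    natℚ (length L) * inv! n
      ≡⟨ cong (_* inv! n) (length-as-sum (VecP.≡-dec (VecP.≡-dec BoolP._≟_)) {relations n} (relations-enumerate n) L u X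
           (λ R R∈ → X-one R (Equivalence.to (member R) R∈)) (λ R R∉ → X-zero R λ c → R∉ (Equivalence.from (member R) c))) ⟩
    ∑ (relations n) X * inv! n
      ≡⟨ cong (_* inv! n) (∑-swap (relations n) bs value) ⟩
    ∑ bs (λ b → ∑ (relations n) λ R → value R b) * inv! n
      ≡⟨ cong (_* inv! n) (∑-cong bs collect) ⟩
    ∑ bs (λ b → Eℚ.apply P λ τs → ∑ (relations n) λ R → Pointwise.orderForced b R * Pointwise.blockValues b R τs) * inv! n
      ≡⟨ trans (cong (_* inv! n) (apply-∑ P bs λ b τs → ∑ (relations n) λ R → Pointwise.orderForced b R * Pointwise.blockValues b R τs)) (ℚP.*-comm (Eℚ.apply P total) (inv! n)) ⟩
    inv! n * Eℚ.apply P total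
      ≡⟨ apply-*ˡ P (inv! n) total ⟩
    Eℚ.apply P (λ τs → inv! n * total τs)
      ≡⟨ (Eℚ.apply-cong P λ τs → trans (ℚP.*-comm (inv! n) (total τs)) (∑-blockValues-series τs n)) ⟩
    Eℚ.apply P (λ τs → ∏ˢ (λ i → termSeries (lookup τs i)) n 0)
      ≡⟨ apply-series-at P (λ τs → ∏ˢ λ i → termSeries (lookup τs i)) n 0 ⟨
    Eˢ.apply P (λ τs → ∏ˢ λ i → termSeries (lookup τs i)) n 0 ∎
    where
    open ≡-Reasoning
    P = recipe k
    bs = vecs (bases (blockCount k)) n
    total : Vec Term (blockCount k) → ℚ
    total τs = ∑ bs λ b → ∑ (relations n) λ R → Pointwise.orderForced b R * Pointwise.blockValues b R τs
    collect : ∀ b → ∑ (relations n) (λ R → value R b) ≡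
      Eℚ.apply P λ τs → ∑ (relations n) λ R → Pointwise.orderForced b R * Pointwise.blockValues b R τs
    collect b = trans (∑-cong (relations n) λ R → apply-*ˡ P (Pointwise.orderForced b R) (Pointwise.blockValues b R))
      (apply-∑ P (relations n) λ R τs → Pointwise.orderForced b R * Pointwise.blockValues b R τs)

-- Structure of the posets

open import Data.Nat using (_≤_; _<_; z≤n; s≤s)
open import Data.Bool.Properties using (T?)
open import Data.Fin using (fromℕ<)
open import Data.Fin.Induction using (po-wellFounded; po-noetherian)
open import Data.Vec using (tabulate)
open import Induction.WellFounded using (Acc; acc)
open import Relation.Nullary.Decidable using (_⊎-dec_; _→-dec_)
open import Relation.Binary.Structures using (IsPartialOrder)
open import Relation.Binary.Construct.Closure.ReflexiveTransitive using (ε; _◅_; _◅◅_)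
open import Relation.Binary.PropositionalEquality using (subst₂)

free-level : ∀ {k} (b c : Base k) → free b c ≡ true → level c ≡ suc (level b)
free-level (i , lower) (j , upper) eq with i Fin.≟ j
... | yes refl = refl

module Layered {k n} (b : Vec (Base k) n) (R : Relation n) (ordered : ∀ x y → PatternIndicator.Ordered b R x y) where
  open PatternIndicator b R

  lev : Fin n → ℕ
  lev x = level (base x)

  below-refl : ∀ x → Le R x x
  below-refl x = proj₁ (ordered x x) refl

  below-level : ∀ {x y} → Lt R x y → lev x < lev y
  below-level {x} {y} (r , x≢y) = go (free (base x) (base y)) refl
    where
    go : ∀ f → free (base x) (base y) ≡ f → lev x < lev y
    go true  eq = ℕP.≤-reflexive (sym (free-level (base x) (base y) eq))
    go false eq = proj₁ (proj₂ (ordered x y) x≢y eq) r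

  level-below : ∀ {x y} → lev x < lev y → free (base x) (base y) ≡ false → Lt R x y
  level-below {x} {y} l eq = proj₂ (proj₂ (ordered x y) x≢y eq) l , x≢y
    where
    x≢y : x ≢ y
    x≢y refl = ℕP.<-irrefl refl l

  -- Free pairs lie on consecutive levels, so a larger gap is always a forced relation.
  far-below : ∀ {x y} → suc (lev x) < lev y → Lt R x y
  far-below {x} {y} l = go (free (base x) (base y)) refl
    where
    go : ∀ f → free (base x) (base y) ≡ f → Lt R x y
    go true  eq = ⊥-elim (ℕP.<-irrefl (sym (free-level (base x) (base y) eq)) l)
    go false eq = level-below (ℕP.<-trans (ℕP.n<1+n _) l) eq

  below-lower : ∀ {x y} → lev x < lev y → proj₂ (base y) ≡ lower → Lt R x y
  below-lower {x} {y} l s = level-below l (lemma (base x) (base y) s)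
    where
    lemma : ∀ b c → proj₂ c ≡ lower → free b c ≡ false
    lemma (i , lower) (j , lower) refl = refl
    lemma (i , upper) (j , lower) refl = refl

  upper-below : ∀ {x y} → lev x < lev y → proj₂ (base x) ≡ upper → Lt R x y
  upper-below {x} {y} l s = level-below l (lemma (base x) (base y) s)
    where
    lemma : ∀ b c → proj₂ b ≡ upper → free b c ≡ false
    lemma (i , upper) c refl = refl

  isPoset : IsPoset R
  isPoset = record
    { reflexive = below-refl
    ; antisymmetric = anti
    ; transitive = tr }
    where
    anti : ∀ x y → Le R x y → Le R y x → x ≡ y
    anti x y p q with x Fin.≟ y
    ... | yes e   = e
    ... | no x≢y = ⊥-elim (ℕP.<-asym (below-level (p , x≢y)) (below-level (q , x≢y ∘ sym)))
    tr : ∀ x y z → Le R x y → Le R y z → Le R x z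
    tr x y z p q with x Fin.≟ y | y Fin.≟ z
    ... | yes refl | _        = q
    ... | no _     | yes refl = p
    ... | no x≢y   | no y≢z   = proj₁ (far-below (ℕP.≤-<-trans (below-level (p , x≢y)) (below-level (q , y≢z))))

  -- Incomparability with x and z squeezes w strictly between their levels. There a lower w lies
  -- above x and an upper w below z.
  avoids : Avoids3+1 R
  avoids x y z w x<y y<z (¬wx , ¬wy , ¬wz) = side-of (proj₂ (base w)) refl
    where
    w≤x+1 : lev w ≤ suc (lev x)
    w≤x+1 = ℕP.≮⇒≥ λ l → ¬wx (inj₂ (proj₁ (far-below l)))
    z≤w+1 : lev z ≤ suc (lev w)
    z≤w+1 = ℕP.≮⇒≥ λ l → ¬wz (inj₁ (proj₁ (far-below l)))
    x+1<z : suc (lev x) < lev z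
    x+1<z = ℕP.≤-<-trans (below-level x<y) (below-level y<z)
    x<w : lev x < lev w
    x<w = ℕP.≤-pred (ℕP.≤-trans x+1<z z≤w+1)
    w<z : lev w < lev z
    w<z = ℕP.≤-<-trans w≤x+1 x+1<z
    side-of : ∀ s → proj₂ (base w) ≡ s → ⊥
    side-of lower eq = ¬wx (inj₂ (proj₁ (below-lower x<w eq)))
    side-of upper eq = ¬wz (inj₁ (proj₁ (upper-below w<z eq)))

  chain-bound : ∀ {h} → (∀ x → lev x < h) → ∀ j → HasChainOfSize R j → j ≤ h
  chain-bound bound .0 ([] , [] , refl) = z≤n
  chain-bound {h} bound j (x ∷ xs , c , refl) = ℕP.m+n≤o⇒n≤o (lev x) (go x xs c)
    where
    go : ∀ x xs → IsChain R (x ∷ xs) → lev x ℕ.+ suc (length xs) ≤ h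
    go x []       [ .x ]   = ℕP.≤-trans (ℕP.≤-reflexive (ℕP.+-comm (lev x) 1)) (bound x)
    go x (y ∷ xs) (l ∷ c) = ℕP.≤-trans (ℕP.≤-reflexive (ℕP.+-suc (lev x) (suc (length xs))))
      (ℕP.≤-trans (ℕP.+-monoˡ-≤ (suc (length xs)) (below-level l)) (go y xs c))

compose₀ : ∀ {n} b R → Compatible 0 {n} b R → Counted n 0 R
compose₀ {n} b R (ordered , nl , nu) = isPoset , (lev , (λ a → absurd a) , λ a → absurd a) , avoids ,
  ([] , [] , refl) , λ { .0 ([] , c , refl) → z≤n ; _ (x ∷ _ , _ , _) → absurd x }
  where
  open Layered b R ordered
  open PatternIndicator b R using (base)
  absurd : ∀ {A : Set} → Fin n → A
  absurd x with base x | nl x | nu x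
  ... | zero , lower | h | _ = ⊥-elim (h (refl , refl))
  ... | zero , upper | _ | h = ⊥-elim (h (refl , refl))

one-block-base : ∀ (c : Base 1) → c ≡ (zero , lower) ⊎ c ≡ (zero , upper)
one-block-base (zero , lower) = inj₁ refl
one-block-base (zero , upper) = inj₂ refl

compose₁ : ∀ {n} b R → Compatible 1 {n} b R → Counted n 1 R
compose₁ {n} b R (ordered , (x₀ , l₀) , nu) = isPoset ,
  (lev , (λ x y ((x<y , _)) → ⊥-elim (ℕP.n≮0 (subst (lev x <_) (zero-level y) (below-level x<y)))) , λ x → x , ε , zero-level x) ,
  avoids , (x₀ ∷ [] , [ x₀ ] , refl) , chain-bound λ x → s≤s (ℕP.≤-reflexive (zero-level x))
  where
  open Layered b R ordered
  open PatternIndicator b R using (base)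
  zero-level : ∀ x → lev x ≡ 0
  zero-level x = either (cong level) (λ eq → ⊥-elim (nu x (cong (toℕ ∘ proj₁) eq , cong proj₂ eq))) (one-block-base (base x))

compose₂ : ∀ {n} b R → Compatible 2 {n} b R → Counted n 2 R
compose₂ {n} b R (ordered , (y₀ , u₀) , cols) = isPoset , (lev , covers , component) , avoids ,
  (proj₁ (cols y₀ u₀) ∷ y₀ ∷ [] , bottom y₀ u₀ ∷ [ y₀ ] , refl) , chain-bound (λ x → s≤s (level≤1 x))
  where
  open Layered b R ordered
  open PatternIndicator b R using (base; Low; Up)
  level≤1 : ∀ x → lev x ≤ 1
  level≤1 x = either (λ eq → subst (_≤ 1) (cong level (sym eq)) z≤n) (λ eq → subst (_≤ 1) (cong level (sym eq)) (s≤s z≤n)) (one-block-base (base x))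
  low-level : ∀ {x} → Low 0 x → lev x ≡ 0
  low-level {x} (p , q) = trans (cong level {base x} {proj₁ (base x) , lower} (cong (proj₁ (base x) ,_) q)) p
  bottom : ∀ y (u : Up 0 y) → Lt R (proj₁ (cols y u)) y
  bottom y u@(_ , s) with cols y u
  ... | x , (_ , s′) , r = r , λ { refl → lower≢upper (trans (sym s′) s) }
  covers : ∀ x y → Covers R x y → lev y ≡ suc (lev x)
  covers x y (l , _) = ℕP.≤-antisym (ℕP.≤-trans (level≤1 y) (s≤s z≤n)) (below-level l)
  component : ∀ x → ∃ λ y → SameComponent R x y × lev y ≡ 0
  component x with one-block-base (base x)
  ... | inj₁ eq = x , ε , cong level eq
  ... | inj₂ eq with cols x (cong (toℕ ∘ proj₁) eq , cong proj₂ eq)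
  ...   | y , l , r = y , inj₂ r ◅ ε , low-level l

module Compose₃ {j n} (b : Vec (Base (3 ℕ.+ j)) n) (R : Relation n) (compatible : Compatible (3 ℕ.+ j) b R) where
  open Layered b R (proj₁ compatible) public
  open PatternIndicator b R

  private
    pattern₃ = proj₂ compatible

  low-level : ∀ {i x} → Low i x → lev x ≡ i
  low-level {x = x} (p , q) = trans (cong level {base x} {proj₁ (base x) , lower} (cong (proj₁ (base x) ,_) q)) p

  up-level : ∀ {i x} → Up i x → lev x ≡ suc i
  up-level {x = x} (p , q) = trans (cong level {base x} {proj₁ (base x) , upper} (cong (proj₁ (base x) ,_) q)) (cong suc p)

  low-or-up : ∀ x → Low (lev x) x ⊎ ∃ λ i → Up i x × lev x ≡ suc i
  low-or-up x = go (base x) refl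
    where
    go : ∀ c → base x ≡ c → Low (lev x) x ⊎ ∃ λ i → Up i x × lev x ≡ suc i
    go (i , lower) eq = inj₁ (trans (cong (toℕ ∘ proj₁) eq) (sym (cong level eq)) , cong proj₂ eq)
    go (i , upper) eq = inj₂ (toℕ i , (cong (toℕ ∘ proj₁) eq , cong proj₂ eq) , cong level eq)

  private
    distinct : ∀ {x y} → lev y ≡ suc (lev x) → x ≢ y
    distinct eq e = ℕP.1+n≢n (trans (sym eq) (cong lev (sym e)))

    tail-meets : ∀ j i → Tail j i → ∀ l → i ≤ l → l < j ℕ.+ i → RowsMeet l ⊎ ColsMeet (suc l)
    tail-meets zero    i t l i≤l l<i = ⊥-elim (ℕP.<-irrefl refl (ℕP.≤-<-trans i≤l l<i))
    tail-meets (suc j) i (_ , m , t) l i≤l l< with ℕP.m≤n⇒m<n∨m≡n i≤l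
    ... | inj₁ i<l  = tail-meets j (suc i) t l i<l (ℕP.≤-trans l< (ℕP.≤-reflexive (sym (ℕP.+-suc j i))))
    ... | inj₂ refl = m

    tail-noFull : ∀ j i → Tail j i → ∀ l → i ≤ l → l ≤ j ℕ.+ i → NoFull l
    tail-noFull zero    i (f , _) l i≤l l≤i with ℕP.≤-antisym i≤l l≤i
    ... | refl = f
    tail-noFull (suc j) i (f , _ , t) l i≤l l≤ with ℕP.m≤n⇒m<n∨m≡n i≤l
    ... | inj₁ i<l  = tail-noFull j (suc i) t l i<l (ℕP.≤-trans l≤ (ℕP.≤-reflexive (sym (ℕP.+-suc j i))))
    ... | inj₂ refl = f

    tail-top : ∀ j i → Tail j i → NoUp (suc (j ℕ.+ i)) × (∃ (Up (j ℕ.+ i)) ⊎ ∃ (Low (suc (j ℕ.+ i))))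
    tail-top zero    i (_ , nu , t) = nu , t
    tail-top (suc j) i (_ , _ , t) = subst (λ l → NoUp (suc l) × (∃ (Up l) ⊎ ∃ (Low (suc l)))) (ℕP.+-suc j i) (tail-top j (suc i) t)

  height-1 : ℕ
  height-1 = 2 ℕ.+ j

  meets : ∀ l → suc l < height-1 → RowsMeet l ⊎ ColsMeet (suc l)
  meets zero    _         = proj₁ (proj₂ pattern₃)
  meets (suc l) (s≤s lt) = tail-meets j 1 (proj₂ (proj₂ pattern₃)) (suc l) (s≤s z≤n) (ℕP.≤-trans lt (ℕP.≤-reflexive (ℕP.+-comm 1 j)))

  noFull-block : ∀ l → l < height-1 → NoFull l
  noFull-block zero    _         = proj₂ (proj₁ pattern₃)
  noFull-block (suc l) (s≤s lt) = tail-noFull j 1 (proj₂ (proj₂ pattern₃)) (suc l) (s≤s z≤n) (ℕP.≤-trans lt (ℕP.≤-reflexive (ℕP.+-comm 1 j)))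

  private
    top-facts : NoUp height-1 × (∃ (Up (suc j)) ⊎ ∃ (Low height-1))
    top-facts = subst (λ l → NoUp (suc l) × (∃ (Up l) ⊎ ∃ (Low (suc l)))) (ℕP.+-comm j 1) (tail-top j 1 (proj₂ (proj₂ pattern₃)))

  level-bound : ∀ x → lev x < suc height-1
  level-bound x with low-or-up x
  ... | inj₁ (p , _) = subst (_< suc height-1) p (FinP.toℕ<n (proj₁ (base x)))
  ... | inj₂ (i , u@(p , _) , eq) = ℕP.≤∧≢⇒< (subst (_≤ suc height-1) (sym eq) (subst (_< suc height-1) p (FinP.toℕ<n (proj₁ (base x)))))
      λ e → proj₁ top-facts x (subst (λ l → Up l x) (ℕP.suc-injective (trans (sym eq) e)) u)

  up-bound : ∀ {i x} → Up i x → i < height-1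
  up-bound {i} {x} u = ℕP.≤-pred (subst (_< suc height-1) (up-level u) (level-bound x))

  bottom : ∃ λ x → lev x ≡ 0
  bottom = let x , l = proj₁ (proj₁ pattern₃) in x , low-level l

  top : ∃ λ x → lev x ≡ height-1
  top = either (λ (x , u) → x , up-level u) (λ (x , l) → x , low-level l) (proj₂ top-facts)

  -- An upper y is below everything on higher levels and a lower y above everything on lower ones.
  -- So with y in the upper part only x < y needs an argument, which `Rows` supplies, and with y in
  -- the lower part only y < z, from `Cols`.
  between : ∀ x z → suc (lev x) < lev z → ∃ λ y → Lt R x y × lev y ≡ suc (lev x) × Lt R y z
  between x z x+1<z = either via-row via-col (meets (lev x) (ℕP.≤-pred (ℕP.≤-trans (s≤s x+1<z) (level-bound z))))
    where
    via-row : RowsMeet (lev x) → ∃ λ y → Lt R x y × lev y ≡ suc (lev x) × Lt R y z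
    via-row ((y , u) , rows) = go (low-or-up x)
      where
      below-z : ∀ {y} → Up (lev x) y → Lt R y z
      below-z u = upper-below (subst (_< lev z) (sym (up-level u)) x+1<z) (proj₂ u)
      go : Low (lev x) x ⊎ (∃ λ i → Up i x × lev x ≡ suc i) → ∃ λ y → Lt R x y × lev y ≡ suc (lev x) × Lt R y z
      go (inj₁ l) = let y , u , r = rows x l in
        y , (r , distinct (up-level u)) , up-level u , below-z u
      go (inj₂ (_ , u′ , _)) = y , upper-below (ℕP.≤-reflexive (sym (up-level u))) (proj₂ u′) , up-level u , below-z u
    via-col : ColsMeet (suc (lev x)) → ∃ λ y → Lt R x y × lev y ≡ suc (lev x) × Lt R y z
    via-col ((y , l) , cols) = go (low-or-up z)
      where
      above-x : ∀ {y} → Low (suc (lev x)) y → Lt R x y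
      above-x l = below-lower (ℕP.≤-reflexive (sym (low-level l))) (proj₂ l)
      go : Low (lev z) z ⊎ (∃ λ i → Up i z × lev z ≡ suc i) → ∃ λ y → Lt R x y × lev y ≡ suc (lev x) × Lt R y z
      go (inj₁ l′) = y , above-x l , low-level l , below-lower (subst (_< lev z) (sym (low-level l)) x+1<z) (proj₂ l′)
      go (inj₂ (i , u , eq)) with i ℕ.≟ suc (lev x)
      ... | yes refl = let y , l , r = cols z u in
              y , above-x l , low-level l , (r , distinct (trans eq (cong suc (sym (low-level l)))))
      ... | no i≢ = y , above-x l , low-level l , far-below (subst₂ _<_ (cong suc (sym (low-level l))) (sym eq) (s≤s (ℕP.≤∧≢⇒< (ℕP.≤-pred (subst (suc (lev x) <_) eq x+1<z)) (i≢ ∘ sym))))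

  weaklyGraded : WeaklyGraded R
  weaklyGraded = lev , covers , component
    where
    covers : ∀ x y → Covers R x y → lev y ≡ suc (lev x)
    covers x y (l , nothing-between) with ℕP.m≤n⇒m<n∨m≡n (below-level l)
    ... | inj₂ eq = sym eq
    ... | inj₁ gap = let c , x<c , _ , c<y = between x y gap in ⊥-elim (nothing-between c (x<c , c<y))
    x₀ = proj₁ bottom
    z₀ = proj₁ top
    x₀<z₀ : Lt R x₀ z₀
    x₀<z₀ = far-below (subst₂ _<_ (cong suc (sym (proj₂ bottom))) (sym (proj₂ top)) (s≤s (s≤s z≤n)))
    component : ∀ x → ∃ λ y → SameComponent R x y × lev y ≡ 0
    component x with lev x in eq
    ... | zero = x , ε , eq
    ... | suc (suc _) = x₀ , inj₂ (proj₁ (far-below (subst₂ _<_ (cong suc (sym (proj₂ bottom))) (sym eq) (s≤s (s≤s z≤n))))) ◅ ε , proj₂ bottom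
    -- Level 1 is the delicate one: a lower x is above x₀, while an upper x may miss x₀ but is
    -- joined to it through z₀.
    ... | suc zero with low-or-up x
    ...   | inj₁ (_ , s) = x₀ , inj₂ (proj₁ (below-lower (subst₂ _<_ (sym (proj₂ bottom)) (sym eq) (s≤s z≤n)) s)) ◅ ε , proj₂ bottom
    ...   | inj₂ (_ , (_ , s) , _) = x₀ , inj₁ (proj₁ (upper-below (subst₂ _<_ (sym eq) (sym (proj₂ top)) (s≤s (s≤s z≤n))) s)) ◅ inj₂ (proj₁ x₀<z₀) ◅ ε , proj₂ bottom

  chain-below : ∀ d x z → Lt R x z → lev z ≡ suc d ℕ.+ lev x → Σ (List (Fin n)) λ xs → IsChain R (x ∷ xs) × length xs ≡ suc d
  chain-below zero    x z x<z eq = z ∷ [] , x<z ∷ [ z ] , refl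
  chain-below (suc d) x z x<z eq =
    let y , x<y , ey , y<z = between x z (ℕP.≤-trans (s≤s (s≤s (ℕP.m≤n+m (lev x) d))) (ℕP.≤-reflexive (sym eq)))
        xs , c , len = chain-below d y z y<z (trans eq (trans (cong suc (sym (ℕP.+-suc d (lev x)))) (cong (suc d ℕ.+_) (sym ey))))
    in y ∷ xs , x<y ∷ c , cong suc len

  counted : Counted n (3 ℕ.+ j) R
  counted = isPoset , weaklyGraded , avoids , chain , chain-bound level-bound
    where
    chain : HasChainOfSize R (3 ℕ.+ j)
    chain = let x , ex = bottom
                z , ez = top
                xs , c , len = chain-below (suc j) x z
                  (far-below (subst₂ _<_ (cong suc (sym ex)) (sym ez) (s≤s (s≤s z≤n))))
                  (trans ez (trans (sym (ℕP.+-identityʳ height-1)) (cong (height-1 ℕ.+_) (sym ex))))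
            in x ∷ xs , c , cong suc len

compose : ∀ k {n} b R → Compatible k {n} b R → Counted n k R
compose 0 b R c = compose₀ b R c
compose 1 b R c = compose₁ b R c
compose 2 b R c = compose₂ b R c
compose (suc (suc (suc j))) b R c = Compose₃.counted b R c

-- Every counted poset has a unique block structure

import Relation.Binary.Construct.Closure.ReflexiveTransitive as StarOps
import Data.Nat.Solver

module PosetFacts {n} (R : Relation n) (P : IsPoset R) where
  open IsPoset P

  le? : ∀ x y → Dec (Le R x y)
  le? x y = T? (entry R x y)

  lt? : ∀ x y → Dec (Lt R x y)
  lt? x y = le? x y ×-dec ¬? (x Fin.≟ y)

  lt-trans : ∀ {x y z} → Lt R x y → Lt R y z → Lt R x z
  lt-trans {x} {y} {z} (p , x≢y) (q , _) = transitive x y z p q , λ { refl → x≢y (antisymmetric x y p q) }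

  lt-extend : ∀ {x y z} → Lt R x y → y ≡ z ⊎ Lt R y z → Lt R x z
  lt-extend l (inj₁ refl) = l
  lt-extend l (inj₂ m)    = lt-trans l m

  le-cases : ∀ {x y} → Le R x y → x ≡ y ⊎ Lt R x y
  le-cases {x} {y} r with x Fin.≟ y
  ... | yes e   = inj₁ e
  ... | no x≢y = inj₂ (r , x≢y)

  isPartialOrder : IsPartialOrder _≡_ (Le R)
  isPartialOrder = record
    { isPreorder = record
      { isEquivalence = ≡.isEquivalence
      ; reflexive = λ { {x} refl → reflexive x }
      ; trans = λ {x} {y} {z} → transitive x y z }
    ; antisym = λ {x} {y} → antisymmetric x y }

  atom : ∀ a b → Lt R a b → ∃ λ c → Covers R a c × (c ≡ b ⊎ Lt R c b)
  atom a b = go (po-wellFounded isPartialOrder b)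
    where
    go : ∀ {b} → Acc (Lt R) b → Lt R a b → ∃ λ c → Covers R a c × (c ≡ b ⊎ Lt R c b)
    go {b} (acc rec) l with FinP.any? (λ d → lt? a d ×-dec lt? d b)
    ... | no none = b , (l , λ c (p , q) → none (c , p , q)) , inj₁ refl
    ... | yes (d , a<d , d<b) with go (rec d<b) a<d
    ...   | c , cov , inj₁ refl = c , cov , inj₂ d<b
    ...   | c , cov , inj₂ c<d  = c , cov , inj₂ (lt-trans c<d d<b)

  ascend : ∀ {ℓ} (Q : Fin n → Set ℓ) → (∀ a → (∀ c → Lt R a c → Q c) → Q a) → ∀ a → Q a
  ascend Q step a = go (po-noetherian isPartialOrder a)
    where
    go : ∀ {a} → Acc (λ x y → Lt R y x) a → Q a
    go (acc rec) = step _ λ c a<c → go (rec a<c)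

  CoverRank : (Fin n → ℕ) → Set
  CoverRank rk = ∀ a b → Covers R a b → rk b ≡ suc (rk a)

  private
    -- The equality of rk - rk′ at a and at b, written without subtraction; along a cover both ranks
    -- grow by 1.
    offset : ∀ {rk rk′} → CoverRank rk → CoverRank rk′ → ∀ a b → Lt R a b → rk a ℕ.+ rk′ b ≡ rk′ a ℕ.+ rk b
    offset {rk} {rk′} cov cov′ a b = ascend (λ a → Lt R a b → rk a ℕ.+ rk′ b ≡ rk′ a ℕ.+ rk b) go a
      where
      go : ∀ a → (∀ c → Lt R a c → Lt R c b → rk c ℕ.+ rk′ b ≡ rk′ c ℕ.+ rk b) → Lt R a b → rk a ℕ.+ rk′ b ≡ rk′ a ℕ.+ rk b
      go a ih l with atom a b l
      ... | c , a⋖c , inj₁ refl = trans (cong (rk a ℕ.+_) (cov′ a c a⋖c)) (trans (ℕP.+-suc (rk a) (rk′ a))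
            (trans (cong suc (ℕP.+-comm (rk a) (rk′ a))) (trans (sym (ℕP.+-suc (rk′ a) (rk a))) (cong (rk′ a ℕ.+_) (sym (cov a c a⋖c))))))
      ... | c , a⋖c , inj₂ c<b = ℕP.suc-injective (trans (cong (ℕ._+ rk′ b) (sym (cov a c a⋖c)))
            (trans (ih c (proj₁ a⋖c) c<b) (cong (ℕ._+ rk b) (cov′ a c a⋖c))))

    chained : ∀ p q r p′ q′ r′ → p ℕ.+ q′ ≡ p′ ℕ.+ q → q ℕ.+ r′ ≡ q′ ℕ.+ r → p ℕ.+ r′ ≡ p′ ℕ.+ r
    chained p q r p′ q′ r′ e f = ℕP.+-cancelʳ-≡ (q ℕ.+ q′) _ _
      (trans (solve 4 (λ p r′ q q′ → (p :+ r′) :+ (q :+ q′) := (p :+ q′) :+ (q :+ r′)) refl p r′ q q′)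
        (trans (cong₂ ℕ._+_ e f)
          (solve 4 (λ p′ q q′ r → (p′ :+ q) :+ (q′ :+ r) := (p′ :+ r) :+ (q :+ q′)) refl p′ q q′ r)))
      where open Data.Nat.Solver.+-*-Solver

  -- The difference of two rank functions is constant on every component, and it is 0 because
  -- both attain the value 0 there.
  rank-unique : (g g′ : WeaklyGraded R) → ∀ x → proj₁ g x ≡ proj₁ g′ x
  rank-unique (rk , cov , zer) (rk′ , cov′ , zer′) x =
    let y , x~y , y0 = zer x
        z , x~z , z0 = zer′ x
        yz : rk y ℕ.+ rk′ z ≡ rk′ y ℕ.+ rk z
        yz = along (StarOps.reverse flip x~y ◅◅ x~z)
        y0′ : rk′ y ≡ 0
        y0′ = ℕP.m+n≡0⇒m≡0 (rk′ y) (trans (sym yz) (cong₂ ℕ._+_ y0 z0))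
    in ℕP.+-cancelʳ-≡ 0 _ _ (trans (cong (rk x ℕ.+_) (sym y0′)) (trans (along x~y) (cong (rk′ x ℕ.+_) y0)))
    where
    flip : ∀ {x y} → Comparable R x y → Comparable R y x
    flip (inj₁ r) = inj₂ r
    flip (inj₂ r) = inj₁ r
    one-step : ∀ {x y} → Comparable R x y → rk x ℕ.+ rk′ y ≡ rk′ x ℕ.+ rk y
    one-step (inj₁ r) with le-cases r
    ... | inj₁ refl = ℕP.+-comm (rk _) _
    ... | inj₂ l    = offset cov cov′ _ _ l
    one-step {x} {y} (inj₂ r) with le-cases r
    ... | inj₁ refl = ℕP.+-comm (rk _) _
    ... | inj₂ l    = trans (ℕP.+-comm (rk x) (rk′ y)) (trans (sym (offset cov cov′ _ _ l)) (ℕP.+-comm (rk y) (rk′ x)))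
    along : ∀ {x y} → SameComponent R x y → rk x ℕ.+ rk′ y ≡ rk′ x ℕ.+ rk y
    along {x} ε = ℕP.+-comm (rk x) (rk′ x)
    along {x} {z} (_◅_ {j = y} s ss) = chained (rk x) (rk y) (rk z) (rk′ x) (rk′ y) (rk′ z) (one-step s) (along ss)

module GradedFacts {n} (R : Relation n) (P : IsPoset R) (rk : Fin n → ℕ)
  (cover : ∀ a b → Covers R a b → rk b ≡ suc (rk a)) (avoid : Avoids3+1 R) where
  open PosetFacts R P public

  step-up : ∀ {a b} → Lt R a b → ∃ λ c → Lt R a c × rk c ≡ suc (rk a) × (c ≡ b ⊎ Lt R c b)
  step-up {a} {b} l = let c , a⋖c , h = atom a b l in c , proj₁ a⋖c , cover a c a⋖c , h

  mono : ∀ {a b} → Lt R a b → rk a < rk b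
  mono {a} {b} = ascend (λ a → Lt R a b → rk a < rk b) go a
    where
    go : ∀ a → (∀ c → Lt R a c → Lt R c b → rk c < rk b) → Lt R a b → rk a < rk b
    go a ih l with step-up l
    ... | c , a<c , e , inj₁ refl = ℕP.≤-reflexive (sym e)
    ... | c , a<c , e , inj₂ c<b  = ℕP.<-trans (ℕP.≤-reflexive (sym e)) (ih c a<c c<b)

  le-rank : ∀ {a b} → Le R a b → rk a ≤ rk b
  le-rank r with le-cases r
  ... | inj₁ refl = ℕP.≤-refl
  ... | inj₂ l    = ℕP.<⇒≤ (mono l)

  between : ∀ {a b} → Lt R a b → suc (rk a) < rk b → ∃ λ c → Lt R a c × rk c ≡ suc (rk a) × Lt R c b
  between l gap with step-up l
  ... | c , a<c , e , inj₁ refl = ⊥-elim (ℕP.<-irrefl (sym e) gap)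
  ... | c , a<c , e , inj₂ c<b  = c , a<c , e , c<b

  comparable? : ∀ x y → Dec (Comparable R x y)
  comparable? x y = le? x y ⊎-dec le? y x

  -- By avoidance w is comparable to a member of the chain, and its rank only allows it to be above
  -- that member or equal to z.
  above-chain : ∀ {x y z w} → Lt R x y → Lt R y z → rk z ≤ rk w → Lt R x w
  above-chain {x} {y} {z} {w} x<y y<z z≤w with comparable? w x | comparable? w y | comparable? w z
  ... | yes (inj₁ r) | _ | _ = ⊥-elim (ℕP.<-irrefl refl (ℕP.≤-<-trans (le-rank r) (ℕP.<-≤-trans (mono (lt-trans x<y y<z)) z≤w)))
  ... | yes (inj₂ r) | _ | _ = r , λ { refl → ℕP.<-irrefl refl (ℕP.<-≤-trans (mono (lt-trans x<y y<z)) z≤w) }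
  ... | no _ | yes (inj₁ r) | _ = ⊥-elim (ℕP.<-irrefl refl (ℕP.≤-<-trans (le-rank r) (ℕP.<-≤-trans (mono y<z) z≤w)))
  ... | no _ | yes (inj₂ r) | _ = lt-extend x<y (le-cases r)
  ... | no _ | no _ | yes (inj₂ r) = lt-extend (lt-trans x<y y<z) (le-cases r)
  ... | no _ | no _ | yes (inj₁ r) with le-cases r
  ...   | inj₁ refl = lt-trans x<y y<z
  ...   | inj₂ l    = ⊥-elim (ℕP.<-irrefl refl (ℕP.<-≤-trans (mono l) z≤w))
  above-chain {x} {y} {z} {w} x<y y<z z≤w | no a | no b | no c = ⊥-elim (avoid x y z w x<y y<z (a , b , c))

  lt-prepend : ∀ {x y z} → x ≡ y ⊎ Lt R x y → Lt R y z → Lt R x z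
  lt-prepend (inj₁ refl) l = l
  lt-prepend (inj₂ m)    l = lt-trans m l

  below-chain : ∀ {x y z w} → Lt R x y → Lt R y z → rk w ≤ rk x → Lt R w z
  below-chain {x} {y} {z} {w} x<y y<z w≤x with comparable? w x | comparable? w y | comparable? w z
  ... | _ | _ | yes (inj₂ r) = ⊥-elim (ℕP.<-irrefl refl (ℕP.≤-<-trans (ℕP.≤-trans (le-rank r) w≤x) (mono (lt-trans x<y y<z))))
  ... | _ | _ | yes (inj₁ r) = r , λ { refl → ℕP.<-irrefl refl (ℕP.≤-<-trans w≤x (mono (lt-trans x<y y<z))) }
  ... | _ | yes (inj₂ r) | no _ = ⊥-elim (ℕP.<-irrefl refl (ℕP.≤-<-trans (ℕP.≤-trans (le-rank r) w≤x) (mono x<y)))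
  ... | _ | yes (inj₁ r) | no _ = lt-prepend (le-cases r) y<z
  ... | yes (inj₁ r) | no _ | no _ = lt-prepend (le-cases r) (lt-trans x<y y<z)
  ... | yes (inj₂ r) | no _ | no _ with le-cases r
  ...   | inj₁ refl = lt-trans x<y y<z
  ...   | inj₂ l    = ⊥-elim (ℕP.<-irrefl refl (ℕP.<-≤-trans (mono l) w≤x))
  below-chain {x} {y} {z} {w} x<y y<z w≤x | no a | no b | no c = ⊥-elim (avoid x y z w x<y y<z (a , b , c))

  ChainAt : ℕ → Set
  ChainAt a = Σ (Fin n) λ x → Σ (Fin n) λ y → Σ (Fin n) λ z →
    (Lt R x y × Lt R y z) × rk x ≡ a × rk y ≡ suc a × rk z ≡ suc (suc a)

  chainAt-first : ∀ {x y z} → Lt R x y → Lt R y z → ChainAt (rk x)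
  chainAt-first {x} x<y y<z =
    let u , x<u , eu , h = step-up x<y
        v , u<v , ev , _ = step-up (lt-prepend h y<z)
    in x , u , v , (x<u , u<v) , refl , eu , trans ev (cong suc eu)

  -- `below-chain` exchanges the bottom of the chain for p; `above-chain`, applied to a chain from p
  -- to the old top, then reaches q.
  chainAt-below : ∀ {a} → ChainAt a → ∀ p q → rk p ≡ a → suc a < rk q → Lt R p q
  chainAt-below {a} (x , y , z , (x<y , y<z) , ex , _ , ez) p q ep gap =
    let p<z = below-chain x<y y<z (ℕP.≤-reflexive (trans ep (sym ex)))
        y′ , p<y′ , _ , y′<z = between p<z (ℕP.≤-reflexive (trans (cong (λ r → suc (suc r)) ep) (sym ez)))
    in above-chain p<y′ y′<z (ℕP.≤-trans (ℕP.≤-reflexive ez) gap)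

  chainAt-between : ∀ {x z} → Lt R x z → suc (suc (rk x)) < rk z → ChainAt (rk x) × ChainAt (suc (rk x))
  chainAt-between {x} {z} x<z gap =
    let u , x<u , eu , u<z = between x<z (ℕP.<-trans (ℕP.n<1+n _) gap)
        v , u<v , ev , v<z = between u<z (subst (λ r → suc r < rk z) (sym eu) gap)
        ev′ = trans ev (cong suc eu)
        w , v<w , ew , _ = step-up v<z
    in (x , u , v , (x<u , u<v) , refl , eu , ev′) , u , v , w , (u<v , v<w) , eu , ev′ , trans ew (cong suc ev′)

  module Connected (p₀ : Fin n) (p₀-rank : rk p₀ ≡ 0) {x₀ y₀ z₀} (x₀<y₀ : Lt R x₀ y₀) (y₀<z₀ : Lt R y₀ z₀) where

    -- If the given chain starts at positive rank, `below-chain` still puts its top above p₀, and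
    -- climbing by covers from p₀ towards that top produces a chain at rank 0.
    chainAt-0 : ChainAt 0
    chainAt-0 with chainAt-first x₀<y₀ y₀<z₀
    ... | x , y , z , (x<y , y<z) , ex , ey , ez with rk x₀
    ...   | zero  = x , y , z , (x<y , y<z) , ex , ey , ez
    ...   | suc a = subst ChainAt p₀-rank (proj₁ (chainAt-between (below-chain x<y y<z (subst (_≤ rk x) (sym p₀-rank) z≤n))
                      (subst₂ _<_ (cong (λ r → suc (suc r)) (sym p₀-rank)) (sym ez) (s≤s (s≤s (s≤s z≤n))))))

    -- Chains propagate upwards: the bottom of a chain at rank a is below q by `chainAt-below`, and
    -- if q is at least three ranks higher, climbing towards q passes through a chain at rank a + 1.
    chainAt : ∀ a q → suc a < rk q → ChainAt a
    chainAt zero    q _   = chainAt-0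
    chainAt (suc a) q gap with chainAt a q (ℕP.<-trans (ℕP.n<1+n _) gap)
    ... | c@(x , y , z , (x<y , y<z) , refl , _) = proj₂ (chainAt-between (chainAt-below c x q refl (ℕP.<-trans (ℕP.n<1+n _) gap)) gap)

    far : ∀ {p q} → suc (rk p) < rk q → Lt R p q
    far {p} {q} gap = chainAt-below (chainAt (rk p) q gap) p q refl gap

    chain-between : ∀ d p q → Lt R p q → rk q ≡ suc d ℕ.+ rk p → Σ (List (Fin n)) λ xs → IsChain R (p ∷ xs) × length xs ≡ suc d
    chain-between zero    p q l eq = q ∷ [] , l ∷ [ q ] , refl
    chain-between (suc d) p q l eq =
      let y , p<y , ey , y<q = between l (ℕP.≤-trans (s≤s (s≤s (ℕP.m≤n+m (rk p) d))) (ℕP.≤-reflexive (sym eq)))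
          xs , c , len = chain-between d y q y<q (trans eq (trans (cong suc (sym (ℕP.+-suc d (rk p)))) (cong (suc d ℕ.+_) (sym ey))))
      in y ∷ xs , p<y ∷ c , cong suc len

    rank-bound : ∀ {h} → (∀ j → HasChainOfSize R j → j ≤ suc (suc h)) → ∀ q → rk q ≤ suc h
    rank-bound bound q with rk q in eq
    ... | zero        = z≤n
    ... | suc zero    = s≤s z≤n
    ... | suc (suc d) =
      let xs , c , len = chain-between (suc d) p₀ q (far (subst₂ _<_ (cong suc (sym p₀-rank)) (sym eq) (s≤s (s≤s z≤n))))
                           (trans eq (trans (sym (ℕP.+-identityʳ _)) (cong (suc (suc d) ℕ.+_) (sym p₀-rank))))
      in ℕP.≤-pred (bound _ (p₀ ∷ xs , c , cong suc len))

    inhabited : ∀ z i → i ≤ rk z → 2 ≤ rk z → ∃ λ p → rk p ≡ i × (p ≡ z ⊎ Lt R p z)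
    inhabited z zero    _   2≤z = p₀ , p₀-rank , inj₂ (far (subst (λ r → suc r < rk z) (sym p₀-rank) 2≤z))
    inhabited z (suc i) i<z 2≤z with inhabited z i (ℕP.<⇒≤ i<z) 2≤z
    ... | p , e , inj₁ refl = ⊥-elim (ℕP.<-irrefl (sym e) i<z)
    ... | p , e , inj₂ p<z  = let c , _ , ec , h = step-up p<z in c , trans ec (cong suc e) , h

    -- Otherwise x would be incomparable to a chain from an element that it misses in the level
    -- below to an element that it misses in the level above.
    up-or-down : ∀ {w x y} → suc (rk w) ≡ rk x → rk y ≡ suc (rk x) → ¬ Le R w x → Le R x y
    up-or-down {w} {x} {y} ew ey ¬wx with le? x y
    ... | yes r = r
    ... | no ¬xy = let c , w<c , ec , c<y = between (far gap) gap in
      ⊥-elim (avoid w c y x w<c c<y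
        ( either (λ r → ℕP.<-irrefl refl (ℕP.≤-trans (ℕP.≤-reflexive ew) (le-rank r))) ¬wx
        , incomparable (trans ec ew) w<c
        , either ¬xy λ r → ℕP.<-irrefl refl (ℕP.≤-trans (ℕP.≤-reflexive (sym ey)) (le-rank r))))
      where
      gap : suc (rk w) < rk y
      gap = ℕP.≤-reflexive (trans (cong suc ew) (sym ey))
      incomparable : ∀ {c} → rk c ≡ rk x → Lt R w c → ¬ Comparable R x c
      incomparable e w<c (inj₁ r) with le-cases r
      ... | inj₁ refl = ¬wx (proj₁ w<c)
      ... | inj₂ l    = ℕP.<-irrefl (sym e) (mono l)
      incomparable e w<c (inj₂ r) with le-cases r
      ... | inj₁ refl = ¬wx (proj₁ w<c)
      ... | inj₂ l    = ℕP.<-irrefl e (mono l)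

vec-ext : ∀ {A : Set} {n} {u v : Vec A n} → (∀ x → lookup u x ≡ lookup v x) → u ≡ v
vec-ext {u = u} {v} eq = trans (sym (VecP.tabulate∘lookup u)) (trans (VecP.tabulate-cong eq) (VecP.tabulate∘lookup v))

decompose₀ : ∀ {n} R → Counted n 0 R → Σ (Vec (Base 1) n) λ b → Compatible 0 b R × (∀ b′ → Compatible 0 b′ R → b′ ≡ b)
decompose₀ {n} R (_ , _ , _ , _ , bound) = tabulate (λ x → absurd x) , ((λ x → absurd x) , (λ x → absurd x) , λ x → absurd x) ,
  λ b′ _ → vec-ext λ x → absurd x
  where
  absurd : ∀ {A : Set} → Fin n → A
  absurd x = ⊥-elim (ℕP.1+n≰n (bound 1 (x ∷ [] , [ x ] , refl)))

module ByLookup {k n} (β : Fin n → Base k) (R : Relation n) where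
  b : Vec (Base k) n
  b = tabulate β

  open PatternIndicator b R

  base-β : ∀ x → base x ≡ β x
  base-β x = VecP.lookup∘tabulate β x

  OrderedBy : Fin n → Fin n → Set
  OrderedBy x y = x ≢ y → free (β x) (β y) ≡ false →
    (Below x y → level (β x) < level (β y)) × (level (β x) < level (β y) → Below x y)

  ordered-by : (∀ x → Le R x x) → (∀ x y → OrderedBy x y) → ∀ x y → Ordered x y
  ordered-by rfl h x y = (λ { refl → rfl x }) ,
    subst₂ (λ c d → x ≢ y → free c d ≡ false → (Below x y → level c < level d) × (level c < level d → Below x y))
      (sym (base-β x)) (sym (base-β y)) (h x y)

decompose₁ : ∀ {n} R → Counted n 1 R → Σ (Vec (Base 1) n) λ b → Compatible 1 b R × (∀ b′ → Compatible 1 b′ R → b′ ≡ b)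
decompose₁ {n} R (poset , _ , _ , (x₀ ∷ _ , _ , _) , bound) = b ,
  (ordered-by (IsPoset.reflexive poset)
    (λ x y x≢y _ → (λ r → ⊥-elim (ℕP.<-irrefl refl (bound 2 (x ∷ y ∷ [] , (r , x≢y) ∷ [ y ] , refl)))) , λ ()) ,
   (x₀ , cong (toℕ ∘ proj₁) (base-β x₀) , cong proj₂ (base-β x₀)) , λ x (_ , s) → lower≢upper (trans (sym (cong proj₂ (base-β x))) s)) ,
  λ b′ (_ , _ , nu) → vec-ext λ x → trans (either (λ e → e) (λ e → ⊥-elim (nu x (cong (toℕ ∘ proj₁) e , cong proj₂ e))) (one-block-base (lookup b′ x))) (sym (base-β x))
  where
  open ByLookup {1} (λ _ → zero , lower) R

decompose₂ : ∀ {n} R → Counted n 2 R → Σ (Vec (Base 1) n) λ b → Compatible 2 b R × (∀ b′ → Compatible 2 b′ R → b′ ≡ b)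
decompose₂ {n} R (poset , _ , _ , (x₀ ∷ y₀ ∷ [] , x₀<y₀ ∷ _ , _) , bound) = b ,
  (ordered-by (IsPoset.reflexive poset) ordered , (y₀ , up y₀ (x₀ , x₀<y₀)) , cols) , unique
  where
  open PosetFacts R poset
  -- The positive answer belongs to the non-minimal elements, which form the upper part; isolated
  -- elements go to the lower part.
  minimal? : ∀ x → Dec (∃ λ y → Lt R y x)
  minimal? x = FinP.any? λ y → lt? y x
  β : Fin n → Base 1
  β x with minimal? x
  ... | yes _ = zero , upper
  ... | no _  = zero , lower
  β-up : ∀ x → (∃ λ y → Lt R y x) → β x ≡ (zero , upper)
  β-up x e with minimal? x
  ... | yes _ = refl
  ... | no ¬e = ⊥-elim (¬e e)
  β-low : ∀ x → ¬ (∃ λ y → Lt R y x) → β x ≡ (zero , lower)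
  β-low x ¬e with minimal? x
  ... | yes e = ⊥-elim (¬e e)
  ... | no _  = refl
  open ByLookup β R
  open PatternIndicator b R using (Low; Up; Cols)
  up : ∀ x → (∃ λ y → Lt R y x) → Up 0 x
  up x e = cong (toℕ ∘ proj₁) (trans (base-β x) (β-up x e)) , cong proj₂ (trans (base-β x) (β-up x e))
  low : ∀ x → ¬ (∃ λ y → Lt R y x) → Low 0 x
  low x ¬e = cong (toℕ ∘ proj₁) (trans (base-β x) (β-low x ¬e)) , cong proj₂ (trans (base-β x) (β-low x ¬e))
  no-3-chain : ∀ {x y z} → Lt R x y → Lt R y z → ⊥
  no-3-chain {x} {y} {z} l m = ℕP.<-irrefl refl (bound 3 (x ∷ y ∷ z ∷ [] , l ∷ m ∷ [ z ] , refl))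
  ordered : ∀ x y → OrderedBy x y
  ordered x y x≢y f with minimal? x | minimal? y
  ... | yes (w , w<x) | yes _ = (λ r → ⊥-elim (no-3-chain w<x (r , x≢y))) , λ { (s≤s ()) }
  ... | yes _ | no ¬e = (λ r → ⊥-elim (¬e (x , r , x≢y))) , λ ()
  ... | no _  | no ¬e = (λ r → ⊥-elim (¬e (x , r , x≢y))) , λ ()
  ordered x y x≢y () | no _ | yes _
  upper-has-below : ∀ y → Up 0 y → ∃ λ x → Lt R x y
  upper-has-below y (_ , s) with minimal? y in eq
  ... | yes e = e
  ... | no ¬e = ⊥-elim (lower≢upper (trans (sym (cong proj₂ (trans (base-β y) (β-low y ¬e)))) s))
  cols : Cols 0
  cols y u with upper-has-below y u
  ... | x , l = x , low x (λ (w , w<x) → no-3-chain w<x l) , proj₁ l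
  unique : ∀ b′ → Compatible 2 b′ R → b′ ≡ b
  unique b′ (ordered′ , _ , cols′) = vec-ext λ x → trans (same-base x (one-block-base (lookup b′ x))) (sym (base-β x))
    where
    module L = Layered b′ R ordered′
    same-base : ∀ x → lookup b′ x ≡ (zero , lower) ⊎ lookup b′ x ≡ (zero , upper) → lookup b′ x ≡ β x
    same-base x (inj₁ e) = trans e (sym (β-low x λ (y , y<x) → ℕP.n≮0 (subst (L.lev y <_) (cong level e) (L.below-level y<x))))
    same-base x (inj₂ e) = let y , (_ , s) , r = cols′ x (cong (toℕ ∘ proj₁) e , cong proj₂ e) in
      trans e (sym (β-up x (y , r , λ y≡x → lower≢upper (trans (sym s) (trans (cong (proj₂ ∘ lookup b′) y≡x) (cong proj₂ e))))))

module Decompose₃ {j n} (R : Relation n) (counted : Counted n (3 ℕ.+ j) R) where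
  private
    poset = proj₁ counted
    graded = proj₁ (proj₂ counted)
    avoid = proj₁ (proj₂ (proj₂ counted))
    bound = proj₂ (proj₂ (proj₂ (proj₂ counted)))
    rk = proj₁ graded

  open GradedFacts R poset rk (proj₁ (proj₂ graded)) avoid

  private
    ends : ∀ x xs → IsChain R (x ∷ xs) → ∃ λ z → rk x ℕ.+ length xs ≤ rk z
    ends x []       [ .x ]   = x , ℕP.≤-reflexive (ℕP.+-identityʳ (rk x))
    ends x (y ∷ xs) (l ∷ c) = let z , h = ends y xs c in
      z , ℕP.≤-trans (ℕP.≤-reflexive (ℕP.+-suc (rk x) (length xs))) (ℕP.≤-trans (ℕP.+-monoˡ-≤ (length xs) (mono l)) h)

    long-chain : HasChainOfSize R (3 ℕ.+ j) → Σ (Fin n × Fin n × Fin n) λ (x , y , z) → Lt R x y × Lt R y z × ∃ λ t → 2 ℕ.+ j ≤ rk t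
    long-chain (x ∷ y ∷ z ∷ xs , l ∷ m ∷ c , len) = let t , h = ends x (y ∷ z ∷ xs) (l ∷ m ∷ c) in
      (x , y , z) , l , m , t , ℕP.≤-trans (ℕP.≤-reflexive (ℕP.suc-injective (sym len))) (ℕP.m+n≤o⇒n≤o (rk x) h)

    chain₃ = long-chain (proj₁ (proj₂ (proj₂ (proj₂ counted))))
    bottom = proj₂ (proj₂ graded) (proj₁ (proj₁ chain₃))
    p₀ = proj₁ bottom
    p₀-rank : rk p₀ ≡ 0
    p₀-rank = proj₂ (proj₂ bottom)

  open Connected p₀ p₀-rank (proj₁ (proj₂ chain₃)) (proj₁ (proj₂ (proj₂ chain₃)))

  private
    rank≤ : ∀ q → rk q ≤ 2 ℕ.+ j
    rank≤ = rank-bound bound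

    t₀ : Fin n
    t₀ = proj₁ (proj₂ (proj₂ (proj₂ chain₃)))
    t₀-rank : rk t₀ ≡ 2 ℕ.+ j
    t₀-rank = ℕP.≤-antisym (rank≤ t₀) (proj₂ (proj₂ (proj₂ (proj₂ chain₃))))

    at-rank : ∀ i → i ≤ 2 ℕ.+ j → ∃ λ p → rk p ≡ i
    at-rank i i≤ = let p , e , _ = inhabited t₀ i (ℕP.≤-trans i≤ (ℕP.≤-reflexive (sym t₀-rank))) (ℕP.≤-trans (s≤s (s≤s z≤n)) (ℕP.≤-reflexive (sym t₀-rank)))
                   in p , e

    AboveAll : Fin n → Set
    AboveAll x = ∀ y → suc (rk y) ≡ rk x → Le R y x

    aboveAll? : ∀ x → Dec (AboveAll x)
    aboveAll? x = FinP.all? λ y → (suc (rk y) ℕ.≟ rk x) →-dec le? y x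

    missed : ∀ x → ¬ AboveAll x → ∃ λ y → suc (rk y) ≡ rk x × ¬ Le R y x
    missed x ¬a with FinP.any? (λ y → (suc (rk y) ℕ.≟ rk x) ×-dec ¬? (le? y x))
    ... | yes m  = m
    ... | no none = ⊥-elim (¬a λ y e → all-below y e (le? y x))
      where
      all-below : ∀ y → suc (rk y) ≡ rk x → Dec (Le R y x) → Le R y x
      all-below y e (yes r) = r
      all-below y e (no ¬r) = ⊥-elim (none (y , e , ¬r))

    belowAll : ∀ {x} → ¬ AboveAll x → ∀ y → rk y ≡ suc (rk x) → Le R x y
    belowAll {x} ¬a y e = let w , ew , ¬r = missed x ¬a in up-or-down ew e ¬r

    block : ∀ x → Dec (AboveAll x) → Base (3 ℕ.+ j)
    block x (yes _) = fromℕ< (s≤s (rank≤ x)) , lower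
    -- An element that is not above all of the rank below has positive rank, so the predecessor is a
    -- true subtraction.
    block x (no _)  = fromℕ< (s≤s (ℕP.≤-trans (ℕP.pred[n]≤n {rk x}) (rank≤ x))) , upper

    block-level : ∀ x d → level (block x d) ≡ rk x
    block-level x (yes _) = FinP.toℕ-fromℕ< _
    block-level x (no ¬a) = trans (cong suc (FinP.toℕ-fromℕ< _)) (suc-pred (missed x ¬a))
      where
      suc-pred : (∃ λ y → suc (rk y) ≡ rk x × ¬ Le R y x) → suc (ℕ.pred (rk x)) ≡ rk x
      suc-pred (y , e , _) = subst (λ r → suc (ℕ.pred r) ≡ r) e refl

    block-lower : ∀ x d → proj₂ (block x d) ≡ lower → AboveAll x
    block-lower x (yes a) _ = a

    block-upper : ∀ x d → proj₂ (block x d) ≡ upper → ¬ AboveAll x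
    block-upper x (no ¬a) _ = ¬a

    β : Fin n → Base (3 ℕ.+ j)
    β x = block x (aboveAll? x)

  open ByLookup β R public
  open PatternIndicator b R

  private
    β-level : ∀ x → level (β x) ≡ rk x
    β-level x = block-level x (aboveAll? x)

    low-above : ∀ {x} → proj₂ (β x) ≡ lower → AboveAll x
    low-above {x} = block-lower x (aboveAll? x)

    up-not-above : ∀ {x} → proj₂ (β x) ≡ upper → ¬ AboveAll x
    up-not-above {x} = block-upper x (aboveAll? x)

    side-cases : ∀ (s : Side) → s ≡ lower ⊎ s ≡ upper
    side-cases lower = inj₁ refl
    side-cases upper = inj₂ refl

    free-from : ∀ {k} (c d : Base k) → proj₂ c ≡ lower → proj₂ d ≡ upper → level d ≡ suc (level c) → free c d ≡ true
    free-from (i , lower) (i′ , upper) refl refl e with FinP.toℕ-injective {i = i′} {i} (ℕP.suc-injective e)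
    ... | refl = same-refl i

    -- Ranks two or more apart are settled by `far`. On consecutive ranks a lower y is above all of
    -- the rank below it, and an upper x is below all of the rank above it by `up-or-down`; a lower
    -- x with an upper y is the free pair.
    ordered : ∀ x y → OrderedBy x y
    ordered x y x≢y f = (λ r → subst₂ _<_ (sym (β-level x)) (sym (β-level y)) (mono (r , x≢y))) ,
      λ l → below (subst₂ _<_ (β-level x) (β-level y) l)
      where
      consecutive : suc (rk x) ≡ rk y → proj₂ (β y) ≡ lower ⊎ proj₂ (β y) ≡ upper → proj₂ (β x) ≡ lower ⊎ proj₂ (β x) ≡ upper → Le R x y
      consecutive e (inj₁ s) _        = low-above s x e
      consecutive e (inj₂ _) (inj₂ s) = belowAll (up-not-above s) y (sym e)
      consecutive e (inj₂ t) (inj₁ s) with trans (sym f) (free-from (β x) (β y) s t (trans (β-level y) (trans (sym e) (cong suc (sym (β-level x))))))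
      ... | ()
      below : rk x < rk y → Le R x y
      below l with ℕP.m≤n⇒m<n∨m≡n l
      ... | inj₁ gap = proj₁ (far gap)
      ... | inj₂ e   = consecutive e (side-cases (proj₂ (β y))) (side-cases (proj₂ (β x)))

    β-cong : ∀ {x c} → base x ≡ c → β x ≡ c
    β-cong {x} e = trans (sym (base-β x)) e

    low-rank : ∀ {i x} → Low i x → rk x ≡ i
    low-rank {x = x} (p , s) = trans (sym (β-level x)) (trans (cong level (β-cong {x} (cong (proj₁ (base x) ,_) s))) p)

    up-rank : ∀ {i x} → Up i x → rk x ≡ suc i
    up-rank {x = x} (p , s) = trans (sym (β-level x)) (trans (cong level (β-cong {x} (cong (proj₁ (base x) ,_) s))) (cong suc p))

    low-or-up : ∀ x → (AboveAll x × Low (rk x) x) ⊎ (¬ AboveAll x × ∃ λ i → Up i x × rk x ≡ suc i)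
    low-or-up x = go (side-cases (proj₂ (β x)))
      where
      go : proj₂ (β x) ≡ lower ⊎ proj₂ (β x) ≡ upper → (AboveAll x × Low (rk x) x) ⊎ (¬ AboveAll x × ∃ λ i → Up i x × rk x ≡ suc i)
      go (inj₁ s) = inj₁ (low-above s , trans (cong (toℕ ∘ proj₁) (base-β x)) (trans (sym (cong level {β x} {proj₁ (β x) , lower} (cong (proj₁ (β x) ,_) s))) (β-level x)) , trans (cong proj₂ (base-β x)) s)
      go (inj₂ s) = inj₂ (up-not-above s , toℕ (proj₁ (β x)) , (cong (toℕ ∘ proj₁) (base-β x) , trans (cong proj₂ (base-β x)) s) ,
        trans (sym (β-level x)) (cong level {β x} {proj₁ (β x) , upper} (cong (proj₁ (β x) ,_) s)))

    is-low : ∀ {i x} → rk x ≡ i → AboveAll x → Low i x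
    is-low {x = x} refl a with low-or-up x
    ... | inj₁ (_ , l)  = l
    ... | inj₂ (¬a , _) = ⊥-elim (¬a a)

    is-up : ∀ {i x} → rk x ≡ suc i → ¬ AboveAll x → Up i x
    is-up {i} {x} e ¬a with low-or-up x
    ... | inj₁ (a , _) = ⊥-elim (¬a a)
    ... | inj₂ (_ , l , u , e′) = subst (λ l → Up l x) (ℕP.suc-injective (trans (sym e′) e)) u

    up⇒¬above : ∀ {i x} → Up i x → ¬ AboveAll x
    up⇒¬above {x = x} (_ , s) = up-not-above (trans (sym (cong proj₂ (base-β x))) s)

    -- The element missed by an upper y must be lower, since an upper one would be below all of the
    -- next rank, y included.
    noFull-at : ∀ i → NoFull i
    noFull-at i y u with missed y (up⇒¬above u)
    ... | x , e , ¬r = x , is-low (ℕP.suc-injective (trans e (up-rank u))) above , ¬r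
      where
      above : AboveAll x
      above with aboveAll? x
      ... | yes a = a
      ... | no ¬a = ⊥-elim (¬r (belowAll ¬a y (sym e)))

    -- If both failed, an element of level i with no neighbour in U_{i+1} and an element of level
    -- i + 2 with no neighbour in D_{i+1} would have nothing between them.
    meets : ∀ i → 2 ℕ.+ i ≤ 2 ℕ.+ j → RowsMeet i ⊎ ColsMeet (suc i)
    meets i i≤ = one-of rows-meet? cols-meet? λ ¬rows ¬cols →
      let x , ex , no-up  = lonely-below ¬rows
          z , ez , no-low = lonely-above ¬cols
          c , x<c , ec , c<z = between (far (gap ex ez)) (gap ex ez)
      in either (λ (a , _) → no-low c (is-low (trans ec (cong suc ex)) a) (proj₁ c<z))
                (λ (¬a , _) → no-up c (is-up (trans ec (cong suc ex)) ¬a) (proj₁ x<c)) (low-or-up c)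
      where
      gap : ∀ {x z} → rk x ≡ i → rk z ≡ 2 ℕ.+ i → suc (rk x) < rk z
      gap ex ez = ℕP.≤-reflexive (trans (cong (λ r → suc (suc r)) ex) (sym ez))
      row? : ∀ x → Dec (Low i x → ∃ λ y → Up i y × Below x y)
      row? x = low? i x →-dec FinP.any? λ y → up? i y ×-dec le? x y
      col? : ∀ y → Dec (Up (suc i) y → ∃ λ x → Low (suc i) x × Below x y)
      col? y = up? (suc i) y →-dec FinP.any? λ x → low? (suc i) x ×-dec le? x y
      rows-meet? : Dec (RowsMeet i)
      rows-meet? = FinP.any? (up? i) ×-dec FinP.all? row?
      cols-meet? : Dec (ColsMeet (suc i))
      cols-meet? = FinP.any? (low? (suc i)) ×-dec FinP.all? col?
      lonely-below : ¬ RowsMeet i → ∃ λ x → rk x ≡ i × (∀ y → Up i y → ¬ Below x y)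
      lonely-below ¬rows with some-or-none (up? i)
      ... | inj₂ nu = let x , ex = at-rank i (ℕP.≤-trans (ℕP.m≤n+m i 2) i≤) in x , ex , λ y u → ⊥-elim (nu y u)
      ... | inj₁ u with FinP.¬∀⟶∃¬ n _ row? (λ rows → ¬rows (u , rows))
      ...   | x , ¬row with low? i x
      ...     | yes l = x , low-rank l , λ y u r → ¬row λ _ → y , u , r
      ...     | no ¬l = ⊥-elim (¬row λ l → ⊥-elim (¬l l))
      lonely-above : ¬ ColsMeet (suc i) → ∃ λ z → rk z ≡ 2 ℕ.+ i × (∀ y → Low (suc i) y → ¬ Below y z)
      lonely-above ¬cols with some-or-none (low? (suc i))
      ... | inj₂ nl = let z , ez = at-rank (2 ℕ.+ i) i≤ in z , ez , λ y l → ⊥-elim (nl y l)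
      ... | inj₁ l with FinP.¬∀⟶∃¬ n _ col? (λ cols → ¬cols (l , cols))
      ...   | z , ¬col with up? (suc i) z
      ...     | yes u = z , up-rank u , λ y l r → ¬col λ _ → y , l , r
      ...     | no ¬u = ⊥-elim (¬col λ u → ⊥-elim (¬u u))

    build-tail : ∀ d i → (∀ l → l < d ℕ.+ i → RowsMeet l ⊎ ColsMeet (suc l)) → NoUp (suc (d ℕ.+ i)) →
      ∃ (Up (d ℕ.+ i)) ⊎ ∃ (Low (suc (d ℕ.+ i))) → Tail d i
    build-tail zero    i m nu t = noFull-at i , nu , t
    build-tail (suc d) i m nu t = noFull-at i , m i (s≤s (ℕP.m≤n+m i d)) ,
      build-tail d (suc i) (λ l l< → m l (ℕP.≤-trans l< (ℕP.≤-reflexive (ℕP.+-suc d i))))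
        (subst (NoUp ∘ suc) (sym (ℕP.+-suc d i)) nu)
        (subst (λ e → ∃ (Up e) ⊎ ∃ (Low (suc e))) (sym (ℕP.+-suc d i)) t)

  compatible : Compatible (3 ℕ.+ j) b R
  compatible = ordered-by (IsPoset.reflexive poset) ordered ,
    ((p₀ , is-low p₀-rank λ y e → ⊥-elim (ℕP.1+n≢0 (trans e p₀-rank))) , noFull-at 0) , meets 0 (s≤s (s≤s z≤n)) ,
    build-tail j 1 (λ l l< → meets l (s≤s (ℕP.≤-trans l< (ℕP.≤-reflexive (ℕP.+-comm j 1)))))
      (λ x u → ℕP.1+n≰n (subst (_≤ 2 ℕ.+ j) (trans (up-rank u) (cong (λ l → suc (suc l)) (ℕP.+-comm j 1))) (rank≤ x)))
      top
    where
    top : ∃ (Up (j ℕ.+ 1)) ⊎ ∃ (Low (suc (j ℕ.+ 1)))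
    top = either (λ (a , _) → inj₂ (t₀ , is-low rank a)) (λ (¬a , _) → inj₁ (t₀ , is-up rank ¬a)) (low-or-up t₀)
      where
      rank : rk t₀ ≡ suc (j ℕ.+ 1)
      rank = trans t₀-rank (cong suc (ℕP.+-comm 1 j))

  -- The levels of b′ form a rank function, hence agree with `rk`. The sides agree because a lower
  -- element is above its whole previous level, while the absence of full columns makes every upper
  -- element miss something there.
  unique : ∀ b′ → Compatible (3 ℕ.+ j) b′ R → b′ ≡ b
  unique b′ ok = vec-ext λ x → trans (agrees x) (sym (base-β x))
    where
    module C = Compose₃ b′ R ok
    level-rank : ∀ x → C.lev x ≡ rk x
    level-rank = rank-unique C.weaklyGraded graded
    above⇔ : ∀ x s → proj₂ (lookup b′ x) ≡ s → (s ≡ lower → AboveAll x) × (s ≡ upper → ¬ AboveAll x)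
    above⇔ x s eq = (λ { refl y e → proj₁ (C.below-lower (subst₂ _<_ (sym (level-rank y)) (sym (level-rank x)) (ℕP.≤-reflexive e)) eq) }) ,
      λ { refl a → let i = toℕ (proj₁ (lookup b′ x))
                       u = refl , eq
                       w , l , ¬r = C.noFull-block i (C.up-bound u) x u
                   in ¬r (a w (trans (cong suc (trans (sym (level-rank w)) (C.low-level l))) (trans (sym (C.up-level u)) (level-rank x)))) }
    determined : ∀ (c d : Base (3 ℕ.+ j)) → proj₂ c ≡ proj₂ d → level c ≡ level d → c ≡ d
    determined (i , lower) (i′ , lower) refl e = cong (_, lower) (FinP.toℕ-injective e)
    determined (i , upper) (i′ , upper) refl e = cong (_, upper) (FinP.toℕ-injective (ℕP.suc-injective e))
    agrees : ∀ x → lookup b′ x ≡ β x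
    agrees x = determined (lookup b′ x) (β x) (sides-agree (side-cases (proj₂ (lookup b′ x))) (side-cases (proj₂ (β x)))) (trans (level-rank x) (sym (β-level x)))
      where
      sides-agree : proj₂ (lookup b′ x) ≡ lower ⊎ proj₂ (lookup b′ x) ≡ upper → proj₂ (β x) ≡ lower ⊎ proj₂ (β x) ≡ upper → proj₂ (lookup b′ x) ≡ proj₂ (β x)
      sides-agree (inj₁ p) (inj₁ q) = trans p (sym q)
      sides-agree (inj₂ p) (inj₂ q) = trans p (sym q)
      sides-agree (inj₁ p) (inj₂ q) = ⊥-elim (up-not-above q (proj₁ (above⇔ x lower p) refl))
      sides-agree (inj₂ p) (inj₁ q) = ⊥-elim (proj₂ (above⇔ x upper p) refl (low-above q))

decompose : ∀ k {n} R → Counted n k R →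
  Σ (Vec (Base (blockCount k)) n) λ b → Compatible k b R × (∀ b′ → Compatible k b′ R → b′ ≡ b)
decompose 0 R c = decompose₀ R c
decompose 1 R c = decompose₁ R c
decompose 2 R c = decompose₂ R c
decompose (suc (suc (suc j))) R c = Decompose₃.b R c , Decompose₃.compatible R c , Decompose₃.unique R c

-- The transfer matrix

termProduct : ∀ {m} → Vec Term m → Series
termProduct τs = ∏ˢ λ i → termSeries (lookup τs i)

heightSeries : ℕ → Series
heightSeries k = Eˢ.apply (recipe k) termProduct

tailSeries tail¬colsSeries : ℕ → Series
tailSeries j = Eˢ.apply (tail j) termProduct
tail¬colsSeries j = Eˢ.apply (tail¬cols j) termProduct

-- The transfer matrix t and the row vector l of the first block, up to the signs of the second column.
t₁₁ t₁₂ t₂₁ t₂₂ l₁ l₂ : Series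
t₁₁ = e⁻ˣ ⊗ Ψ
t₁₂ = Ψ ⊖ e⁻ˣ ⊗ Ψ ⊕ 𝟙
t₂₁ = e⁻ˣ ⊗ Ψ ⊖ e⁻ˣ ⊗ (e⁻ˣ ⊗ Ψ) ⊕ e⁻ˣ
t₂₂ = Ψ ⊖ e⁻ˣ ⊗ Ψ ⊖ e⁻ˣ ⊗ Ψ ⊕ e⁻ˣ ⊗ (e⁻ˣ ⊗ Ψ) ⊕ 𝟙
l₁ = e⁻ˣ ⊗ Ψ ⊖ 𝟙
l₂ = Ψ ⊖ e⁻ˣ ⊗ Ψ

-- The solver does not know eˣ e⁻ˣ = 1: identities modulo this relation are given with the cofactor h.
cancel-e : ∀ {f g} h → f ≐ g ⊕ (eˣ ⊗ e⁻ˣ ⊖ 𝟙) ⊗ h → f ≐ g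
cancel-e {f} {g} h eq n k = trans (eq n k) (trans (cong (_+_ (g n k))
  (trans (Ser.*-congʳ {h} (λ n k → trans (cong (_+ - 𝟙 n k) (trans (Ser.*-comm eˣ e⁻ˣ n k) (e⁻ˣ⊗eˣ n k))) (ℚP.+-inverseʳ (𝟙 n k))) n k)
         (trans (⊗-nested (λ _ _ → 0ℚ) h n k) (PS₂.conv-zeroˡ h n k))))
  (ℚP.+-identityʳ (g n k)))

module _ where
  open Solver

  private
    factored : ∀ {m} τ (τs : Vec Term m) → termProduct (τ ∷ τs) ≐ termSeries τ ⊗ termProduct τs
    factored τ τs n k = refl

    one-block : ∀ (L : FormalSum Term) → Eˢ.apply (L ⊠ unit) termProduct ≐ Eˢ.apply L termSeries ⊗ (𝟙 ⊕ const 0ℚ)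
    one-block L = Eˢ.apply-⊠ L unit {termProduct} {termSeries} {termProduct} factored

    difference : ∀ {m} L L′ (M M′ : FormalSum (Vec Term m)) {l l′ u u′} →
      Eˢ.apply L termSeries ≐ l → Eˢ.apply M termProduct ≐ u → Eˢ.apply L′ termSeries ≐ l′ → Eˢ.apply M′ termProduct ≐ u′ →
      Eˢ.apply (L ⊠ M ++ opposite (L′ ⊠ M′)) termProduct ≐ l ⊗ u ⊖ l′ ⊗ u′
    difference L L′ M M′ p q p′ q′ n k = trans (Eˢ.apply-⊠-difference L L′ M M′ factored n k)
      (cong₂ (λ v w → v + - w) (⊗-cong p q n k) (⊗-cong p′ q′ n k))

    drop-zero : ∀ f → f ⊕ const 0ℚ ≐ f
    drop-zero f = solve 1 (λ f → f :+ :0 := f) (λ _ _ → refl) f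

    single : ∀ (L : FormalSum Term) {l} → Eˢ.apply L termSeries ≐ l → Eˢ.apply (L ⊠ unit) termProduct ≐ l
    single L {l} p n k = trans (one-block L n k) (trans (⊗-cong p (drop-zero 𝟙) n k) (Ser.*-identityʳ l n k))

    noFull-series : Eˢ.apply noFull termSeries ≐ t₁₁
    noFull-series = drop-zero t₁₁

    lower-series : Eˢ.apply onlyLower termSeries ≐ eˣ
    lower-series = drop-zero eˣ

    emptyBlock-series : Eˢ.apply emptyBlock termSeries ≐ 𝟙
    emptyBlock-series = drop-zero 𝟙

    ¬rows-series : Eˢ.apply noFull¬rows termSeries ≐ t₁₂
    ¬rows-series = solve 2 (λ u p → p :+ (:- (u :* p) :+ (:1 :+ :0)) := (p :- u :* p) :+ :1) (λ _ _ → refl) e⁻ˣ Ψ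

    ¬cols-series : Eˢ.apply noFull¬cols termSeries ≐ t₂₁
    ¬cols-series = solve 2 (λ u p → u :* p :+ (:- (u :* (u :* p)) :+ (u :+ :0)) := (u :* p :- u :* (u :* p)) :+ u) (λ _ _ → refl) e⁻ˣ Ψ

    ¬both-series : Eˢ.apply noFull¬both termSeries ≐ t₂₂
    ¬both-series = solve 2 (λ u p → p :+ (:- (u :* p) :+ (:- (u :* p) :+ (u :* (u :* p) :+ (:1 :+ :0))))
      := (((p :- u :* p) :- u :* p) :+ u :* (u :* p)) :+ :1) (λ _ _ → refl) e⁻ˣ Ψ

    first-series : Eˢ.apply noFullFirst termSeries ≐ l₁
    first-series = solve 2 (λ u p → u :* p :+ (:- :1 :+ :0) := u :* p :- :1) (λ _ _ → refl) e⁻ˣ Ψ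

    ¬rowsFirst-series : Eˢ.apply noFull¬rowsFirst termSeries ≐ l₂
    ¬rowsFirst-series = solve 2 (λ u p → p :+ (:- (u :* p) :+ :0) := p :- u :* p) (λ _ _ → refl) e⁻ˣ Ψ

  A-suc : ∀ j → tailSeries (suc j) ≐ t₁₁ ⊗ tailSeries j ⊖ t₁₂ ⊗ tail¬colsSeries j
  A-suc j = difference noFull noFull¬rows (tail j) (tail¬cols j) noFull-series (λ _ _ → refl) ¬rows-series (λ _ _ → refl)

  B-suc : ∀ j → tail¬colsSeries (suc j) ≐ t₂₁ ⊗ tailSeries j ⊖ t₂₂ ⊗ tail¬colsSeries j
  B-suc j = difference noFull¬cols noFull¬both (tail j) (tail¬cols j) ¬cols-series (λ _ _ → refl) ¬both-series (λ _ _ → refl)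

  A-zero : tailSeries 0 ≐ Ψ ⊖ eˣ
  A-zero n k = trans (difference noFull onlyLower (onlyLower ⊠ unit) (emptyBlock ⊠ unit) noFull-series (single onlyLower lower-series) lower-series (single emptyBlock emptyBlock-series) n k)
    (cancel-e {e⁻ˣ ⊗ Ψ ⊗ eˣ ⊖ eˣ ⊗ 𝟙} {Ψ ⊖ eˣ} Ψ (solve 3 (λ e u p → u :* p :* e :- e :* :1 := (p :- e) :+ (e :* u :- :1) :* p) (λ _ _ → refl) eˣ e⁻ˣ Ψ) n k)

  B-zero : tail¬colsSeries 0 ≐ Ψ ⊖ e⁻ˣ ⊗ Ψ
  B-zero n k = trans (difference noFull¬cols emptyBlock (onlyLower ⊠ unit) (emptyBlock ⊠ unit) ¬cols-series (single onlyLower lower-series) emptyBlock-series (single emptyBlock emptyBlock-series) n k)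
    (cancel-e {t₂₁ ⊗ eˣ ⊖ 𝟙 ⊗ 𝟙} {Ψ ⊖ e⁻ˣ ⊗ Ψ} (Ψ ⊖ e⁻ˣ ⊗ Ψ ⊕ 𝟙) (solve 3 (λ e u p → (u :* p :- u :* (u :* p) :+ u) :* e :- :1 :* :1 := (p :- u :* p) :+ (e :* u :- :1) :* (p :- u :* p :+ :1)) (λ _ _ → refl) eˣ e⁻ˣ Ψ) n k)

  heightSeries-0 : heightSeries 0 ≐ 𝟙
  heightSeries-0 = single emptyBlock emptyBlock-series

  heightSeries-1 : heightSeries 1 ≐ eˣ ⊖ 𝟙
  heightSeries-1 n k = trans (difference onlyLower emptyBlock unit unit lower-series (drop-zero 𝟙) emptyBlock-series (drop-zero 𝟙) n k)
    (solve 1 (λ e → e :* :1 :- :1 :* :1 := e :- :1) (λ _ _ → refl) eˣ n k)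

  heightSeries-2 : heightSeries 2 ≐ e⁻ˣ ⊗ Ψ ⊖ eˣ
  heightSeries-2 n k = trans (difference ((true , noEmptyCol) ∷ []) onlyLower unit unit (drop-zero t₁₁) (drop-zero 𝟙) lower-series (drop-zero 𝟙) n k)
    (solve 3 (λ e u p → u :* p :* :1 :- e :* :1 := u :* p :- e) (λ _ _ → refl) eˣ e⁻ˣ Ψ n k)

  tall : ℕ → Series
  tall j = heightSeries (3 ℕ.+ j)

  tall-form : ∀ j → tall j ≐ l₁ ⊗ tailSeries j ⊖ l₂ ⊗ tail¬colsSeries j
  tall-form j = difference noFullFirst noFull¬rowsFirst (tail j) (tail¬cols j) first-series (λ _ _ → refl) ¬rowsFirst-series (λ _ _ → refl)

  -- The coefficients of the powers of t in the denominator and the numerator of the theorem.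
  d₀ d₁ d₂ n₀ n₁ : Series
  d₀ = eˣ ⊗ eˣ
  d₁ = eˣ ⊗ eˣ ⊕ (𝟙 ⊖ ℤc 3 ⊗ eˣ ⊕ eˣ ⊗ eˣ) ⊗ Ψ
  d₂ = eˣ ⊕ (eˣ ⊖ ℤc 2) ⊗ Ψ
  n₀ = eˣ ⊗ eˣ ⊗ eˣ ⊖ eˣ ⊗ (ℤc 2 ⊗ eˣ) ⊗ Ψ ⊖ (𝟙 ⊖ ℤc 3 ⊗ eˣ ⊕ eˣ ⊗ eˣ) ⊗ (Ψ ⊗ Ψ)
  n₁ = eˣ ⊗ eˣ ⊗ eˣ ⊖ eˣ ⊗ (𝟙 ⊕ ℤc 2 ⊗ eˣ ⊖ eˣ ⊗ eˣ) ⊗ Ψ ⊖ (eˣ ⊖ ℤc 2) ⊗ (Ψ ⊗ Ψ)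

  private
    -- With its signs restored the second column is (-t₁₂, -t₂₂), so this is -d₀ times the trace,
    -- and `determinant` below is d₀ times the determinant. Thus d₀, d₁, d₂ are the coefficients of
    -- the characteristic polynomial, cleared of e⁻ˣ by the factor d₀ = e²ˣ.
    trace : d₀ ⊗ (t₂₂ ⊖ t₁₁) ≐ d₁
    trace = cancel-e (⊝ (ℤc 3 ⊗ eˣ ⊗ Ψ) ⊕ (eˣ ⊗ e⁻ˣ ⊕ 𝟙) ⊗ Ψ)
      (solve 3 (λ e u p → e :* e :* ((p :- u :* p :- u :* p :+ u :* (u :* p) :+ :1) :- u :* p)
        := (e :* e :+ (:1 :- :3 :* e :+ e :* e) :* p) :+ (e :* u :- :1) :* (:- (:3 :* e :* p) :+ (e :* u :+ :1) :* p))
        (λ _ _ → refl) eˣ e⁻ˣ Ψ)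

    determinant : d₀ ⊗ (t₁₂ ⊗ t₂₁ ⊖ t₁₁ ⊗ t₂₂) ≐ d₂
    determinant = cancel-e (eˣ ⊗ Ψ ⊖ ℤc 2 ⊗ (eˣ ⊗ e⁻ˣ ⊕ 𝟙) ⊗ Ψ ⊕ eˣ)
      (solve 3 (λ e u p → e :* e :* ((p :- u :* p :+ :1) :* (u :* p :- u :* (u :* p) :+ u) :- u :* p :* (p :- u :* p :- u :* p :+ u :* (u :* p) :+ :1))
        := (e :+ (e :- :2) :* p) :+ (e :* u :- :1) :* (e :* p :- :2 :* (e :* u :+ :1) :* p :+ e))
        (λ _ _ → refl) eˣ e⁻ˣ Ψ)

    tall-suc : ∀ j → tall (suc j) ≐ l₁ ⊗ (t₁₁ ⊗ tailSeries j ⊖ t₁₂ ⊗ tail¬colsSeries j) ⊖ l₂ ⊗ (t₂₁ ⊗ tailSeries j ⊖ t₂₂ ⊗ tail¬colsSeries j)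
    tall-suc j n k = trans (tall-form (suc j) n k) (cong₂ (λ v w → v + - w) (⊗-cong {l₁} (λ _ _ → refl) (A-suc j) n k) (⊗-cong {l₂} (λ _ _ → refl) (B-suc j) n k))

    tall-suc-suc : ∀ j → tall (suc (suc j)) ≐ l₁ ⊗ (t₁₁ ⊗ (t₁₁ ⊗ tailSeries j ⊖ t₁₂ ⊗ tail¬colsSeries j) ⊖ t₁₂ ⊗ (t₂₁ ⊗ tailSeries j ⊖ t₂₂ ⊗ tail¬colsSeries j)) ⊖ l₂ ⊗ (t₂₁ ⊗ (t₁₁ ⊗ tailSeries j ⊖ t₁₂ ⊗ tail¬colsSeries j) ⊖ t₂₂ ⊗ (t₂₁ ⊗ tailSeries j ⊖ t₂₂ ⊗ tail¬colsSeries j))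
    tall-suc-suc j n k = trans (tall-suc (suc j) n k) (cong₂ (λ v w → v + - w)
      (⊗-cong {l₁} (λ _ _ → refl) (λ n k → cong₂ (λ v w → v + - w) (⊗-cong {t₁₁} (λ _ _ → refl) (A-suc j) n k) (⊗-cong {t₁₂} (λ _ _ → refl) (B-suc j) n k)) n k)
      (⊗-cong {l₂} (λ _ _ → refl) (λ n k → cong₂ (λ v w → v + - w) (⊗-cong {t₂₁} (λ _ _ → refl) (A-suc j) n k) (⊗-cong {t₂₂} (λ _ _ → refl) (B-suc j) n k)) n k))

  -- In the product of d₀ + d₁ t + d₂ t² with the sum of all `tall j` t^j, the coefficient of t⁰ is
  -- computed here and that of t¹ in `tall-second`; `tall-recurrence` makes the others vanish, so
  -- the numerator is linear in t.
  tall-initial : d₀ ⊗ tall 0 ≐ n₀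
  tall-initial n k = trans (⊗-cong {d₀} (λ _ _ → refl) (λ n k → trans (tall-form 0 n k)
      (cong₂ (λ v w → v + - w) (⊗-cong {l₁} (λ _ _ → refl) A-zero n k) (⊗-cong {l₂} (λ _ _ → refl) B-zero n k))) n k)
    (cancel-e {d₀ ⊗ (l₁ ⊗ (Ψ ⊖ eˣ) ⊖ l₂ ⊗ (Ψ ⊖ e⁻ˣ ⊗ Ψ))} {n₀} (ℤc 3 ⊗ eˣ ⊗ Ψ ⊗ Ψ ⊖ Ψ ⊗ Ψ ⊖ eˣ ⊗ e⁻ˣ ⊗ Ψ ⊗ Ψ ⊖ eˣ ⊗ eˣ ⊗ Ψ)
      (solve 3 (λ e u p → e :* e :* ((u :* p :- :1) :* (p :- e) :- (p :- u :* p) :* (p :- u :* p))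
        := (e :* e :* e :- e :* (:2 :* e) :* p :- (:1 :- :3 :* e :+ e :* e) :* (p :* p))
          :+ (e :* u :- :1) :* (:3 :* e :* p :* p :- p :* p :- e :* u :* p :* p :- e :* e :* p))
        (λ _ _ → refl) eˣ e⁻ˣ Ψ) n k)

  tall-second : d₀ ⊗ tall 1 ⊕ d₁ ⊗ tall 0 ≐ n₁
  tall-second n k = trans (cong₂ _+_ (⊗-cong {d₀} (λ _ _ → refl) (tall-suc 0) n k) (⊗-cong (λ n k → sym (trace n k)) (tall-form 0) n k))
    (trans (solve 9 (λ e t₁₁ t₁₂ t₂₁ t₂₂ l₁ l₂ tailSeries tail¬colsSeries → e :* (l₁ :* (t₁₁ :* tailSeries :- t₁₂ :* tail¬colsSeries) :- l₂ :* (t₂₁ :* tailSeries :- t₂₂ :* tail¬colsSeries)) :+ (e :* (t₂₂ :- t₁₁)) :* (l₁ :* tailSeries :- l₂ :* tail¬colsSeries)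
        := e :* (tailSeries :* (t₂₂ :* l₁ :- l₂ :* t₂₁) :+ tail¬colsSeries :* (t₁₁ :* l₂ :- l₁ :* t₁₂))) (λ _ _ → refl) d₀ t₁₁ t₁₂ t₂₁ t₂₂ l₁ l₂ (tailSeries 0) (tail¬colsSeries 0) n k)
    (trans (⊗-cong {d₀} (λ _ _ → refl) (λ n k → cong₂ _+_ (⊗-cong {g = t₂₂ ⊗ l₁ ⊖ l₂ ⊗ t₂₁} A-zero (λ _ _ → refl) n k) (⊗-cong {g = t₁₁ ⊗ l₂ ⊖ l₁ ⊗ t₁₂} B-zero (λ _ _ → refl) n k)) n k)
    (cancel-e {d₀ ⊗ ((Ψ ⊖ eˣ) ⊗ (t₂₂ ⊗ l₁ ⊖ l₂ ⊗ t₂₁) ⊕ (Ψ ⊖ e⁻ˣ ⊗ Ψ) ⊗ (t₁₁ ⊗ l₂ ⊖ l₁ ⊗ t₁₂))} {n₁} (ℤc 2 ⊗ Ψ ⊗ Ψ ⊖ eˣ ⊗ Ψ ⊖ eˣ ⊗ Ψ ⊗ Ψ ⊕ ℤc 2 ⊗ eˣ ⊗ e⁻ˣ ⊗ Ψ ⊗ Ψ ⊖ ℤc 2 ⊗ eˣ ⊗ eˣ ⊗ Ψ)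
      (solve 3 (λ e u p → e :* e :* ((p :- e) :* ((p :- u :* p :- u :* p :+ u :* (u :* p) :+ :1) :* (u :* p :- :1) :- (p :- u :* p) :* (u :* p :- u :* (u :* p) :+ u))
          :+ (p :- u :* p) :* (u :* p :* (p :- u :* p) :- (u :* p :- :1) :* (p :- u :* p :+ :1)))
        := (e :* e :* e :- e :* (:1 :+ :2 :* e :- e :* e) :* p :- (e :- :2) :* (p :* p))
          :+ (e :* u :- :1) :* (:2 :* p :* p :- e :* p :- e :* p :* p :+ :2 :* e :* u :* p :* p :- :2 :* e :* e :* p))
        (λ _ _ → refl) eˣ e⁻ˣ Ψ) n k)))

  tall-recurrence : ∀ j → d₀ ⊗ tall (suc (suc j)) ⊕ d₁ ⊗ tall (suc j) ⊕ d₂ ⊗ tall j ≐ const 0ℚ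
  tall-recurrence j n k = trans (cong₂ _+_ (cong₂ _+_ (⊗-cong {d₀} (λ _ _ → refl) (tall-suc-suc j) n k)
      (⊗-cong (λ n k → sym (trace n k)) (tall-suc j) n k)) (⊗-cong (λ n k → sym (determinant n k)) (tall-form j) n k))
    -- The matrix entries are now independent variables: this is Cayley-Hamilton for a generic 2 × 2
    -- matrix.
    (solve 9 (λ e t₁₁ t₁₂ t₂₁ t₂₂ l₁ l₂ tailSeries tail¬colsSeries →
        e :* (l₁ :* (t₁₁ :* (t₁₁ :* tailSeries :- t₁₂ :* tail¬colsSeries) :- t₁₂ :* (t₂₁ :* tailSeries :- t₂₂ :* tail¬colsSeries)) :- l₂ :* (t₂₁ :* (t₁₁ :* tailSeries :- t₁₂ :* tail¬colsSeries) :- t₂₂ :* (t₂₁ :* tailSeries :- t₂₂ :* tail¬colsSeries)))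
        :+ (e :* (t₂₂ :- t₁₁)) :* (l₁ :* (t₁₁ :* tailSeries :- t₁₂ :* tail¬colsSeries) :- l₂ :* (t₂₁ :* tailSeries :- t₂₂ :* tail¬colsSeries))
        :+ (e :* (t₁₂ :* t₂₁ :- t₁₁ :* t₂₂)) :* (l₁ :* tailSeries :- l₂ :* tail¬colsSeries) := :0)
      (λ _ _ → refl) d₀ t₁₁ t₁₂ t₂₁ t₂₂ l₁ l₂ (tailSeries j) (tail¬colsSeries j) n k)

-- Finiteness of the sum over heights

chain-length : ∀ {n k} {R : Relation n} → IsPoset R → HasChainOfSize R k → k ℕ.≤ n
chain-length {n} {R = R} poset (xs , chain , refl) = FinP.injective⇒≤ (injective xs chain)
  where
  open PosetFacts R poset using (lt-trans)
  head-below : ∀ {v xs} → IsChain R (v ∷ xs) → ∀ i → Lt R v (List.lookup xs i)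
  head-below (l ∷ c) zero    = l
  head-below (l ∷ c) (suc i) = lt-trans l (head-below c i)
  rest : ∀ {v xs} → IsChain R (v ∷ xs) → IsChain R xs
  rest [ _ ]   = []
  rest (_ ∷ c) = c
  injective : ∀ xs → IsChain R xs → ∀ {i j} → List.lookup xs i ≡ List.lookup xs j → i ≡ j
  injective (v ∷ xs) c {zero}  {zero}  eq = refl
  injective (v ∷ xs) c {zero}  {suc j} eq = ⊥-elim (proj₂ (head-below c j) eq)
  injective (v ∷ xs) c {suc i} {zero}  eq = ⊥-elim (proj₂ (head-below c i) (sym eq))
  injective (v ∷ xs) c {suc i} {suc j} eq = cong suc (injective xs (rest c) eq)

count-vanishes : ∀ {n k m} → IsCardinality (Counted n k) m → n ℕ.< k → m ≡ 0
count-vanishes ([] , _ , refl , _) n<k = refl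
count-vanishes {n} {k} (R ∷ L , _ , _ , member) n<k with Equivalence.to (member R) (here refl)
... | poset , _ , _ , (chain , _) = ⊥-elim (ℕP.<⇒≱ n<k (chain-length poset chain))

-- The local function of EGF₁ cannot be named from outside, so it is obtained as the solution of a
-- unification problem: the normal form of EGF₁ is first freed of all other arithmetic.
mutual
  egf₁-unscaled : (ℕ → ℕ → ℕ) → ℕ → ℚ → ℚ
  egf₁-unscaled w n i = _

  egf₁-scale : ∀ w n → EGF₁ w (suc n) 0 ≡ egf₁-unscaled w n (inv! (suc n))
  egf₁-scale w n with inv! (suc n)
  ... | i = refl

mutual
  egf₁-split : (ℕ → ℕ → ℕ) → ℕ → ℕ → ℚ → ℚ
  egf₁-split w m n i = _

  egf₁-separate : ∀ w n i → egf₁-unscaled w n i ≡ egf₁-split w (suc n) n i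
  egf₁-separate w n i with suc n
  ... | m = refl

mutual
  partialSum : (ℕ → ℕ → ℕ) → ℕ → ℕ → ℕ
  partialSum w m n = _

  egf₁-sum : ∀ w m n i → egf₁-split w m n i ≡ natℚ (partialSum w m n ℕ.+ w m m) * i
  egf₁-sum w m n i with ℕ._+_
  ... | _ = refl

EGF₁-sum : ∀ w n → EGF₁ w n 0 ≡ sumTo n (λ k → natℚ (w n k)) * inv! n
EGF₁-sum w zero    = refl
EGF₁-sum w (suc n) = trans (egf₁-scale w n) (trans (egf₁-separate w n (inv! (suc n))) (trans (egf₁-sum w (suc n) n (inv! (suc n)))
  (cong (_* inv! (suc n)) (trans (natℚ-+ (partialSum w (suc n) n) (w (suc n) (suc n))) (cong (_+ natℚ (w (suc n) (suc n))) (sums (suc n) n))))))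
  where
  sums : ∀ m n → natℚ (partialSum w m n) ≡ sumTo n (λ k → natℚ (w m k))
  sums m zero    = refl
  sums m (suc n) = trans (natℚ-+ (partialSum w m n) (w m (suc n))) (cong (_+ natℚ (w m (suc n))) (sums m n))

-- The fraction in t and the sum over all heights

module _ where
  open Solver

  private
    e-tconst : TConst eˣ
    e-tconst = tconst λ n k → refl

    e⁻-tconst : TConst e⁻ˣ
    e⁻-tconst = tconst λ n k → refl

    Ψ-tconst : TConst Ψ
    Ψ-tconst = tconst λ n k → refl

    scaled-tconst : ∀ m → TConst (ℤc m ⊗ eˣ)
    scaled-tconst m = ⊗-tconst (const-tconst (natℚ m)) e-tconst

    quadratic-tconst : TConst (𝟙 ⊖ ℤc 3 ⊗ eˣ ⊕ eˣ ⊗ eˣ)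
    quadratic-tconst = ⊕-tconst (⊖-tconst (const-tconst 1ℚ) (scaled-tconst 3)) (⊗-tconst e-tconst e-tconst)

    linear-tconst : TConst (eˣ ⊖ ℤc 2)
    linear-tconst = ⊖-tconst e-tconst (const-tconst (natℚ 2))

    e³-tconst : TConst (eˣ ⊗ eˣ ⊗ eˣ)
    e³-tconst = ⊗-tconst (⊗-tconst e-tconst e-tconst) e-tconst

  d₀-tconst : TConst d₀
  d₀-tconst = ⊗-tconst e-tconst e-tconst

  d₁-tconst : TConst d₁
  d₁-tconst = ⊕-tconst d₀-tconst (⊗-tconst quadratic-tconst Ψ-tconst)

  d₂-tconst : TConst d₂
  d₂-tconst = ⊕-tconst e-tconst (⊗-tconst linear-tconst Ψ-tconst)

  n₀-tconst : TConst n₀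
  n₀-tconst = ⊖-tconst (⊖-tconst e³-tconst (⊗-tconst (⊗-tconst e-tconst (scaled-tconst 2)) Ψ-tconst))
    (⊗-tconst quadratic-tconst (⊗-tconst Ψ-tconst Ψ-tconst))

  n₁-tconst : TConst n₁
  n₁-tconst = ⊖-tconst
    (⊖-tconst e³-tconst (⊗-tconst (⊗-tconst e-tconst (⊖-tconst (⊕-tconst (const-tconst 1ℚ) (scaled-tconst 2)) d₀-tconst)) Ψ-tconst))
    (⊗-tconst linear-tconst (⊗-tconst Ψ-tconst Ψ-tconst))

  numerator denominator numerator₁ denominator₁ : Series
  numerator = e³ˣ ⊕ e³ˣ ⊗ 𝕥
    ⊖ eˣ ⊗ (ℤc 2 ⊗ eˣ ⊕ (𝟙 ⊕ ℤc 2 ⊗ eˣ ⊖ e²ˣ) ⊗ 𝕥) ⊗ Ψ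
    ⊖ ((𝟙 ⊖ ℤc 3 ⊗ eˣ ⊕ e²ˣ) ⊕ (eˣ ⊖ ℤc 2) ⊗ 𝕥) ⊗ pow Ψ 2
  denominator = eˣ ⊗ (eˣ ⊕ 𝕥 ⊗ eˣ ⊕ pow 𝕥 2)
    ⊕ ((𝟙 ⊖ ℤc 3 ⊗ eˣ ⊕ e²ˣ) ⊗ 𝕥 ⊕ (eˣ ⊖ ℤc 2) ⊗ pow 𝕥 2) ⊗ Ψ
  numerator₁ = ℤc 2 ⊗ e³ˣ ⊕ e²ˣ ⊗ (eˣ ⊖ ℤc 2) ⊗ Ψ
  denominator₁ = eˣ ⊗ (ℤc 2 ⊗ eˣ ⊕ 𝟙) ⊕ (e²ˣ ⊖ ℤc 2 ⊗ eˣ ⊖ 𝟙) ⊗ Ψ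

  numerator-expand : numerator ≐ n₀ ⊕ 𝕥 ⊗ n₁
  numerator-expand = solve 3 (λ e p t → (e :* e :* e :+ e :* e :* e :* t
      :- e :* (:2 :* e :+ (:1 :+ :2 :* e :- e :* e) :* t) :* p
      :- ((:1 :- :3 :* e :+ e :* e) :+ (e :- :2) :* t) :* (p :* (p :* :1)))
    := (e :* e :* e :- e :* (:2 :* e) :* p :- (:1 :- :3 :* e :+ e :* e) :* (p :* p))
      :+ t :* (e :* e :* e :- e :* (:1 :+ :2 :* e :- e :* e) :* p :- (e :- :2) :* (p :* p)))
    (λ _ _ → refl) eˣ Ψ 𝕥

  denominator-expand : denominator ≐ d₀ ⊕ 𝕥 ⊗ d₁ ⊕ 𝕥 ⊗ (𝕥 ⊗ d₂)
  denominator-expand = solve 3 (λ e p t → e :* (e :+ t :* e :+ t :* (t :* :1))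
      :+ ((:1 :- :3 :* e :+ e :* e) :* t :+ (e :- :2) :* (t :* (t :* :1))) :* p
    := e :* e :+ t :* (e :* e :+ (:1 :- :3 :* e :+ e :* e) :* p) :+ t :* (t :* (e :+ (e :- :2) :* p)))
    (λ _ _ → refl) eˣ Ψ 𝕥

  ⊗-denominator : ∀ f → f ⊗ denominator ≐ f ⊗ d₀ ⊕ 𝕥 ⊗ (f ⊗ d₁) ⊕ 𝕥 ⊗ (𝕥 ⊗ (f ⊗ d₂))
  ⊗-denominator f n k = trans (⊗-cong {f} (λ _ _ → refl) denominator-expand n k)
    (solve 5 (λ f t u v w → f :* (u :+ t :* v :+ t :* (t :* w)) := f :* u :+ t :* (f :* v) :+ t :* (t :* (f :* w)))
      (λ _ _ → refl) f 𝕥 d₀ d₁ d₂ n k)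

  -- The constant term is a closed rational and computes to 1; so does that of `denominator₁`, as 3
  -- - 2.
  denominator-unit : denominator 0 0 ≢ 0ℚ
  denominator-unit ()

  denominator₁-unit : denominator₁ 0 0 ≢ 0ℚ
  denominator₁-unit ()

  quotient : ∀ {f g h} → g 0 0 ≢ 0ℚ → h ⊗ g ≐ f → f ⊘ g ≐ h
  quotient {f} {g} {h} unit eq n k = trans (⊗-cong {g = inv g} (λ n k → sym (eq n k)) (λ _ _ → refl) n k)
    (trans (Ser.*-assoc h g (inv g) n k) (trans (⊗-cong {h} (λ _ _ → refl) (inv-correct g unit) n k) (Ser.*-identityʳ h n k)))

  -- All heights at least 3, divided by t³.
  tallSeries : Series
  tallSeries n k = tall k n 0

  tallSeries-at : ∀ f → TConst f → ∀ n k → (tallSeries ⊗ f) n k ≡ (f ⊗ tall k) n 0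
  tallSeries-at f tf n k = trans (⊗-at tallSeries f tf n k) (Ser.*-comm (tall k) f n 0)

  tallSeries-equation : tallSeries ⊗ denominator ≐ numerator
  tallSeries-equation n k = trans (⊗-denominator tallSeries n k) (trans (coefficient n k) (sym (numerator-expand n k)))
    where
    open ≡-Reasoning
    coefficient : ∀ n k → (tallSeries ⊗ d₀) n k + (𝕥 ⊗ (tallSeries ⊗ d₁)) n k + (𝕥 ⊗ (𝕥 ⊗ (tallSeries ⊗ d₂))) n k ≡ n₀ n k + (𝕥 ⊗ n₁) n k
    coefficient n zero = begin
      (tallSeries ⊗ d₀) n 0 + (𝕥 ⊗ (tallSeries ⊗ d₁)) n 0 + (𝕥 ⊗ (𝕥 ⊗ (tallSeries ⊗ d₂))) n 0
        ≡⟨ cong₂ _+_ (cong₂ _+_ (trans (tallSeries-at d₀ d₀-tconst n 0) (tall-initial n 0)) (𝕥⊗-zero (tallSeries ⊗ d₁) n)) (𝕥⊗-zero (𝕥 ⊗ (tallSeries ⊗ d₂)) n) ⟩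
      n₀ n 0 + 0ℚ + 0ℚ  ≡⟨ ℚP.+-identityʳ (n₀ n 0 + 0ℚ) ⟩
      n₀ n 0 + 0ℚ       ≡⟨ cong (_+_ (n₀ n 0)) (𝕥⊗-zero n₁ n) ⟨
      n₀ n 0 + (𝕥 ⊗ n₁) n 0 ∎
    coefficient n (suc zero) = begin
      (tallSeries ⊗ d₀) n 1 + (𝕥 ⊗ (tallSeries ⊗ d₁)) n 1 + (𝕥 ⊗ (𝕥 ⊗ (tallSeries ⊗ d₂))) n 1
        ≡⟨ cong₂ _+_ (cong₂ _+_ (tallSeries-at d₀ d₀-tconst n 1) (trans (𝕥⊗-suc (tallSeries ⊗ d₁) n 0) (tallSeries-at d₁ d₁-tconst n 0)))
             (trans (𝕥⊗-suc (𝕥 ⊗ (tallSeries ⊗ d₂)) n 0) (𝕥⊗-zero (tallSeries ⊗ d₂) n)) ⟩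
      (d₀ ⊗ tall 1) n 0 + (d₁ ⊗ tall 0) n 0 + 0ℚ  ≡⟨ ℚP.+-identityʳ _ ⟩
      (d₀ ⊗ tall 1) n 0 + (d₁ ⊗ tall 0) n 0       ≡⟨ tall-second n 0 ⟩
      n₁ n 0                                ≡⟨ ℚP.+-identityˡ (n₁ n 0) ⟨
      0ℚ + n₁ n 0                           ≡⟨ cong₂ _+_ (vanish n₀-tconst n 0) (𝕥⊗-suc n₁ n 0) ⟨
      n₀ n 1 + (𝕥 ⊗ n₁) n 1 ∎
    coefficient n (suc (suc k)) = begin
      (tallSeries ⊗ d₀) n (2 ℕ.+ k) + (𝕥 ⊗ (tallSeries ⊗ d₁)) n (2 ℕ.+ k) + (𝕥 ⊗ (𝕥 ⊗ (tallSeries ⊗ d₂))) n (2 ℕ.+ k)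
        ≡⟨ cong₂ _+_ (cong₂ _+_ (tallSeries-at d₀ d₀-tconst n (2 ℕ.+ k)) (trans (𝕥⊗-suc (tallSeries ⊗ d₁) n (suc k)) (tallSeries-at d₁ d₁-tconst n (suc k))))
             (trans (𝕥⊗-suc (𝕥 ⊗ (tallSeries ⊗ d₂)) n (suc k)) (trans (𝕥⊗-suc (tallSeries ⊗ d₂) n k) (tallSeries-at d₂ d₂-tconst n k))) ⟩
      (d₀ ⊗ tall (2 ℕ.+ k)) n 0 + (d₁ ⊗ tall (suc k)) n 0 + (d₂ ⊗ tall k) n 0  ≡⟨ tall-recurrence k n 0 ⟩
      const 0ℚ n 0                                                    ≡⟨ zero-nested n 0 ⟩
      0ℚ                                                              ≡⟨ cong₂ _+_ (vanish n₀-tconst n (suc k)) (trans (𝕥⊗-suc n₁ n (suc k)) (vanish n₁-tconst n k)) ⟨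
      n₀ n (2 ℕ.+ k) + (𝕥 ⊗ n₁) n (2 ℕ.+ k) ∎

  RHS₁-expand : RHS₁ ≐ 𝟙 ⊕ 𝕥 ⊗ (eˣ ⊖ 𝟙) ⊕ 𝕥 ⊗ (𝕥 ⊗ (e⁻ˣ ⊗ Ψ ⊖ eˣ)) ⊕ 𝕥 ⊗ (𝕥 ⊗ (𝕥 ⊗ tallSeries))
  RHS₁-expand n k = trans
    (cong (_+_ ((𝟙 ⊕ (eˣ ⊖ 𝟙) ⊗ 𝕥 ⊕ (e⁻ˣ ⊗ Ψ ⊖ eˣ) ⊗ pow 𝕥 2) n k))
      (⊗-cong {pow 𝕥 3} (λ _ _ → refl) (quotient {numerator} {denominator} {tallSeries} denominator-unit tallSeries-equation) n k))
    (solve 4 (λ t u v g → :1 :+ u :* t :+ v :* (t :* (t :* :1)) :+ (t :* (t :* (t :* :1))) :* g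
        := :1 :+ t :* u :+ t :* (t :* v) :+ t :* (t :* (t :* g))) (λ _ _ → refl) 𝕥 (eˣ ⊖ 𝟙) (e⁻ˣ ⊗ Ψ ⊖ eˣ) tallSeries n k)

  private
    h₁ h₂ : Series
    h₁ = eˣ ⊖ 𝟙
    h₂ = e⁻ˣ ⊗ Ψ ⊖ eˣ

    h₁-tconst : TConst h₁
    h₁-tconst = ⊖-tconst e-tconst (const-tconst 1ℚ)

    h₂-tconst : TConst h₂
    h₂-tconst = ⊖-tconst (⊗-tconst e⁻-tconst Ψ-tconst) e-tconst

    cong₄ : ∀ {p q r s p′ q′ r′ s′ : ℚ} → p ≡ p′ → q ≡ q′ → r ≡ r′ → s ≡ s′ → p + q + r + s ≡ p′ + q′ + r′ + s′
    cong₄ refl refl refl refl = refl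

  RHS₁-coefficient : ∀ n k → RHS₁ n k ≡ heightSeries k n 0
  RHS₁-coefficient n k = trans (RHS₁-expand n k) (coefficient k)
    where
    coefficient : ∀ k → 𝟙 n k + (𝕥 ⊗ h₁) n k + (𝕥 ⊗ (𝕥 ⊗ h₂)) n k + (𝕥 ⊗ (𝕥 ⊗ (𝕥 ⊗ tallSeries))) n k ≡ heightSeries k n 0
    coefficient 0 = trans (cong₄ (refl {x = 𝟙 n 0}) (𝕥⊗-zero h₁ n) (𝕥⊗-zero (𝕥 ⊗ h₂) n) (𝕥⊗-zero (𝕥 ⊗ (𝕥 ⊗ tallSeries)) n))
      (trans (ℚP.+-identityʳ (𝟙 n 0 + 0ℚ + 0ℚ)) (trans (ℚP.+-identityʳ (𝟙 n 0 + 0ℚ)) (trans (ℚP.+-identityʳ (𝟙 n 0)) (sym (heightSeries-0 n 0)))))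
    coefficient 1 = trans (cong₄ (vanish (const-tconst 1ℚ) n 0) (𝕥⊗-suc h₁ n 0) (trans (𝕥⊗-suc (𝕥 ⊗ h₂) n 0) (𝕥⊗-zero h₂ n)) (trans (𝕥⊗-suc (𝕥 ⊗ (𝕥 ⊗ tallSeries)) n 0) (𝕥⊗-zero (𝕥 ⊗ tallSeries) n)))
      (trans (ℚP.+-identityʳ _) (trans (ℚP.+-identityʳ _) (trans (ℚP.+-identityˡ _) (sym (heightSeries-1 n 0)))))
    coefficient 2 = trans (cong₄ (vanish (const-tconst 1ℚ) n 1) (trans (𝕥⊗-suc h₁ n 1) (vanish h₁-tconst n 0)) (trans (𝕥⊗-suc (𝕥 ⊗ h₂) n 1) (𝕥⊗-suc h₂ n 0))
        (trans (𝕥⊗-suc (𝕥 ⊗ (𝕥 ⊗ tallSeries)) n 1) (trans (𝕥⊗-suc (𝕥 ⊗ tallSeries) n 0) (𝕥⊗-zero tallSeries n))))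
      (trans (ℚP.+-identityʳ _) (trans (ℚP.+-identityˡ _) (sym (heightSeries-2 n 0))))
    coefficient (suc (suc (suc j))) = trans (cong₄ (vanish (const-tconst 1ℚ) n (2 ℕ.+ j)) (trans (𝕥⊗-suc h₁ n (2 ℕ.+ j)) (vanish h₁-tconst n (suc j)))
        (trans (𝕥⊗-suc (𝕥 ⊗ h₂) n (2 ℕ.+ j)) (trans (𝕥⊗-suc h₂ n (suc j)) (vanish h₂-tconst n j)))
        (trans (𝕥⊗-suc (𝕥 ⊗ (𝕥 ⊗ tallSeries)) n (2 ℕ.+ j)) (trans (𝕥⊗-suc (𝕥 ⊗ tallSeries) n (suc j)) (𝕥⊗-suc tallSeries n j))))
      (ℚP.+-identityˡ _)

  partialTall : ℕ → Series
  partialTall zero    = tall 0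
  partialTall (suc M) = partialTall M ⊕ tall (suc M)

  -- With upper limits staggered by one, the left side is exactly the two initial equations plus the
  -- recurrences for j ≤ M, without boundary terms. So infinite sums are avoided until the
  -- coefficients have stabilised.
  partialTall-equation : ∀ M → d₀ ⊗ partialTall (suc (suc M)) ⊕ d₁ ⊗ partialTall (suc M) ⊕ d₂ ⊗ partialTall M ≐ n₀ ⊕ n₁
  partialTall-equation zero n k = trans
    (solve 6 (λ u v w f g h → u :* (f :+ g :+ h) :+ v :* (f :+ g) :+ w :* f
        := u :* f :+ (u :* g :+ v :* f) :+ (u :* h :+ v :* g :+ w :* f)) (λ _ _ → refl) d₀ d₁ d₂ (tall 0) (tall 1) (tall 2) n k)
    (trans (cong₂ _+_ (cong₂ _+_ (tall-initial n k) (tall-second n k)) (trans (tall-recurrence 0 n k) (zero-nested n k))) (ℚP.+-identityʳ _))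
  partialTall-equation (suc M) n k = trans
    (solve 9 (λ u v w f g h f′ g′ h′ → u :* (f :+ f′) :+ v :* (g :+ g′) :+ w :* (h :+ h′)
        := (u :* f :+ v :* g :+ w :* h) :+ (u :* f′ :+ v :* g′ :+ w :* h′)) (λ _ _ → refl)
      d₀ d₁ d₂ (partialTall (2 ℕ.+ M)) (partialTall (suc M)) (partialTall M) (tall (3 ℕ.+ M)) (tall (2 ℕ.+ M)) (tall (suc M)) n k)
    (trans (cong₂ _+_ (partialTall-equation M n k) (trans (tall-recurrence (suc M) n k) (zero-nested n k))) (ℚP.+-identityʳ _))

module _ (w : ℕ → ℕ → ℕ) (card : ∀ n k → IsCardinality (Counted n k) (w n k)) where

  count : ∀ n k → natℚ (w n k) * inv! n ≡ heightSeries k n 0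
  count n k = count-series {n} {k} (decompose k) (compose k) (card n k)

  -- Not visible from the formula for the series; it is drawn from the counting side, where a chain
  -- on [n] has at most n elements.
  vanishes : ∀ n k → n ℕ.< k → heightSeries k n 0 ≡ 0ℚ
  vanishes n k n<k = trans (sym (count n k)) (*-annihilˡ (inv! n) (cong natℚ (count-vanishes (card n k) n<k)))

  private
    sum-extend : ∀ n {h} M → (∀ i → n ℕ.< i → h i ≡ 0ℚ) → sumTo (M ℕ.+ n) h ≡ sumTo n h
    sum-extend n zero    z = refl
    sum-extend n (suc M) z = trans (cong₂ _+_ (sum-extend n M z) (z (suc M ℕ.+ n) (ℕ.s≤s (ℕP.m≤n+m n M)))) (ℚP.+-identityʳ _)

  allHeights : Series
  allHeights n zero    = sumTo n λ j → tall j n 0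
  allHeights n (suc k) = 0ℚ

  private
    partialTall-at : ∀ M n → partialTall M n 0 ≡ sumTo M (λ j → tall j n 0)
    partialTall-at zero    n = refl
    partialTall-at (suc M) n = cong (_+ tall (suc M) n 0) (partialTall-at M n)

    stable : ∀ M n → n ℕ.≤ M → partialTall M n 0 ≡ allHeights n 0
    stable M n n≤M = trans (partialTall-at M n) (trans (cong (λ l → sumTo l λ j → tall j n 0) (sym (ℕP.m∸n+n≡m n≤M)))
      (sum-extend n (M ∸ n) λ i n<i → vanishes n (3 ℕ.+ i) (ℕP.<-≤-trans n<i (ℕP.m≤n+m i 3))))

    allHeights-⊗ : ∀ f M n → n ℕ.≤ M → (f ⊗ allHeights) n 0 ≡ (f ⊗ partialTall M) n 0
    allHeights-⊗ f M n n≤M = sumTo-cong n λ i _ → cong (f i 0 *_) (sym (stable M (n ∸ i) (ℕP.≤-trans (ℕP.m∸n≤m n i) n≤M)))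

  private
    allHeights-tconst : TConst allHeights
    allHeights-tconst = tconst λ n k → refl

  allHeights-equation : d₀ ⊗ allHeights ⊕ d₁ ⊗ allHeights ⊕ d₂ ⊗ allHeights ≐ n₀ ⊕ n₁
  allHeights-equation n zero = trans
    (cong₂ _+_ (cong₂ _+_ (allHeights-⊗ d₀ (2 ℕ.+ n) n (ℕP.m≤n+m n 2)) (allHeights-⊗ d₁ (suc n) n (ℕP.n≤1+n n))) (allHeights-⊗ d₂ n n ℕP.≤-refl))
    (partialTall-equation n n 0)
  allHeights-equation n (suc k) = trans
    (cong₂ _+_ (cong₂ _+_ (vanish (⊗-tconst d₀-tconst allHeights-tconst) n k) (vanish (⊗-tconst d₁-tconst allHeights-tconst) n k))
      (vanish (⊗-tconst d₂-tconst allHeights-tconst) n k))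
    (sym (cong₂ _+_ (vanish n₀-tconst n k) (vanish n₁-tconst n k)))

  -- The heights 0, 1 and 2 telescope: 1 + (eˣ - 1) + (e⁻ˣ Ψ - eˣ) = e⁻ˣ Ψ.
  total : Series
  total = e⁻ˣ ⊗ Ψ ⊕ allHeights

  -- The denominator is d₀ + d₁ + d₂, that of the first formula at t = 1. The quotient equals Ψ +
  -- `allHeights`, and the summand (e⁻ˣ - 1) Ψ exchanges the extra Ψ for e⁻ˣ Ψ.
  RHS₂-total : RHS₂ ≐ total
  RHS₂-total n k = trans (cong (_+_ (((e⁻ˣ ⊖ 𝟙) ⊗ Ψ) n k)) (quotient {numerator₁} {denominator₁} {Ψ ⊕ allHeights} denominator₁-unit equation n k))
    (solve 3 (λ u p s → (u :- :1) :* p :+ (p :+ s) := u :* p :+ s) (λ _ _ → refl) e⁻ˣ Ψ allHeights n k)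
    where
    open Solver
    equation : (Ψ ⊕ allHeights) ⊗ denominator₁ ≐ numerator₁
    equation n k = trans
      (solve 3 (λ e p s → (p :+ s) :* (e :* (:2 :* e :+ :1) :+ (e :* e :- :2 :* e :- :1) :* p)
          := p :* (e :* (:2 :* e :+ :1) :+ (e :* e :- :2 :* e :- :1) :* p)
            :+ (e :* e :* s :+ (e :* e :+ (:1 :- :3 :* e :+ e :* e) :* p) :* s :+ (e :+ (e :- :2) :* p) :* s))
        (λ _ _ → refl) eˣ Ψ allHeights n k)
      (trans (cong (_+_ ((Ψ ⊗ denominator₁) n k)) (allHeights-equation n k))
      (solve 2 (λ e p → p :* (e :* (:2 :* e :+ :1) :+ (e :* e :- :2 :* e :- :1) :* p)
          :+ ((e :* e :* e :- e :* (:2 :* e) :* p :- (:1 :- :3 :* e :+ e :* e) :* (p :* p))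
            :+ (e :* e :* e :- e :* (:1 :+ :2 :* e :- e :* e) :* p :- (e :- :2) :* (p :* p)))
          := :2 :* (e :* e :* e) :+ e :* e :* (e :- :2) :* p)
        (λ _ _ → refl) eˣ Ψ n k))

  EGF₁-total : EGF₁ w ≐ total
  EGF₁-total n (suc k) = sym (trans (cong (_+ 0ℚ) (vanish (⊗-tconst {e⁻ˣ} {Ψ} (tconst λ _ _ → refl) (tconst λ _ _ → refl)) n k)) refl)
  EGF₁-total n zero = begin
    EGF₁ w n 0                                    ≡⟨ EGF₁-sum w n ⟩
    sumTo n (λ k → natℚ (w n k)) * inv! n         ≡⟨ ℚP.*-comm _ (inv! n) ⟩
    inv! n * sumTo n (λ k → natℚ (w n k))         ≡⟨ sumTo-*ˡ (inv! n) n (λ k → natℚ (w n k)) ⟨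
    sumTo n (λ k → inv! n * natℚ (w n k))         ≡⟨ (sumTo-cong n λ k _ → trans (ℚP.*-comm (inv! n) (natℚ (w n k))) (count n k)) ⟩
    sumTo n h                                     ≡⟨ sum-extend n 3 (vanishes n) ⟨
    sumTo (3 ℕ.+ n) h
      ≡⟨ trans (sumTo-first (2 ℕ.+ n) h) (cong (_+_ (h 0)) (trans (sumTo-first (suc n) (λ i → h (suc i))) (cong (_+_ (h 1)) (sumTo-first n (λ i → h (2 ℕ.+ i)))))) ⟩
    h 0 + (h 1 + (h 2 + allHeights n 0))
      ≡⟨ cong₂ _+_ (heightSeries-0 n 0) (cong₂ _+_ (heightSeries-1 n 0) (cong (_+ allHeights n 0) (heightSeries-2 n 0))) ⟩
    (𝟙 ⊕ ((eˣ ⊖ 𝟙) ⊕ ((e⁻ˣ ⊗ Ψ ⊖ eˣ) ⊕ allHeights))) n 0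
      ≡⟨ solve 3 (λ e a s → :1 :+ ((e :- :1) :+ ((a :- e) :+ s)) := a :+ s) (λ _ _ → refl) eˣ (e⁻ˣ ⊗ Ψ) allHeights n 0 ⟩
    total n 0 ∎
    where
    open ≡-Reasoning
    open Solver
    h : ℕ → ℚ
    h k = heightSeries k n 0

theorem8p3 : (w : ℕ → ℕ → ℕ) →
    (∀ n k → IsCardinality (Counted n k) (w n k)) →
    (∀ n k → EGF₂ w n k ≡ RHS₁ n k) × (∀ n k → EGF₁ w n k ≡ RHS₂ n k)
theorem8p3 w card =
  (λ n k → trans (count w card n k) (sym (RHS₁-coefficient n k))) ,
  λ n k → trans (EGF₁-total w card n k) (sym (RHS₂-total w card n k))
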